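{- Let $K$ be a real biquadratic field, with quadratic subfields $K_1,K_2,K_3$. Then for at least two of the indices $j\in\{1,2,3\}$, the indecomposable elements in $\mathcal{O}_{K_j}^+$ remain indecomposable in $\mathcal{O}_K^+$ (that is, every indecomposable element of $\mathcal{O}_{K_j}^+$ is an indecomposable element of $\mathcal{O}_K^+$).
   Context: A real biquadratic field is a field $\mathbb{Q}(\sqrt{p},\sqrt{q})$ of degree $4$ over $\mathbb{Q}$ with $p,q$ positive integers; it has exactly three quadratic subfields. For a totally real number field $F$ with ring of integers $\mathcal{O}_F$, $\mathcal{O}_F^+$ denotes the set of elements of $\mathcal{O}_F$ that are positive under every embedding $F\hookrightarrow\mathbb{R}$ (totally positive). An element $\alpha\in\mathcal{O}_F^+$ is indecomposable (in $\mathcal{O}_F^+$) if it cannot be written as $\alpha=\beta+\gamma$ with $\beta,\gamma\in\mathcal{O}_F^+$. -}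

module Defs where

open import Level using (Level; _⊔_) renaming (suc to lsuc; zero to 0ℓ)
open import Algebra.Bundles using (CommutativeRing; RawRing)
open import Algebra.Morphism.Structures using (IsRingHomomorphism; IsRingMonomorphism)
import Algebra.Properties.CommutativeMonoid.Sum as Sum
open import Data.Fin.Base using (Fin)
open import Data.Integer.Base as ℤ using (ℤ)
open import Data.List.Base using (List; []; _∷_)
open import Data.Nat.Base as ℕ using (ℕ)
import Data.Nat.Properties as ℕ
open import Data.Product.Base using (∃-syntax; ∃₂; _×_; _,_)
open import Data.Rational.Base as ℚ using (ℚ; 0ℚ; 1ℚ; ½)
import Data.Rational.Properties as ℚ
open import Algebra.Properties.CommutativeSemigroup
  (CommutativeRing.+-commutativeSemigroup ℚ.+-*-commutativeRing) using (interchange)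
open import Relation.Binary.PropositionalEquality
  using (_≡_; sym; trans; cong; cong₂; subst; module ≡-Reasoning)
open import Relation.Nullary.Negation using (¬_)

------------------------------------------------------------------------
-- Real numbers, as Cauchy sequences of rationals

-- The modulus is existential, so the representing sequences are arbitrary
-- Cauchy sequences and the operations below are all pointwise.
IsCauchy : (ℕ → ℚ) → Set
IsCauchy x = ∀ ε → 0ℚ ℚ.< ε →
  ∃[ N ] ∀ m n → N ℕ.≤ m → N ℕ.≤ n → ℚ.∣ x m ℚ.- x n ∣ ℚ.< ε

record ℝ : Set where
  constructor mkℝ
  field
    seq    : ℕ → ℚ
    cauchy : IsCauchy seq

open ℝ public

infix 4 _≈ℝ_

_≈ℝ_ : ℝ → ℝ → Set
x ≈ℝ y = ∀ ε → 0ℚ ℚ.< ε →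
  ∃[ N ] ∀ n → N ℕ.≤ n → ℚ.∣ seq x n ℚ.- seq y n ∣ ℚ.< ε

Positiveℝ : ℝ → Set
Positiveℝ x = ∃[ ε ] 0ℚ ℚ.< ε × ∃[ N ] (∀ n → N ℕ.≤ n → ε ℚ.≤ seq x n)

half+half : ∀ ε → ε ℚ.* ½ ℚ.+ ε ℚ.* ½ ≡ ε
half+half ε = trans (sym (ℚ.*-distribˡ-+ ε ½ ½)) (ℚ.*-identityʳ ε)

*-pos : ∀ {p q} → 0ℚ ℚ.< p → 0ℚ ℚ.< q → 0ℚ ℚ.< p ℚ.* q
*-pos {p} {q} 0<p 0<q =
  subst (ℚ._< p ℚ.* q) (ℚ.*-zeroˡ q) (ℚ.*-monoˡ-<-pos q {{ℚ.positive 0<q}} 0<p)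

add-back : ∀ a c → a ≡ (a ℚ.- c) ℚ.+ c
add-back a c = sym (trans (ℚ.+-assoc a (ℚ.- c) c)
  (trans (cong (a ℚ.+_) (ℚ.+-inverseˡ c)) (ℚ.+-identityʳ a)))

diff-+ : ∀ a b c d → (a ℚ.+ b) ℚ.- (c ℚ.+ d) ≡ (a ℚ.- c) ℚ.+ (b ℚ.- d)
diff-+ a b c d = trans (cong ((a ℚ.+ b) ℚ.+_) (ℚ.neg-distrib-+ c d))
  (interchange a b (ℚ.- c) (ℚ.- d))

diff-neg : ∀ a c → (ℚ.- a) ℚ.- (ℚ.- c) ≡ ℚ.- (a ℚ.- c)
diff-neg a c = sym (ℚ.neg-distrib-+ a (ℚ.- c))

*-distribˡ-- : ∀ a b c → a ℚ.* (b ℚ.- c) ≡ a ℚ.* b ℚ.- a ℚ.* c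
*-distribˡ-- a b c = trans (ℚ.*-distribˡ-+ a b (ℚ.- c))
  (cong (a ℚ.* b ℚ.+_) (sym (ℚ.neg-distribʳ-* a c)))

diff-* : ∀ a b c d →
  (a ℚ.* b) ℚ.- (c ℚ.* d) ≡ a ℚ.* (b ℚ.- d) ℚ.+ d ℚ.* (a ℚ.- c)
diff-* a b c d = begin
  a ℚ.* b ℚ.- c ℚ.* d
    ≡⟨ cong (ℚ._- c ℚ.* d) (add-back (a ℚ.* b) (a ℚ.* d)) ⟩
  (a ℚ.* b ℚ.- a ℚ.* d) ℚ.+ a ℚ.* d ℚ.- c ℚ.* d
    ≡⟨ ℚ.+-assoc (a ℚ.* b ℚ.- a ℚ.* d) (a ℚ.* d) (ℚ.- (c ℚ.* d)) ⟩
  (a ℚ.* b ℚ.- a ℚ.* d) ℚ.+ (a ℚ.* d ℚ.- c ℚ.* d)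
    ≡⟨ cong₂ ℚ._+_ (sym (*-distribˡ-- a b d))
         (trans (cong₂ ℚ._-_ (ℚ.*-comm a d) (ℚ.*-comm c d)) (sym (*-distribˡ-- d a c))) ⟩
  a ℚ.* (b ℚ.- d) ℚ.+ d ℚ.* (a ℚ.- c) ∎
  where open ≡-Reasoning

+-cauchy : ∀ x y → IsCauchy x → IsCauchy y → IsCauchy (λ n → x n ℚ.+ y n)
+-cauchy x y cx cy ε 0<ε
  with cx (ε ℚ.* ½) (*-pos 0<ε (ℚ.positive⁻¹ ½)) | cy (ε ℚ.* ½) (*-pos 0<ε (ℚ.positive⁻¹ ½))
... | M , hM | N , hN = M ℕ.⊔ N , λ m n m≥ n≥ → begin-strict
  ℚ.∣ (x m ℚ.+ y m) ℚ.- (x n ℚ.+ y n) ∣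
    ≡⟨ cong ℚ.∣_∣ (diff-+ (x m) (y m) (x n) (y n)) ⟩
  ℚ.∣ (x m ℚ.- x n) ℚ.+ (y m ℚ.- y n) ∣
    ≤⟨ ℚ.∣p+q∣≤∣p∣+∣q∣ (x m ℚ.- x n) (y m ℚ.- y n) ⟩
  ℚ.∣ x m ℚ.- x n ∣ ℚ.+ ℚ.∣ y m ℚ.- y n ∣
    <⟨ ℚ.+-mono-< (hM m n (ℕ.m⊔n≤o⇒m≤o M N m≥) (ℕ.m⊔n≤o⇒m≤o M N n≥))
                  (hN m n (ℕ.m⊔n≤o⇒n≤o M N m≥) (ℕ.m⊔n≤o⇒n≤o M N n≥)) ⟩
  ε ℚ.* ½ ℚ.+ ε ℚ.* ½
    ≡⟨ half+half ε ⟩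
  ε ∎
  where open ℚ.≤-Reasoning

neg-cauchy : ∀ x → IsCauchy x → IsCauchy (λ n → ℚ.- x n)
neg-cauchy x cx ε 0<ε with cx ε 0<ε
... | N , hN = N , λ m n m≥ n≥ →
  subst (ℚ._< ε)
    (sym (trans (cong ℚ.∣_∣ (diff-neg (x m) (x n))) (ℚ.∣-p∣≡∣p∣ (x m ℚ.- x n))))
    (hN m n m≥ n≥)

const-cauchy : ∀ q → IsCauchy (λ _ → q)
const-cauchy q ε 0<ε =
  0 , λ _ _ _ _ → subst (λ z → ℚ.∣ z ∣ ℚ.< ε) (sym (ℚ.+-inverseʳ q)) 0<ε

bounded : ∀ {x} → IsCauchy x →
  ∃[ B ] 0ℚ ℚ.< B × ∃[ N ] (∀ n → N ℕ.≤ n → ℚ.∣ x n ∣ ℚ.≤ B)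
bounded {x} cx with cx 1ℚ (ℚ.positive⁻¹ 1ℚ)
... | N , hN = 1ℚ ℚ.+ ℚ.∣ x N ∣
  , ℚ.+-mono-<-≤ (ℚ.positive⁻¹ 1ℚ) (ℚ.0≤∣p∣ (x N))
  , N , λ n n≥ → begin
    ℚ.∣ x n ∣                          ≡⟨ cong ℚ.∣_∣ (add-back (x n) (x N)) ⟩
    ℚ.∣ (x n ℚ.- x N) ℚ.+ x N ∣        ≤⟨ ℚ.∣p+q∣≤∣p∣+∣q∣ (x n ℚ.- x N) (x N) ⟩
    ℚ.∣ x n ℚ.- x N ∣ ℚ.+ ℚ.∣ x N ∣    ≤⟨ ℚ.+-monoˡ-≤ ℚ.∣ x N ∣ (ℚ.<⇒≤ (hN n N n≥ ℕ.≤-refl)) ⟩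
    1ℚ ℚ.+ ℚ.∣ x N ∣                   ∎
  where open ℚ.≤-Reasoning

*-small : ∀ {B δ} a b → 0ℚ ℚ.< B → ℚ.∣ a ∣ ℚ.≤ B → ℚ.∣ b ∣ ℚ.< δ →
  ℚ.∣ a ℚ.* b ∣ ℚ.< B ℚ.* δ
*-small {B} {δ} a b 0<B a≤B b<δ = begin-strict
  ℚ.∣ a ℚ.* b ∣          ≡⟨ ℚ.∣p*q∣≡∣p∣*∣q∣ a b ⟩
  ℚ.∣ a ∣ ℚ.* ℚ.∣ b ∣    ≤⟨ ℚ.*-monoʳ-≤-nonNeg ℚ.∣ b ∣ {{ℚ.nonNegative (ℚ.0≤∣p∣ b)}} a≤B ⟩
  B ℚ.* ℚ.∣ b ∣          <⟨ ℚ.*-monoʳ-<-pos B {{ℚ.positive 0<B}} b<δ ⟩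
  B ℚ.* δ                ∎
  where open ℚ.≤-Reasoning

shrink : ∀ B ε → 0ℚ ℚ.< B → 0ℚ ℚ.< ε → ∃[ δ ] 0ℚ ℚ.< δ × B ℚ.* δ ≡ ε
shrink B ε 0<B 0<ε = B⁻¹ ℚ.* ε
  , *-pos (ℚ.positive⁻¹ B⁻¹ {{ℚ.1/pos⇒pos B}}) 0<ε
  , trans (sym (ℚ.*-assoc B B⁻¹ ε))
      (trans (cong (ℚ._* ε) (ℚ.*-inverseʳ B)) (ℚ.*-identityˡ ε))
  where
  instance
    B-pos : ℚ.Positive B
    B-pos = ℚ.positive 0<B
    B-nonZero : ℚ.NonZero B
    B-nonZero = ℚ.pos⇒nonZero B
  B⁻¹ : ℚ
  B⁻¹ = ℚ.1/ B

*-cauchy : ∀ x y → IsCauchy x → IsCauchy y → IsCauchy (λ n → x n ℚ.* y n)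
*-cauchy x y cx cy ε 0<ε
  with bounded cx | bounded cy
... | B , 0<B , M₁ , hB | C , 0<C , M₂ , hC
  with shrink (B ℚ.+ C) ε (ℚ.+-mono-< 0<B 0<C) 0<ε
... | δ , 0<δ , eq
  with cx δ 0<δ | cy δ 0<δ
... | M₃ , hx | M₄ , hy = (M₁ ℕ.⊔ M₂) ℕ.⊔ (M₃ ℕ.⊔ M₄) , λ m n m≥ n≥ →
  let m₁ = ℕ.m⊔n≤o⇒m≤o M₁ M₂ (ℕ.m⊔n≤o⇒m≤o (M₁ ℕ.⊔ M₂) (M₃ ℕ.⊔ M₄) m≥)
      m₃₄ = ℕ.m⊔n≤o⇒n≤o (M₁ ℕ.⊔ M₂) (M₃ ℕ.⊔ M₄) m≥
      n₂ = ℕ.m⊔n≤o⇒n≤o M₁ M₂ (ℕ.m⊔n≤o⇒m≤o (M₁ ℕ.⊔ M₂) (M₃ ℕ.⊔ M₄) n≥)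
      n₃₄ = ℕ.m⊔n≤o⇒n≤o (M₁ ℕ.⊔ M₂) (M₃ ℕ.⊔ M₄) n≥
  in begin-strict
  ℚ.∣ x m ℚ.* y m ℚ.- x n ℚ.* y n ∣
    ≡⟨ cong ℚ.∣_∣ (diff-* (x m) (y m) (x n) (y n)) ⟩
  ℚ.∣ x m ℚ.* (y m ℚ.- y n) ℚ.+ y n ℚ.* (x m ℚ.- x n) ∣
    ≤⟨ ℚ.∣p+q∣≤∣p∣+∣q∣ (x m ℚ.* (y m ℚ.- y n)) (y n ℚ.* (x m ℚ.- x n)) ⟩
  ℚ.∣ x m ℚ.* (y m ℚ.- y n) ∣ ℚ.+ ℚ.∣ y n ℚ.* (x m ℚ.- x n) ∣
    <⟨ ℚ.+-mono-<
         (*-small (x m) (y m ℚ.- y n) 0<B (hB m m₁)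
           (hy m n (ℕ.m⊔n≤o⇒n≤o M₃ M₄ m₃₄) (ℕ.m⊔n≤o⇒n≤o M₃ M₄ n₃₄)))
         (*-small (y n) (x m ℚ.- x n) 0<C (hC n n₂)
           (hx m n (ℕ.m⊔n≤o⇒m≤o M₃ M₄ m₃₄) (ℕ.m⊔n≤o⇒m≤o M₃ M₄ n₃₄))) ⟩
  B ℚ.* δ ℚ.+ C ℚ.* δ
    ≡⟨ sym (ℚ.*-distribʳ-+ δ B C) ⟩
  (B ℚ.+ C) ℚ.* δ
    ≡⟨ eq ⟩
  ε ∎
  where open ℚ.≤-Reasoning

ℝ-rawRing : RawRing 0ℓ 0ℓ
ℝ-rawRing = record
  { Carrier = ℝ
  ; _≈_     = _≈ℝ_
  ; _+_     = λ x y → mkℝ (λ n → seq x n ℚ.+ seq y n) (+-cauchy (seq x) (seq y) (cauchy x) (cauchy y))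
  ; _*_     = λ x y → mkℝ (λ n → seq x n ℚ.* seq y n) (*-cauchy (seq x) (seq y) (cauchy x) (cauchy y))
  ; -_      = λ x → mkℝ (λ n → ℚ.- seq x n) (neg-cauchy (seq x) (cauchy x))
  ; 0#      = mkℝ (λ _ → 0ℚ) (const-cauchy 0ℚ)
  ; 1#      = mkℝ (λ _ → 1ℚ) (const-cauchy 1ℚ)
  }

------------------------------------------------------------------------
-- Number fields

-- A field that is finite-dimensional over ℚ.  The homomorphism ι and the
-- number `degree` are uniquely determined by the ring; `basis` is a choice of
-- ℚ-basis, on which none of the notions below depend.
record NumberField (c ℓ : Level) : Set (lsuc (c ⊔ ℓ)) where
  field
    commutativeRing : CommutativeRing c ℓ

  open CommutativeRing commutativeRing public
    hiding (refl; sym; trans)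

  open Sum +-commutativeMonoid public using (sum)

  field
    1≉0     : ¬ (1# ≈ 0#)
    inverse : ∀ x → ¬ (x ≈ 0#) → ∃[ y ] x * y ≈ 1#
    ι       : ℚ → Carrier
    ι-homo  : IsRingHomomorphism ℚ.+-*-rawRing rawRing ι
    degree  : ℕ
    basis   : Fin degree → Carrier

  combination : (Fin degree → ℚ) → Carrier
  combination a = sum (λ i → ι (a i) * basis i)

  field
    spans       : ∀ x → ∃[ a ] x ≈ combination a
    independent : ∀ a → combination a ≈ 0# → ∀ i → a i ≡ 0ℚ

  ιℤ : ℤ → Carrier
  ιℤ z = ι (z ℚ./ 1)

module _ {c ℓ : Level} (F : NumberField c ℓ) where
  open NumberField F

  -- The value at x of the monic integer polynomial
  -- a₀ + a₁ X + … + aₙ₋₁ Xⁿ⁻¹ + Xⁿ, given by the list a₀ ∷ … ∷ aₙ₋₁ ∷ [].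
  evalMonic : List ℤ → Carrier → Carrier
  evalMonic []       x = 1#
  evalMonic (a ∷ as) x = ιℤ a + x * evalMonic as x

  -- Membership in the ring of integers 𝒪_F.
  Integral : Carrier → Set ℓ
  Integral x = ∃[ as ] evalMonic as x ≈ 0#

  TotallyPositive : Carrier → Set (c ⊔ ℓ)
  TotallyPositive x =
    ∀ (σ : Carrier → ℝ) → IsRingMonomorphism rawRing ℝ-rawRing σ → Positiveℝ (σ x)

  -- Membership in 𝒪_F⁺.
  𝒪⁺ : Carrier → Set (c ⊔ ℓ)
  𝒪⁺ x = Integral x × TotallyPositive x

  Indecomposable : Carrier → Set (c ⊔ ℓ)
  Indecomposable α =
    𝒪⁺ α × ¬ (∃₂ λ β γ → 𝒪⁺ β × 𝒪⁺ γ × α ≈ β + γ)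

  -- The subfield ℚ(s , t), i.e. the closure of {s , t} under the field
  -- operations (`inv` says that it contains the inverses of its elements).
  data Adjoin (s t : Carrier) : Carrier → Set (c ⊔ ℓ) where
    gen₁ : Adjoin s t s
    gen₂ : Adjoin s t t
    rat  : ∀ a → Adjoin s t (ι a)
    add  : ∀ {x y} → Adjoin s t x → Adjoin s t y → Adjoin s t (x + y)
    neg  : ∀ {x} → Adjoin s t x → Adjoin s t (- x)
    mul  : ∀ {x y} → Adjoin s t x → Adjoin s t y → Adjoin s t (x * y)
    inv  : ∀ {x y} → x * y ≈ 1# → Adjoin s t x → Adjoin s t y
    resp : ∀ {x y} → x ≈ y → Adjoin s t x → Adjoin s t y

  record IsRealBiquadratic : Set (c ⊔ ℓ) where
    field
      p q       : ℕ
      p>0       : 0 ℕ.< p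
      q>0       : 0 ℕ.< q
      √p √q     : Carrier
      √p²≈p     : √p * √p ≈ ιℤ (ℤ.+ p)
      √q²≈q     : √q * √q ≈ ιℤ (ℤ.+ q)
      generated : ∀ x → Adjoin √p √q x
      degree≡4  : degree ≡ 4

-- A quadratic subfield of K, given as a quadratic field together with its
-- inclusion into K.
record QuadraticSubfield {c ℓ : Level} (K : NumberField c ℓ) (c′ ℓ′ : Level) :
    Set (c ⊔ ℓ ⊔ lsuc (c′ ⊔ ℓ′)) where
  field
    field′    : NumberField c′ ℓ′
    degree≡2  : NumberField.degree field′ ≡ 2
    incl      : NumberField.Carrier field′ → NumberField.Carrier K
    incl-mono : IsRingMonomorphism (NumberField.rawRing field′) (NumberField.rawRing K) incl

module _ {c ℓ c′ ℓ′ : Level} {K : NumberField c ℓ} where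
  open NumberField K using (Carrier; _≈_)
  open QuadraticSubfield

  infix 4 _∈ₛ_ _≐ₛ_

  _∈ₛ_ : Carrier → QuadraticSubfield K c′ ℓ′ → Set (ℓ ⊔ c′)
  x ∈ₛ L = ∃[ y ] incl L y ≈ x

  _≐ₛ_ : (L L′ : QuadraticSubfield K c′ ℓ′) → Set (c ⊔ ℓ ⊔ c′)
  L ≐ₛ L′ = ∀ x → (x ∈ₛ L → x ∈ₛ L′) × (x ∈ₛ L′ → x ∈ₛ L)

  IndecomposablesRemain : QuadraticSubfield K c′ ℓ′ → Set (c ⊔ ℓ ⊔ c′ ⊔ ℓ′)
  IndecomposablesRemain L =
    ∀ α → Indecomposable (field′ L) α → Indecomposable K (incl L α)

{-# OPTIONS --safe #-}
module Submission where

-- Let L₁ ≠ L₂ be two of the subfields, with fundamental discriminants D₁ , D₂ > 0.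
-- A primitive totally positive α in the order O₁ of L₁ has a partner η with
-- O₁ = ℤα + ℤη; if it is reduced modulo α, then N(η) > 0 would make
-- α = η + (α - η) a decomposition, so N(η) < 0 when α is indecomposable.  If now
-- α = β + γ in K, positivity forces Tr(β) = α + nη (traces to L₁).  The four
-- conjugates of υ = η̄β have known signs, and Tr(υ) to L₂ is (A + B√D₂)/2 with
-- A ≡ D₁ (mod 2); comparing signs gives B²D₂ < D₁.  On the other hand, the
-- integrality of the trace and of the norm of υ to L₂ is impossible for B = 0 if
-- v₂(D₁) = v₂(D₂), and for every B if v₂(D₁) < v₂(D₂), by congruences modulo 8.
-- Hence the indecomposables of L₁ remain indecomposable whenever (v₂(D₁) , D₁)
-- precedes (v₂(D₂) , D₂) lexicographically, which fails for at most one subfield.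

open import Defs
open import Level using (Level; _⊔_) renaming (suc to lsuc; zero to 0ℓ)
open import Algebra.Bundles using (CommutativeRing; RawRing)
import Algebra.Morphism.Construct.Composition as Composition
open import Algebra.Morphism.Structures using (IsRingHomomorphism; IsRingMonomorphism)
import Algebra.Properties.CommutativeMonoid.Sum as Sum
import Algebra.Properties.Group as GroupProperties
import Algebra.Properties.Ring as RingProperties
import Algebra.Solver.Ring as RingSolver
import Algebra.Solver.Ring.AlmostCommutativeRing as ACR
import Algebra.Solver.Ring.NaturalCoefficients.Default as NaturalSolver
open import Data.Empty using (⊥; ⊥-elim)
open import Data.Fin.Base using (Fin; zero; suc; punchIn)
open import Data.Fin.Patterns using (0F; 1F; 2F; 3F; 4F; 5F)
import Data.Fin.Properties as Fin
open import Data.Integer.Base as ℤ using (ℤ; +_; -[1+_]; 0ℤ; 1ℤ)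
open import Data.Integer.DivMod using (_%ℕ_; _/ℕ_; n%ℕd<d; a≡a%ℕn+[a/ℕn]*n)
open import Data.Integer.Divisibility.Signed using (_∣_; _∣?_; divides; ∣ᵤ⇒∣; ∣⇒∣ᵤ)
import Data.Integer.Properties as ℤ
open import Data.List.Base using ([]; _∷_; length)
open import Data.Maybe.Base using (Maybe; just; nothing)
open import Data.Nat.Base as ℕ using (ℕ; zero; suc)
import Data.Nat.Coprimality as Coprimality
import Data.Nat.Divisibility as ℕ∣
import Data.Nat.GCD as GCD
open import Data.Nat.Induction using (<-wellFounded)
import Data.Nat.Properties as ℕ
import Data.Nat.Tactic.RingSolver as ℕ-RingSolver
open import Data.Product.Base using (∃-syntax; ∃₂; _×_; _,_; proj₁; proj₂)
open import Data.Rational.Base as ℚ using (ℚ; 0ℚ; 1ℚ; ½; toℚᵘ)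
import Data.Rational.Properties as ℚ
open import Data.Rational.Unnormalised.Base as ℚᵘ using (mkℚᵘ; *≡*; *≤*)
import Data.Rational.Unnormalised.Properties as ℚᵘ
open import Data.Sum.Base as ⊎ using (_⊎_; inj₁; inj₂)
open import Data.Vec.Base using ([]; _∷_)
open import Data.Vec.Functional using (insertAt)
open import Data.Vec.Functional.Properties using (insertAt-lookup; insertAt-punchIn)
open import Function.Base using (_∘_)
open import Induction.WellFounded using (Acc; acc)
open import Relation.Binary.Definitions using (Tri; tri<; tri≈; tri>)
open import Relation.Binary.PropositionalEquality
  using (_≡_; _≢_; refl; sym; trans; cong; cong₂; subst; subst₂; module ≡-Reasoning)
open import Relation.Nullary.Decidable using (Dec; yes; no; ¬?; _⊎-dec_)
open import Relation.Nullary.Negation using (¬_; contradiction)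

-- Integers inside the rationals

private module ℚ-Ring = RingProperties (CommutativeRing.ring ℚ.+-*-commutativeRing)

fromℤ : ℤ → ℚ
fromℤ z = z ℚ./ 1

toℚᵘ-fromℤ : ∀ z → toℚᵘ (fromℤ z) ℚᵘ.≃ mkℚᵘ z 0
toℚᵘ-fromℤ z = ℚ.toℚᵘ-fromℚᵘ (mkℚᵘ z 0)

fromℤ-+ : ∀ m n → fromℤ (m ℤ.+ n) ≡ fromℤ m ℚ.+ fromℤ n
fromℤ-+ m n = ℚ.toℚᵘ-injective (begin
  toℚᵘ (fromℤ (m ℤ.+ n))  ≈⟨ toℚᵘ-fromℤ (m ℤ.+ n) ⟩
  mkℚᵘ (m ℤ.+ n) 0  ≈⟨ *≡* (cong (ℤ._* 1ℤ) (cong₂ ℤ._+_ (sym (ℤ.*-identityʳ m)) (sym (ℤ.*-identityʳ n)))) ⟩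
  mkℚᵘ m 0 ℚᵘ.+ mkℚᵘ n 0  ≈⟨ ℚᵘ.+-cong (toℚᵘ-fromℤ m) (toℚᵘ-fromℤ n) ⟨
  toℚᵘ (fromℤ m) ℚᵘ.+ toℚᵘ (fromℤ n)  ≈⟨ ℚ.toℚᵘ-homo-+ (fromℤ m) (fromℤ n) ⟨
  toℚᵘ (fromℤ m ℚ.+ fromℤ n)  ∎)
  where open import Relation.Binary.Reasoning.Setoid ℚᵘ.≃-setoid

fromℤ-* : ∀ m n → fromℤ (m ℤ.* n) ≡ fromℤ m ℚ.* fromℤ n
fromℤ-* m n = ℚ.toℚᵘ-injective (begin
  toℚᵘ (fromℤ (m ℤ.* n))  ≈⟨ toℚᵘ-fromℤ (m ℤ.* n) ⟩
  mkℚᵘ m 0 ℚᵘ.* mkℚᵘ n 0  ≈⟨ ℚᵘ.*-cong (toℚᵘ-fromℤ m) (toℚᵘ-fromℤ n) ⟨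
  toℚᵘ (fromℤ m) ℚᵘ.* toℚᵘ (fromℤ n)  ≈⟨ ℚ.toℚᵘ-homo-* (fromℤ m) (fromℤ n) ⟨
  toℚᵘ (fromℤ m ℚ.* fromℤ n)  ∎)
  where open import Relation.Binary.Reasoning.Setoid ℚᵘ.≃-setoid

fromℤ-neg : ∀ z → fromℤ (ℤ.- z) ≡ ℚ.- fromℤ z
fromℤ-neg (+ zero)  = refl
fromℤ-neg (+ suc n) = refl
fromℤ-neg -[1+ n ]  = sym (ℚ-Ring.-‿involutive (fromℤ (+ suc n)))

fromℤ-minus : ∀ m n → fromℤ (m ℤ.- n) ≡ fromℤ m ℚ.- fromℤ n
fromℤ-minus m n = trans (fromℤ-+ m (ℤ.- n)) (cong (fromℤ m ℚ.+_) (fromℤ-neg n))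

fromℤ-injective : ∀ {m n} → fromℤ m ≡ fromℤ n → m ≡ n
fromℤ-injective {m} {n} eq = trans (sym (ℤ.*-identityʳ m)) (trans (ℚᵘ.drop-*≡* m≃n) (ℤ.*-identityʳ n))
  where
  m≃n : mkℚᵘ m 0 ℚᵘ.≃ mkℚᵘ n 0
  m≃n = ℚ.fromℚᵘ-injective eq

fromℤ-pos : ∀ {z} → 0ℤ ℤ.< z → 0ℚ ℚ.< fromℤ z
fromℤ-pos {+ suc n} (ℤ.+<+ _) = ℚ.positive⁻¹ (fromℤ (+ suc n)) {{ℚ.normalize-pos (suc n) 1}}

↧*≡↥ : ∀ q → q ℚ.* fromℤ (ℚ.↧ q) ≡ fromℤ (ℚ.↥ q)
↧*≡↥ q@(ℚ.mkℚ n d-1 _) = ℚ.toℚᵘ-injective (begin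
  toℚᵘ (q ℚ.* fromℤ d)  ≈⟨ ℚ.toℚᵘ-homo-* q (fromℤ d) ⟩
  mkℚᵘ n d-1 ℚᵘ.* toℚᵘ (fromℤ d)  ≈⟨ ℚᵘ.*-congˡ (toℚᵘ-fromℤ d) ⟩
  mkℚᵘ n d-1 ℚᵘ.* mkℚᵘ d 0  ≈⟨ *≡* (trans (ℤ.*-identityʳ (n ℤ.* d)) (cong (λ k → n ℤ.* + k) (sym (ℕ.*-identityʳ (suc d-1))))) ⟩
  mkℚᵘ n 0  ≈⟨ toℚᵘ-fromℤ n ⟨
  toℚᵘ (fromℤ n)  ∎)
  where
  open import Relation.Binary.Reasoning.Setoid ℚᵘ.≃-setoid
  d = + suc d-1

module IntegerSolver {c ℓ} (R : CommutativeRing c ℓ)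
  (f : ℤ → CommutativeRing.Carrier R)
  (+-homo : ∀ m n → CommutativeRing._≈_ R (f (m ℤ.+ n)) (CommutativeRing._+_ R (f m) (f n)))
  (*-homo : ∀ m n → CommutativeRing._≈_ R (f (m ℤ.* n)) (CommutativeRing._*_ R (f m) (f n)))
  (-‿homo : ∀ m → CommutativeRing._≈_ R (f (ℤ.- m)) (CommutativeRing.-_ R (f m)))
  (0-homo : CommutativeRing._≈_ R (f 0ℤ) (CommutativeRing.0# R))
  (1-homo : CommutativeRing._≈_ R (f 1ℤ) (CommutativeRing.1# R))
  where

  private
    ℤ-rawRing = CommutativeRing.rawRing ℤ.+-*-commutativeRing
    target = ACR.fromCommutativeRing R

    morphism : ℤ-rawRing ACR.-Raw-AlmostCommutative⟶ target
    morphism = record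
      { ⟦_⟧ = f ; +-homo = +-homo ; *-homo = *-homo
      ; -‿homo = -‿homo ; 0-homo = 0-homo ; 1-homo = 1-homo }

    dec : ∀ m n → Maybe (CommutativeRing._≈_ R (f m) (f n))
    dec m n with m ℤ.≟ n
    ... | yes eq = just (CommutativeRing.reflexive R (cong f eq))
    ... | no _   = nothing

  open RingSolver ℤ-rawRing target morphism dec public

module ℚS = IntegerSolver ℚ.+-*-commutativeRing fromℤ fromℤ-+ fromℤ-* fromℤ-neg refl refl
module ℤS = IntegerSolver ℤ.+-*-commutativeRing (λ z → z) (λ _ _ → refl) (λ _ _ → refl) (λ _ → refl) refl refl

module FieldProperties {c ℓ} (F : NumberField c ℓ) where
  open NumberField F public hiding (zero)
  open CommutativeRing commutativeRing public using ()
    renaming (refl to ≈-refl; sym to ≈-sym; trans to ≈-trans)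
  open RingProperties ring public using (-‿involutive)
  open import Algebra.Properties.Monoid.Sum +-monoid using (sum-cong-≋; sum-replicate-zero)

  private
    module ι = IsRingHomomorphism ι-homo

  ι-+ : ∀ a b → ι (a ℚ.+ b) ≈ ι a + ι b
  ι-+ = ι.+-homo

  ι-* : ∀ a b → ι (a ℚ.* b) ≈ ι a * ι b
  ι-* = ι.*-homo

  ι-neg : ∀ a → ι (ℚ.- a) ≈ - ι a
  ι-neg = ι.-‿homo

  ι0 : ι 0ℚ ≈ 0#
  ι0 = ι.0#-homo

  ι1 : ι 1ℚ ≈ 1#
  ι1 = ι.1#-homo

  ι-cong : ∀ {a b} → a ≡ b → ι a ≈ ι b
  ι-cong refl = ≈-refl

  ιℤ-+ : ∀ m n → ιℤ (m ℤ.+ n) ≈ ιℤ m + ιℤ n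
  ιℤ-+ m n = ≈-trans (ι-cong (fromℤ-+ m n)) (ι-+ _ _)

  ιℤ-* : ∀ m n → ιℤ (m ℤ.* n) ≈ ιℤ m * ιℤ n
  ιℤ-* m n = ≈-trans (ι-cong (fromℤ-* m n)) (ι-* _ _)

  ιℤ-neg : ∀ m → ιℤ (ℤ.- m) ≈ - ιℤ m
  ιℤ-neg m = ≈-trans (ι-cong (fromℤ-neg m)) (ι-neg _)

  ιℤ-cong : ∀ {a b} → a ≡ b → ιℤ a ≈ ιℤ b
  ιℤ-cong refl = ≈-refl

  module FS = IntegerSolver commutativeRing ιℤ ιℤ-+ ιℤ-* ιℤ-neg ι0 ι1

  x-y≈0⇒x≈y : ∀ x y → x - y ≈ 0# → x ≈ y
  x-y≈0⇒x≈y x y eq = ≈-trans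
    (FS.solve 2 (λ x y → x FS.:= (x FS.:- y) FS.:+ y) ≈-refl x y)
    (≈-trans (+-congʳ eq) (+-identityˡ y))

  x≈y⇒x-y≈0 : ∀ {x y} → x ≈ y → x - y ≈ 0#
  x≈y⇒x-y≈0 {x} {y} eq = ≈-trans (+-congʳ eq) (-‿inverseʳ y)

  combination-zero : ∀ a → (∀ i → a i ≡ 0ℚ) → combination a ≈ 0#
  combination-zero a a≡0 = ≈-trans
    (sum-cong-≋ (λ i → ≈-trans (*-congʳ (≈-trans (ι-cong (a≡0 i)) ι0)) (zeroˡ (basis i))))
    (sum-replicate-zero degree)

  infix 4 _≈?_
  _≈?_ : ∀ x y → Dec (x ≈ y)
  x ≈? y with spans (x - y)
  ... | a , eq with Fin.all? (λ i → a i ℚ.≟ 0ℚ)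
  ...   | yes a≡0 = yes (x-y≈0⇒x≈y x y (≈-trans eq (combination-zero a a≡0)))
  ...   | no  a≢0 = no λ x≈y → a≢0 (independent a (≈-trans (≈-sym eq) (x≈y⇒x-y≈0 x≈y)))

  *-cancelʳ : ∀ {x y z} → ¬ (z ≈ 0#) → x * z ≈ y * z → x ≈ y
  *-cancelʳ {x} {y} {z} z≉0 eq with inverse z z≉0
  ... | w , zw≈1 = begin
    x  ≈⟨ *-identityʳ x ⟨
    x * 1#  ≈⟨ *-congˡ zw≈1 ⟨
    x * (z * w)  ≈⟨ *-assoc x z w ⟨
    x * z * w  ≈⟨ *-congʳ eq ⟩
    y * z * w  ≈⟨ *-assoc y z w ⟩
    y * (z * w)  ≈⟨ *-congˡ zw≈1 ⟩
    y * 1#  ≈⟨ *-identityʳ y ⟩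
    y  ∎
    where open import Relation.Binary.Reasoning.Setoid setoid

  xy≈0⇒x≈0 : ∀ {x y} → ¬ (y ≈ 0#) → x * y ≈ 0# → x ≈ 0#
  xy≈0⇒x≈0 {x} {y} y≉0 eq = *-cancelʳ y≉0 (≈-trans eq (≈-sym (zeroˡ y)))

  abstract
    1/ι : ∀ q → q ≢ 0ℚ → ∃[ r ] r ℚ.* q ≡ 1ℚ
    1/ι q q≢0 = ℚ.1/_ q {{ℚ.≢-nonZero q≢0}} , ℚ.*-inverseˡ q {{ℚ.≢-nonZero q≢0}}

  ι≉0 : ∀ {q} → q ≢ 0ℚ → ¬ (ι q ≈ 0#)
  ι≉0 {q} q≢0 ιq≈0 with 1/ι q q≢0
  ... | r , rq≡1 = 1≉0 (begin
    1#  ≈⟨ ι1 ⟨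
    ι 1ℚ  ≈⟨ ι-cong rq≡1 ⟨
    ι (r ℚ.* q) ≈⟨ ι-* r q ⟩
    ι r * ι q  ≈⟨ *-congˡ ιq≈0 ⟩
    ι r * 0#  ≈⟨ zeroʳ (ι r) ⟩
    0#  ∎)
    where open import Relation.Binary.Reasoning.Setoid setoid

  module _ (f : ℚ → Carrier) (f-homo : IsRingHomomorphism ℚ.+-*-rawRing rawRing f) where
    private module f = IsRingHomomorphism f-homo

    ι-uniqueℕ : ∀ n → f (fromℤ (+ n)) ≈ ιℤ (+ n)
    ι-uniqueℕ zero    = ≈-trans f.0#-homo (≈-sym ι0)
    ι-uniqueℕ (suc n) = begin
      f (fromℤ (+ suc n))  ≈⟨ f.⟦⟧-cong (fromℤ-+ 1ℤ (+ n)) ⟩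
      f (1ℚ ℚ.+ fromℤ (+ n))  ≈⟨ f.+-homo 1ℚ (fromℤ (+ n)) ⟩
      f 1ℚ + f (fromℤ (+ n))  ≈⟨ +-cong (≈-trans f.1#-homo (≈-sym ι1)) (ι-uniqueℕ n) ⟩
      ι 1ℚ + ιℤ (+ n)  ≈⟨ ιℤ-+ 1ℤ (+ n) ⟨
      ιℤ (+ suc n)  ∎
      where open import Relation.Binary.Reasoning.Setoid setoid

    ι-uniqueℤ : ∀ z → f (fromℤ z) ≈ ιℤ z
    ι-uniqueℤ (+ n)    = ι-uniqueℕ n
    ι-uniqueℤ -[1+ n ] = ≈-trans (f.-‿homo (fromℤ (+ suc n)))
      (≈-trans (-‿cong (ι-uniqueℕ (suc n))) (≈-sym (ι-neg (fromℤ (+ suc n)))))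

    ι-unique : ∀ q → f q ≈ ι q
    ι-unique q@(ℚ.mkℚ _ d-1 _) = *-cancelʳ (ι≉0 d≢0) (begin
      f q * ι d  ≈⟨ *-congˡ (ι-uniqueℤ (ℚ.↧ q)) ⟨
      f q * f d  ≈⟨ f.*-homo q d ⟨
      f (q ℚ.* d)  ≈⟨ f.⟦⟧-cong (↧*≡↥ q) ⟩
      f (fromℤ (ℚ.↥ q))  ≈⟨ ι-uniqueℤ (ℚ.↥ q) ⟩
      ι (fromℤ (ℚ.↥ q))  ≈⟨ ι-cong (↧*≡↥ q) ⟨
      ι (q ℚ.* d)  ≈⟨ ι-* q d ⟩
      ι q * ι d  ∎)
      where
      open import Relation.Binary.Reasoning.Setoid setoid
      d = fromℤ (ℚ.↧ q)
      d≢0 : d ≢ 0ℚ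
      d≢0 eq = case (fromℤ-injective {+ suc d-1} {0ℤ} eq)
        where
        case : + suc d-1 ≢ 0ℤ
        case ()

record Ordering {c ℓ} (F : NumberField c ℓ) : Set (lsuc 0ℓ ⊔ c ⊔ ℓ) where
  open NumberField F
  field
    P      : Carrier → Set
    P-resp : ∀ {x y} → x ≈ y → P x → P y
    P-+    : ∀ {x y} → P x → P y → P (x + y)
    P-*    : ∀ {x y} → P x → P y → P (x * y)
    P-irr  : ¬ P 0#
    P-dich : ∀ x → ¬ (x ≈ 0#) → P x ⊎ P (- x)

module OrderingProperties {c ℓ} {F : NumberField c ℓ} (O : Ordering F) where
  open FieldProperties F
  open Ordering O public
  open FS using (_:+_; _:*_; _:-_; :-_; _:=_; con)

  P⇒≉0 : ∀ {x} → P x → ¬ (x ≈ 0#)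
  P⇒≉0 px x≈0 = P-irr (P-resp x≈0 px)

  P-neg : ∀ {x} → P x → ¬ P (- x)
  P-neg {x} px p-x = P-irr (P-resp (-‿inverseʳ x) (P-+ px p-x))

  P-tri : ∀ x → x ≈ 0# ⊎ (P x ⊎ P (- x))
  P-tri x with x ≈? 0#
  ... | yes x≈0 = inj₁ x≈0
  ... | no x≉0  = inj₂ (P-dich x x≉0)

  P-sq : ∀ x → ¬ (x ≈ 0#) → P (x * x)
  P-sq x x≉0 with P-dich x x≉0
  ... | inj₁ px  = P-* px px
  ... | inj₂ p-x = P-resp (FS.solve 1 (λ x → (:- x) :* (:- x) := x :* x) ≈-refl x) (P-* p-x p-x)

  P-1 : P 1#
  P-1 = P-resp (*-identityˡ 1#) (P-sq 1# 1≉0)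

  P-ℕ : ∀ n → P (ιℤ (+ suc n))
  P-ℕ zero    = P-resp (≈-sym ι1) P-1
  P-ℕ (suc n) = P-resp (≈-trans (+-congʳ (≈-sym ι1)) (≈-sym (ιℤ-+ 1ℤ (+ suc n)))) (P-+ P-1 (P-ℕ n))

  P-ℤ : ∀ {z} → 0ℤ ℤ.< z → P (ιℤ z)
  P-ℤ {+ suc n} (ℤ.+<+ _) = P-ℕ n

  P-ℤ⁻¹ : ∀ {z} → P (ιℤ z) → 0ℤ ℤ.< z
  P-ℤ⁻¹ {+ zero}    p = contradiction p (λ p → P⇒≉0 p ι0)
  P-ℤ⁻¹ {+ suc n}   p = ℤ.+<+ (ℕ.s≤s ℕ.z≤n)
  P-ℤ⁻¹ { -[1+ n ]} p = contradiction (P-resp (ιℤ-neg (+ suc n)) p) (P-neg (P-ℕ n))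

  P-quotient : ∀ {x y} → P (x * y) → P y → P x
  P-quotient {x} {y} pxy py with P-tri x
  ... | inj₁ x≈0        = contradiction (≈-trans (*-congʳ x≈0) (zeroˡ y)) (P⇒≉0 pxy)
  ... | inj₂ (inj₁ px)  = px
  ... | inj₂ (inj₂ p-x) = contradiction
    (P-resp (FS.solve 2 (λ x y → (:- x) :* y := :- (x :* y)) ≈-refl x y) (P-* p-x py)) (P-neg pxy)

  P-sum-product : ∀ {x y} → P (x + y) → P (x * y) → P x
  P-sum-product {x} {y} p+ p* with P-tri x
  ... | inj₁ x≈0        = contradiction (≈-trans (*-congʳ x≈0) (zeroˡ y)) (P⇒≉0 p*)
  ... | inj₂ (inj₁ px)  = px
  ... | inj₂ (inj₂ p-x) = contradiction (P-+ p-x (P-quotient p-y·-x p-x))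
    (λ p → P-neg p+ (P-resp (FS.solve 2 (λ x y → (:- x) :+ (:- y) := :- (x :+ y)) ≈-refl x y) p))
    where
    p-y·-x : P (- y * - x)
    p-y·-x = P-resp (FS.solve 2 (λ x y → x :* y := (:- y) :* (:- x)) ≈-refl x y) p*

-- Real numbers

module _ where
  open import Data.Rational.Base using (_+_; _*_; _-_; -_; _<_; _≤_)

  private
    module ℚ≤ = ℚ.≤-Reasoning

  fromℤ-mono-≤ : ∀ {m n} → m ℤ.≤ n → fromℤ m ≤ fromℤ n
  fromℤ-mono-≤ {m} {n} m≤n = ℚ.toℚᵘ-cancel-≤
    (ℚᵘ.≤-respˡ-≃ (ℚᵘ.≃-sym (toℚᵘ-fromℤ m))
      (ℚᵘ.≤-respʳ-≃ (ℚᵘ.≃-sym (toℚᵘ-fromℤ n))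
        (*≤* (subst₂ ℤ._≤_ (sym (ℤ.*-identityʳ m)) (sym (ℤ.*-identityʳ n)) m≤n))))

  p≤∣p∣ : ∀ p → p ≤ ℚ.∣ p ∣
  p≤∣p∣ p with ℚ.≤-total 0ℚ p
  ... | inj₁ 0≤p = ℚ.≤-reflexive (sym (ℚ.0≤p⇒∣p∣≡p 0≤p))
  ... | inj₂ p≤0 = ℚ.≤-trans p≤0 (ℚ.0≤∣p∣ p)

  ½-pos : ∀ {ε} → 0ℚ < ε → 0ℚ < ε * ½
  ½-pos 0<ε = *-pos 0<ε (ℚ.positive⁻¹ ½)

  Null : (ℕ → ℚ) → Set
  Null f = ∀ ε → 0ℚ < ε → ∃[ N ] ∀ n → N ℕ.≤ n → ℚ.∣ f n ∣ < ε

  Null-cong : ∀ {f g} → (∀ n → f n ≡ g n) → Null f → Null g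
  Null-cong f≗g nf ε 0<ε with nf ε 0<ε
  ... | N , h = N , λ n n≥ → subst (λ z → ℚ.∣ z ∣ < ε) (f≗g n) (h n n≥)

  Null-0 : Null (λ _ → 0ℚ)
  Null-0 ε 0<ε = 0 , λ _ _ → 0<ε

  Null-+ : ∀ {f g} → Null f → Null g → Null (λ n → f n + g n)
  Null-+ {f} {g} nf ng ε 0<ε with nf (ε * ½) (½-pos 0<ε) | ng (ε * ½) (½-pos 0<ε)
  ... | M , hM | N , hN = M ℕ.⊔ N , λ n n≥ → begin-strict
    ℚ.∣ f n + g n ∣  ≤⟨ ℚ.∣p+q∣≤∣p∣+∣q∣ (f n) (g n) ⟩
    ℚ.∣ f n ∣ + ℚ.∣ g n ∣  <⟨ ℚ.+-mono-< (hM n (ℕ.m⊔n≤o⇒m≤o M N n≥)) (hN n (ℕ.m⊔n≤o⇒n≤o M N n≥)) ⟩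
    ε * ½ + ε * ½  ≡⟨ half+half ε ⟩
    ε  ∎
    where open ℚ≤

  Null-neg : ∀ {f} → Null f → Null (λ n → - f n)
  Null-neg {f} nf ε 0<ε with nf ε 0<ε
  ... | N , h = N , λ n n≥ → subst (ℚ._< ε) (sym (ℚ.∣-p∣≡∣p∣ (f n))) (h n n≥)

  Null-* : ∀ {f g} → IsCauchy f → Null g → Null (λ n → f n * g n)
  Null-* {f} {g} cf ng ε 0<ε =
    let B , 0<B , M , hM = bounded cf
        δ , 0<δ , eq = shrink B ε 0<B 0<ε
        N , hN = ng δ 0<δ
    in M ℕ.⊔ N , λ n n≥ → subst (ℚ.∣ f n * g n ∣ ℚ.<_) eq
    (*-small (f n) (g n) 0<B (hM n (ℕ.m⊔n≤o⇒m≤o M N n≥)) (hN n (ℕ.m⊔n≤o⇒n≤o M N n≥)))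

  open RawRing ℝ-rawRing using () renaming (_+_ to _+ℝ_; _*_ to _*ℝ_; -_ to -ℝ_; 0# to 0ℝ; 1# to 1ℝ) public

  ≗⇒≈ℝ : ∀ x y → (∀ n → seq x n ≡ seq y n) → x ≈ℝ y
  ≗⇒≈ℝ x y eq = Null-cong (λ n → sym (trans (cong (ℚ._- seq y n) (eq n)) (ℚ.+-inverseʳ (seq y n)))) Null-0

  open ℚS using (_:+_; _:*_; _:-_; :-_; _:=_; con)

  ≈ℝ-sym : ∀ {x y} → x ≈ℝ y → y ≈ℝ x
  ≈ℝ-sym {x} {y} x≈y = Null-cong
    (λ n → ℚS.solve 2 (λ a b → :- (a :- b) := b :- a) refl (seq x n) (seq y n)) (Null-neg x≈y)

  ≈ℝ-trans : ∀ {x y z} → x ≈ℝ y → y ≈ℝ z → x ≈ℝ z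
  ≈ℝ-trans {x} {y} {z} x≈y y≈z = Null-cong
    (λ n → ℚS.solve 3 (λ a b c → (a :- b) :+ (b :- c) := a :- c) refl (seq x n) (seq y n) (seq z n))
    (Null-+ x≈y y≈z)

  ℝ-commutativeRing : CommutativeRing 0ℓ 0ℓ
  ℝ-commutativeRing = record
    { RawRing ℝ-rawRing
    ; isCommutativeRing = record
      { isRing = record
        { +-isAbelianGroup = record
          { isGroup = record
            { isMonoid = record
              { isSemigroup = record
                { isMagma = record
                  { isEquivalence = record
                    { refl = λ {x} → ≗⇒≈ℝ x x (λ _ → refl)
                    ; sym = λ {x} {y} → ≈ℝ-sym {x} {y}
                    ; trans = λ {x} {y} {z} → ≈ℝ-trans {x} {y} {z} }
                  ; ∙-cong = λ {x} {y} {u} {v} x≈y u≈v → Null-cong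
                      (λ n → ℚS.solve 4 (λ a b c d → (a :- b) :+ (c :- d) := (a :+ c) :- (b :+ d)) refl
                        (seq x n) (seq y n) (seq u n) (seq v n))
                      (Null-+ x≈y u≈v) }
                ; assoc = λ x y z → ≗⇒≈ℝ ((x +ℝ y) +ℝ z) (x +ℝ (y +ℝ z)) (λ n → ℚ.+-assoc (seq x n) (seq y n) (seq z n)) }
              ; identity = (λ x → ≗⇒≈ℝ (0ℝ +ℝ x) x (λ n → ℚ.+-identityˡ (seq x n)))
                         , (λ x → ≗⇒≈ℝ (x +ℝ 0ℝ) x (λ n → ℚ.+-identityʳ (seq x n))) }
            ; inverse = (λ x → ≗⇒≈ℝ ((-ℝ x) +ℝ x) 0ℝ (λ n → ℚ.+-inverseˡ (seq x n)))
                      , (λ x → ≗⇒≈ℝ (x +ℝ (-ℝ x)) 0ℝ (λ n → ℚ.+-inverseʳ (seq x n)))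
            ; ⁻¹-cong = λ {x} {y} x≈y → Null-cong
                (λ n → ℚS.solve 2 (λ a b → :- (a :- b) := (:- a) :- (:- b)) refl (seq x n) (seq y n))
                (Null-neg x≈y) }
          ; comm = λ x y → ≗⇒≈ℝ (x +ℝ y) (y +ℝ x) (λ n → ℚ.+-comm (seq x n) (seq y n)) }
        ; *-cong = λ {x} {y} {u} {v} x≈y u≈v → Null-cong
            (λ n → ℚS.solve 4 (λ a b c d → a :* (c :- d) :+ d :* (a :- b) := (a :* c) :- (b :* d)) refl
              (seq x n) (seq y n) (seq u n) (seq v n))
            (Null-+ {λ n → seq x n * (seq u n - seq v n)} {λ n → seq v n * (seq x n - seq y n)}
              (Null-* {seq x} {λ n → seq u n - seq v n} (cauchy x) u≈v)
              (Null-* {seq v} {λ n → seq x n - seq y n} (cauchy v) x≈y))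
        ; *-assoc = λ x y z → ≗⇒≈ℝ ((x *ℝ y) *ℝ z) (x *ℝ (y *ℝ z)) (λ n → ℚ.*-assoc (seq x n) (seq y n) (seq z n))
        ; *-identity = (λ x → ≗⇒≈ℝ (1ℝ *ℝ x) x (λ n → ℚ.*-identityˡ (seq x n)))
                     , (λ x → ≗⇒≈ℝ (x *ℝ 1ℝ) x (λ n → ℚ.*-identityʳ (seq x n)))
        ; distrib = (λ x y z → ≗⇒≈ℝ (x *ℝ (y +ℝ z)) ((x *ℝ y) +ℝ (x *ℝ z)) (λ n → ℚ.*-distribˡ-+ (seq x n) (seq y n) (seq z n)))
                  , (λ x y z → ≗⇒≈ℝ ((y +ℝ z) *ℝ x) ((y *ℝ x) +ℝ (z *ℝ x)) (λ n → ℚ.*-distribʳ-+ (seq x n) (seq y n) (seq z n))) }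
      ; *-comm = λ x y → ≗⇒≈ℝ (x *ℝ y) (y *ℝ x) (λ n → ℚ.*-comm (seq x n) (seq y n)) } }

  0≉1ℝ : ¬ (1ℝ ≈ℝ 0ℝ)
  0≉1ℝ eq with eq 1ℚ (ℚ.positive⁻¹ 1ℚ)
  ... | N , h = ℚ.<-irrefl refl (h N ℕ.≤-refl)

  Positive-resp : ∀ {x y} → x ≈ℝ y → Positiveℝ x → Positiveℝ y
  Positive-resp {x} {y} x≈y (ε , 0<ε , M , hM) with x≈y (ε * ½) (½-pos 0<ε)
  ... | N , hN = ε * ½ , ½-pos 0<ε , M ℕ.⊔ N , λ n n≥ → begin
    ε * ½  ≡⟨ ℚS.solve 1 (λ h → h := (h :+ h) :- h) refl (ε * ½) ⟩
    (ε * ½ + ε * ½) - ε * ½  ≡⟨ cong (ℚ._- ε * ½) (half+half ε) ⟩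
    ε - ε * ½  ≤⟨ ℚ.+-mono-≤ (hM n (ℕ.m⊔n≤o⇒m≤o M N n≥))
                                                           (ℚ.neg-antimono-≤ (ℚ.≤-trans (p≤∣p∣ _) (ℚ.<⇒≤ (hN n (ℕ.m⊔n≤o⇒n≤o M N n≥))))) ⟩
    seq x n - (seq x n - seq y n)  ≡⟨ ℚS.solve 2 (λ a b → a :- (a :- b) := b) refl (seq x n) (seq y n) ⟩
    seq y n  ∎
    where open ℚ≤

  Positive-+ : ∀ x y → Positiveℝ x → Positiveℝ y → Positiveℝ (x +ℝ y)
  Positive-+ x y (ε , 0<ε , M , hM) (δ , 0<δ , N , hN) = ε + δ , ℚ.+-mono-< 0<ε 0<δ , M ℕ.⊔ N ,
    λ n n≥ → ℚ.+-mono-≤ (hM n (ℕ.m⊔n≤o⇒m≤o M N n≥)) (hN n (ℕ.m⊔n≤o⇒n≤o M N n≥))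

  *-mono-≤ : ∀ {a b c d} → 0ℚ ≤ a → 0ℚ ≤ d → a ≤ b → c ≤ d → a * c ≤ b * d
  *-mono-≤ {a} {b} {c} {d} 0≤a 0≤d a≤b c≤d = ℚ.≤-trans
    (ℚ.*-monoˡ-≤-nonNeg a {{ℚ.nonNegative 0≤a}} c≤d)
    (ℚ.*-monoʳ-≤-nonNeg d {{ℚ.nonNegative 0≤d}} a≤b)

  Positive-* : ∀ x y → Positiveℝ x → Positiveℝ y → Positiveℝ (x *ℝ y)
  Positive-* x y (ε , 0<ε , M , hM) (δ , 0<δ , N , hN) = ε * δ , *-pos 0<ε 0<δ , M ℕ.⊔ N ,
    λ n n≥ → let δ≤y = hN n (ℕ.m⊔n≤o⇒n≤o M N n≥) in
      *-mono-≤ (ℚ.<⇒≤ 0<ε) (ℚ.≤-trans (ℚ.<⇒≤ 0<δ) δ≤y) (hM n (ℕ.m⊔n≤o⇒m≤o M N n≥)) δ≤y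

  ¬Positive-0 : ¬ Positiveℝ 0ℝ
  ¬Positive-0 (ε , 0<ε , M , hM) = ℚ.<-irrefl refl (ℚ.<-≤-trans 0<ε (hM M ℕ.≤-refl))

  invertible⇒apart : ∀ x z → x *ℝ z ≈ℝ 1ℝ →
    ∃[ δ ] 0ℚ < δ × ∃[ N ] (∀ n → N ℕ.≤ n → δ ≤ ℚ.∣ seq x n ∣)
  invertible⇒apart x z xz≈1 = apart (bounded (cauchy z)) (xz≈1 ½ (ℚ.positive⁻¹ ½))
    where
    open ℚ≤
    apart : ∃[ B ] 0ℚ < B × ∃[ N ] (∀ n → N ℕ.≤ n → ℚ.∣ seq z n ∣ ≤ B) →
      ∃[ N ] (∀ n → N ℕ.≤ n → ℚ.∣ seq x n * seq z n - 1ℚ ∣ < ½) →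
      ∃[ δ ] 0ℚ < δ × ∃[ N ] (∀ n → N ℕ.≤ n → δ ≤ ℚ.∣ seq x n ∣)
    apart (B , 0<B , M , hM) (N , hN) = apart′ (shrink B ½ 0<B (ℚ.positive⁻¹ ½))
      where
      bound : ∀ w b → ℚ.∣ w * b - 1ℚ ∣ < ½ → ℚ.∣ b ∣ ≤ B → ½ ≤ ℚ.∣ w ∣ * B
      bound w b near b≤B = begin
        1ℚ - ½  ≤⟨ ℚ.+-monoʳ-≤ 1ℚ (ℚ.neg-antimono-≤ (ℚ.<⇒≤ near)) ⟩
        1ℚ - ℚ.∣ w * b - 1ℚ ∣  ≡⟨ cong (λ w → 1ℚ - w) (trans (cong ℚ.∣_∣ (ℚS.solve 1 (λ w → w :- con 1ℤ := :- (con 1ℤ :- w)) refl (w * b))) (ℚ.∣-p∣≡∣p∣ (1ℚ - w * b))) ⟩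
        1ℚ - ℚ.∣ 1ℚ - w * b ∣  ≤⟨ ℚ.+-monoʳ-≤ 1ℚ (ℚ.neg-antimono-≤ (p≤∣p∣ (1ℚ - w * b))) ⟩
        1ℚ - (1ℚ - w * b)  ≡⟨ ℚS.solve 1 (λ w → con 1ℤ :- (con 1ℤ :- w) := w) refl (w * b) ⟩
        w * b  ≤⟨ p≤∣p∣ (w * b) ⟩
        ℚ.∣ w * b ∣  ≡⟨ ℚ.∣p*q∣≡∣p∣*∣q∣ w b ⟩
        ℚ.∣ w ∣ * ℚ.∣ b ∣  ≤⟨ ℚ.*-monoˡ-≤-nonNeg ℚ.∣ w ∣ {{ℚ.∣-∣-nonNeg w}} b≤B ⟩
        ℚ.∣ w ∣ * B  ∎
      apart′ : ∃[ δ ] 0ℚ < δ × B * δ ≡ ½ → ∃[ δ ] 0ℚ < δ × ∃[ N ] (∀ n → N ℕ.≤ n → δ ≤ ℚ.∣ seq x n ∣)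
      apart′ (δ , 0<δ , Bδ≡½) = δ , 0<δ , M ℕ.⊔ N , λ n n≥ →
        ℚ.*-cancelʳ-≤-pos B {{ℚ.positive 0<B}} (subst (ℚ._≤ ℚ.∣ seq x n ∣ * B) (sym (trans (ℚ.*-comm δ B) Bδ≡½))
          (bound (seq x n) (seq z n) (hN n (ℕ.m⊔n≤o⇒n≤o M N n≥)) (hM n (ℕ.m⊔n≤o⇒m≤o M N n≥))))

  -- An element bounded away from 0 cannot change sign once its sequence varies
  -- by less than the bound.
  invertible⇒signed : ∀ x z → x *ℝ z ≈ℝ 1ℝ → Positiveℝ x ⊎ Positiveℝ (-ℝ x)
  invertible⇒signed x z xz≈1 =
    let δ , 0<δ , M , apart = invertible⇒apart x z xz≈1
        N , close = cauchy x δ 0<δ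
    in signed δ 0<δ M apart N close
    where
    signed : ∀ δ → 0ℚ < δ → ∀ M → (∀ n → M ℕ.≤ n → δ ≤ ℚ.∣ seq x n ∣) →
      ∀ N → (∀ m n → N ℕ.≤ m → N ℕ.≤ n → ℚ.∣ seq x m - seq x n ∣ < δ) → Positiveℝ x ⊎ Positiveℝ (-ℝ x)
    signed δ 0<δ M apart N close = by-sign (ℚ.≤-total 0ℚ (seq x K))
     where
     K = M ℕ.⊔ N
     M≤ : ∀ {n} → K ℕ.≤ n → M ℕ.≤ n
     M≤ = ℕ.m⊔n≤o⇒m≤o M N
     N≤ : ∀ {n} → K ℕ.≤ n → N ℕ.≤ n
     N≤ = ℕ.m⊔n≤o⇒n≤o M N
     same-sign : ∀ {a b} → δ ≤ a → δ ≤ ℚ.∣ b ∣ → ℚ.∣ a - b ∣ < δ → δ ≤ b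
     same-sign {a} {b} δ≤a δ≤∣b∣ a-b<δ = subst (δ ℚ.≤_) (ℚ.0≤p⇒∣p∣≡p (ℚ.<⇒≤ 0<b)) δ≤∣b∣
       where
       open ℚ≤
       0<b : 0ℚ < b
       0<b = begin-strict
         0ℚ  ≡⟨ ℚ.+-inverseʳ δ ⟨
         δ - δ  <⟨ ℚ.+-mono-≤-< δ≤a (ℚ.neg-antimono-< (ℚ.≤-<-trans (p≤∣p∣ _) a-b<δ)) ⟩
         a - (a - b)  ≡⟨ ℚS.solve 2 (λ a b → a :- (a :- b) := b) refl a b ⟩
         b  ∎
     by-sign : 0ℚ ≤ seq x K ⊎ seq x K ≤ 0ℚ → Positiveℝ x ⊎ Positiveℝ (-ℝ x)
     by-sign (inj₁ 0≤x) = inj₁ (δ , 0<δ , K , λ n n≥ → same-sign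
       (subst (δ ℚ.≤_) (ℚ.0≤p⇒∣p∣≡p 0≤x) (apart K (M≤ ℕ.≤-refl)))
       (apart n (M≤ n≥)) (close K n (N≤ ℕ.≤-refl) (N≤ n≥)))
     by-sign (inj₂ x≤0) = inj₂ (δ , 0<δ , K , λ n n≥ → same-sign
       (subst (δ ℚ.≤_) (trans (sym (ℚ.∣-p∣≡∣p∣ (seq x K))) (ℚ.0≤p⇒∣p∣≡p (ℚ.neg-antimono-≤ x≤0))) (apart K (M≤ ℕ.≤-refl)))
       (subst (δ ℚ.≤_) (sym (ℚ.∣-p∣≡∣p∣ (seq x n))) (apart n (M≤ n≥)))
       (subst (ℚ._< δ) (trans (sym (ℚ.∣-p∣≡∣p∣ _)) (cong ℚ.∣_∣ (sym (diff-neg (seq x K) (seq x n)))))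
         (close K n (N≤ ℕ.≤-refl) (N≤ n≥))))

ordering : ∀ {c ℓ} (F : NumberField c ℓ) (σ : NumberField.Carrier F → ℝ) →
  IsRingMonomorphism (NumberField.rawRing F) ℝ-rawRing σ → Ordering F
ordering F σ σ-mono = record
  { P      = λ x → Positiveℝ (σ x)
  ; P-resp = λ {x} {y} x≈y → Positive-resp {σ x} {σ y} (σ.⟦⟧-cong x≈y)
  ; P-+    = λ {x} {y} px py → Positive-resp {σ x +ℝ σ y} {σ (x + y)} (R.sym {σ (x + y)} {σ x +ℝ σ y} (σ.+-homo x y)) (Positive-+ (σ x) (σ y) px py)
  ; P-*    = λ {x} {y} px py → Positive-resp {σ x *ℝ σ y} {σ (x * y)} (R.sym {σ (x * y)} {σ x *ℝ σ y} (σ.*-homo x y)) (Positive-* (σ x) (σ y) px py)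
  ; P-irr  = λ p → ¬Positive-0 (Positive-resp {σ 0#} {0ℝ} σ.0#-homo p)
  ; P-dich = dich
  }
  where
  open NumberField F
  module σ = IsRingMonomorphism σ-mono
  module R = CommutativeRing ℝ-commutativeRing
  dich : ∀ x → ¬ (x ≈ 0#) → Positiveℝ (σ x) ⊎ Positiveℝ (σ (- x))
  dich x x≉0 = let y , xy≈1 = inverse x x≉0 in
    ⊎.map₂ (Positive-resp { -ℝ σ x} {σ (- x)} (R.sym {σ (- x)} { -ℝ σ x} (σ.-‿homo x)))
      (invertible⇒signed (σ x) (σ y)
        (R.trans {σ x *ℝ σ y} {σ (x * y)} {1ℝ} (R.sym {σ (x * y)} {σ x *ℝ σ y} (σ.*-homo x y))
          (R.trans {σ (x * y)} {σ 1#} {1ℝ} (σ.⟦⟧-cong xy≈1) σ.1#-homo)))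

module _ where
  open import Data.Rational.Base using (_+_; _*_; _-_; -_; _<_; _≤_)

  constℝ : ℚ → ℝ
  constℝ q = mkℝ (λ _ → q) (const-cauchy q)

  module ℝR = CommutativeRing ℝ-commutativeRing

  constℝ-homo : IsRingHomomorphism ℚ.+-*-rawRing ℝ-rawRing constℝ
  constℝ-homo = record
    { isSemiringHomomorphism = record
      { isNearSemiringHomomorphism = record
        { +-isMonoidHomomorphism = record
          { isMagmaHomomorphism = record
            { isRelHomomorphism = record { cong = λ {p} {q} p≡q → ≗⇒≈ℝ (constℝ p) (constℝ q) (λ _ → p≡q) }
            ; homo = λ p q → ℝR.refl {constℝ (p + q)} }
          ; ε-homo = ℝR.refl {0ℝ} }
        ; *-homo = λ p q → ℝR.refl {constℝ (p * q)} }
      ; 1#-homo = ℝR.refl {1ℝ} }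
    ; -‿homo = λ p → ℝR.refl {constℝ (- p)} }

  abstract
    isqrt : ∀ n → ∃[ m ] m ℕ.* m ℕ.≤ n × n ℕ.< suc m ℕ.* suc m
    isqrt zero    = 0 , ℕ.z≤n , ℕ.s≤s ℕ.z≤n
    isqrt (suc n) with isqrt n
    ... | m , m²≤n , n<sm² with suc m ℕ.* suc m ℕ.≤? suc n
    ...   | yes sm²≤sn = suc m , sm²≤sn , ℕ.≤-<-trans n<sm² (ℕ.*-mono-< (ℕ.n<1+n (suc m)) (ℕ.n<1+n (suc m)))
    ...   | no  sm²≰sn = m , ℕ.m≤n⇒m≤1+n m²≤n , ℕ.≰⇒> sm²≰sn

  archimedean : ∀ B ε → 0ℚ < ε → ∃[ N ] ∀ n → N ℕ.≤ n → fromℤ (+ B) < ε * fromℤ (+ suc n)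
  archimedean B ε@(ℚ.mkℚ (+ suc a) d-1 _) _ = N , λ n n≥ → begin-strict
    fromℤ (+ B)  <⟨ fromℤ-mono-< ⟩
    fromℤ (+ suc B)  ≤⟨ fromℤ-mono-≤ (ℤ.+≤+ (ℕ.m≤n*m (suc B) (suc a))) ⟩
    fromℤ (+ (suc a ℕ.* suc B))  ≡⟨ cong fromℤ (ℤ.pos-* (suc a) (suc B)) ⟩
    fromℤ (+ suc a ℤ.* + suc B)  ≡⟨ fromℤ-* (+ suc a) (+ suc B) ⟩
    fromℤ (+ suc a) * fromℤ (+ suc B)  ≡⟨ cong (ℚ._* fromℤ (+ suc B)) (↧*≡↥ ε) ⟨
    (ε * fromℤ (+ suc d-1)) * fromℤ (+ suc B)  ≡⟨ ℚ.*-assoc ε (fromℤ (+ suc d-1)) (fromℤ (+ suc B)) ⟩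
    ε * (fromℤ (+ suc d-1) * fromℤ (+ suc B))  ≡⟨ cong (ε ℚ.*_) (trans (cong fromℤ (ℤ.pos-* (suc d-1) (suc B))) (fromℤ-* (+ suc d-1) (+ suc B))) ⟨
    ε * fromℤ (+ N)  ≤⟨ ℚ.*-monoˡ-≤-nonNeg ε (fromℤ-mono-≤ (ℤ.+≤+ (ℕ.m≤n⇒m≤1+n n≥))) ⟩
    ε * fromℤ (+ suc n)  ∎
    where
    open ℚ.≤-Reasoning
    N = suc d-1 ℕ.* suc B
    fromℤ-mono-< : fromℤ (+ B) < fromℤ (+ suc B)
    fromℤ-mono-< = subst₂ ℚ._<_ (ℚ.+-identityˡ (fromℤ (+ B))) (sym (fromℤ-+ 1ℤ (+ B)))
      (ℚ.+-monoˡ-< (fromℤ (+ B)) (ℚ.positive⁻¹ 1ℚ))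
  archimedean B (ℚ.mkℚ (+ zero) _ _) (ℚ.*<* (ℤ.+<+ ()))
  archimedean B (ℚ.mkℚ -[1+ _ ] _ _) (ℚ.*<* ())

  module SquareRoot (D-1 : ℕ) where
    D = suc D-1

    root : ℕ → ℕ
    root n = proj₁ (isqrt (D ℕ.* (suc n ℕ.* suc n)))

    root²≤ : ∀ n → root n ℕ.* root n ℕ.≤ D ℕ.* (suc n ℕ.* suc n)
    root²≤ n = proj₁ (proj₂ (isqrt (D ℕ.* (suc n ℕ.* suc n))))

    <root² : ∀ n → D ℕ.* (suc n ℕ.* suc n) ℕ.< suc (root n) ℕ.* suc (root n)
    <root² n = proj₂ (proj₂ (isqrt (D ℕ.* (suc n ℕ.* suc n))))

    square-cancel-< : ∀ {m n} → m ℕ.* m ℕ.< n ℕ.* n → m ℕ.< n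
    square-cancel-< {m} {n} m²<n² = ℕ.≰⇒> λ n≤m → ℕ.<⇒≱ m²<n² (ℕ.*-mono-≤ n≤m n≤m)

    n<root : ∀ n → suc n ℕ.≤ root n
    n<root n = ℕ.s≤s⁻¹ (square-cancel-< (ℕ.≤-<-trans (ℕ.m≤n*m (suc n ℕ.* suc n) D) (<root² n)))

    root≤ : ∀ n → root n ℕ.≤ D ℕ.* suc n
    root≤ n = ℕ.s≤s⁻¹ (square-cancel-< (ℕ.≤-<-trans (root²≤ n) (ℕ.≤-<-trans
        (ℕ.≤-trans (ℕ.m≤n*m (D ℕ.* (suc n ℕ.* suc n)) D) (ℕ.≤-reflexive (rearrange D (suc n))))
        (ℕ.*-mono-< (ℕ.n<1+n (D ℕ.* suc n)) (ℕ.n<1+n (D ℕ.* suc n))))))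
      where
      rearrange : ∀ d k → d ℕ.* (d ℕ.* (k ℕ.* k)) ≡ (d ℕ.* k) ℕ.* (d ℕ.* k)
      rearrange = ℕ-RingSolver.solve-∀

    k m r : ℕ → ℚ
    k n = fromℤ (+ suc n)
    m n = fromℤ (+ root n)
    r n = m n * ℚ.1/_ (k n) {{k≢0 n}}
      where
      k≢0 : ∀ n → ℚ.NonZero (k n)
      k≢0 n = ℚ.>-nonZero (fromℤ-pos {+ suc n} (ℤ.+<+ (ℕ.s≤s ℕ.z≤n)))

    k-pos : ∀ n → ℚ.Positive (k n)
    k-pos n = ℚ.positive (fromℤ-pos {+ suc n} (ℤ.+<+ (ℕ.s≤s ℕ.z≤n)))

    rk≡m : ∀ n → r n * k n ≡ m n
    rk≡m n = trans (ℚ.*-assoc (m n) _ (k n)) (trans (cong (m n ℚ.*_) (ℚ.*-inverseˡ (k n) {{_}})) (ℚ.*-identityʳ (m n)))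

    1≤r : ∀ n → 1ℚ ≤ r n
    1≤r n = ℚ.*-cancelʳ-≤-pos (k n) {{k-pos n}}
      (subst₂ ℚ._≤_ (sym (ℚ.*-identityˡ (k n))) (sym (rk≡m n)) (fromℤ-mono-≤ (ℤ.+≤+ (n<root n))))

    d : ℚ
    d = fromℤ (+ D)

    fromℕ-* : ∀ a b → fromℤ (+ (a ℕ.* b)) ≡ fromℤ (+ a) * fromℤ (+ b)
    fromℕ-* a b = trans (cong fromℤ (ℤ.pos-* a b)) (fromℤ-* (+ a) (+ b))

    open ℚS using (_:+_; _:*_; _:-_; :-_; _:=_; con)

    -- d k² lies in the interval [m², (m + 1)²) and m ≤ d k
    error≤ : ∀ n → ℚ.∣ r n * r n - d ∣ * k n ≤ fromℤ (+ (2 ℕ.* D))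
    error≤ n = ℚ.*-cancelʳ-≤-pos (k n) {{k-pos n}} (begin
      ℚ.∣ e ∣ * k n * k n  ≡⟨ ℚ.*-assoc ℚ.∣ e ∣ (k n) (k n) ⟩
      ℚ.∣ e ∣ * (k n * k n)  ≡⟨ cong (ℚ._* (k n * k n)) (trans (sym (ℚ.∣-p∣≡∣p∣ e)) (ℚ.0≤p⇒∣p∣≡p 0≤-e)) ⟩
      (- e) * (k n * k n)  ≡⟨ -ek² ⟩
      dk² - m n * m n  ≤⟨ ℚ.+-monoˡ-≤ (- (m n * m n)) dk²≤ ⟩
      (m n * m n + (m n + m n)) - m n * m n ≡⟨ ℚS.solve 1 (λ m → (m :* m :+ (m :+ m)) :- m :* m := con (+ 2) :* m) refl (m n) ⟩
      fromℤ (+ 2) * m n  ≤⟨ ℚ.*-monoˡ-≤-nonNeg (fromℤ (+ 2)) (fromℤ-mono-≤ (ℤ.+≤+ (root≤ n))) ⟩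
      fromℤ (+ 2) * fromℤ (+ (D ℕ.* suc n)) ≡⟨ cong (fromℤ (+ 2) ℚ.*_) (fromℕ-* D (suc n)) ⟩
      fromℤ (+ 2) * (d * k n)  ≡⟨ ℚ.*-assoc (fromℤ (+ 2)) d (k n) ⟨
      fromℤ (+ 2) * d * k n  ≡⟨ cong (ℚ._* k n) (fromℕ-* 2 D) ⟨
      fromℤ (+ (2 ℕ.* D)) * k n  ∎)
      where
      open ℚ.≤-Reasoning
      e = r n * r n - d
      dk² = d * (k n * k n)
      dk²≡ : fromℤ (+ (D ℕ.* (suc n ℕ.* suc n))) ≡ dk²
      dk²≡ = trans (fromℕ-* D (suc n ℕ.* suc n)) (cong (d ℚ.*_) (fromℕ-* (suc n) (suc n)))
      -ek² : (- e) * (k n * k n) ≡ dk² - m n * m n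
      -ek² = trans
        (ℚS.solve 3 (λ r k d → (:- (r :* r :- d)) :* (k :* k) := d :* (k :* k) :- (r :* k) :* (r :* k)) refl (r n) (k n) d)
        (cong (λ z → dk² - z * z) (rk≡m n))
      m²≤ : m n * m n ≤ dk²
      m²≤ = subst₂ ℚ._≤_ (fromℕ-* (root n) (root n)) dk²≡ (fromℤ-mono-≤ (ℤ.+≤+ (root²≤ n)))
      dk²≤ : dk² ≤ m n * m n + (m n + m n)
      dk²≤ = subst₂ ℚ._≤_ dk²≡
        (trans (fromℤ-+ (+ (root n ℕ.* root n)) (+ (root n ℕ.+ root n)))
          (cong₂ ℚ._+_ (fromℕ-* (root n) (root n)) (fromℤ-+ (+ root n) (+ root n))))
        (fromℤ-mono-≤ (ℤ.+≤+ (ℕ.s≤s⁻¹ (subst (D ℕ.* (suc n ℕ.* suc n) ℕ.<_) (expand (root n)) (<root² n)))))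
        where
        expand : ∀ x → suc x ℕ.* suc x ≡ suc (x ℕ.* x ℕ.+ (x ℕ.+ x))
        expand = ℕ-RingSolver.solve-∀
      0≤-e : 0ℚ ≤ - e
      0≤-e = ℚ.*-cancelʳ-≤-pos (k n) {{k-pos n}} (ℚ.*-cancelʳ-≤-pos (k n) {{k-pos n}} (begin
        0ℚ * k n * k n  ≡⟨ ℚS.solve 1 (λ k → con 0ℤ :* k :* k := con 0ℤ) refl (k n) ⟩
        0ℚ  ≡⟨ ℚ.+-inverseʳ (m n * m n) ⟨
        m n * m n - m n * m n  ≤⟨ ℚ.+-monoˡ-≤ (- (m n * m n)) m²≤ ⟩
        dk² - m n * m n  ≡⟨ -ek² ⟨
        (- e) * (k n * k n)  ≡⟨ ℚ.*-assoc (- e) (k n) (k n) ⟨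
        (- e) * k n * k n  ∎))

    error-null : Null (λ n → r n * r n - d)
    error-null ε 0<ε = let N , hN = archimedean (2 ℕ.* D) ε 0<ε in
      N , λ n n≥ → ℚ.*-cancelʳ-<-nonNeg (k n) {{ℚ.pos⇒nonNeg (k n) {{k-pos n}}}}
        (ℚ.≤-<-trans (error≤ n) (hN n n≥))

    root-cauchy : IsCauchy r
    root-cauchy ε 0<ε = let N , hN = error-null (ε * ½) (½-pos 0<ε) in N , λ a b a≥ b≥ → begin-strict
      ℚ.∣ r a - r b ∣  ≡⟨ ℚ.*-identityʳ ℚ.∣ r a - r b ∣ ⟨
      ℚ.∣ r a - r b ∣ * 1ℚ  ≤⟨ ℚ.*-monoˡ-≤-nonNeg ℚ.∣ r a - r b ∣ {{ℚ.∣-∣-nonNeg (r a - r b)}} (1≤sum a b) ⟩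
      ℚ.∣ r a - r b ∣ * ℚ.∣ r a + r b ∣  ≡⟨ ℚ.∣p*q∣≡∣p∣*∣q∣ (r a - r b) (r a + r b) ⟨
      ℚ.∣ (r a - r b) * (r a + r b) ∣  ≡⟨ cong ℚ.∣_∣ (ℚS.solve 3 (λ x y d → (x :- y) :* (x :+ y) := (x :* x :- d) :- (y :* y :- d)) refl (r a) (r b) d) ⟩
      ℚ.∣ (r a * r a - d) - (r b * r b - d) ∣  ≤⟨ ℚ.∣p-q∣≤∣p∣+∣q∣ (r a * r a - d) (r b * r b - d) ⟩
      ℚ.∣ r a * r a - d ∣ + ℚ.∣ r b * r b - d ∣ <⟨ ℚ.+-mono-< (hN a a≥) (hN b b≥) ⟩
      ε * ½ + ε * ½  ≡⟨ half+half ε ⟩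
      ε  ∎
      where
      open ℚ.≤-Reasoning
      1≤sum : ∀ a b → 1ℚ ≤ ℚ.∣ r a + r b ∣
      1≤sum a b = begin
        1ℚ  ≤⟨ 1≤r a ⟩
        r a  ≡⟨ ℚ.+-identityʳ (r a) ⟨
        r a + 0ℚ  ≤⟨ ℚ.+-monoʳ-≤ (r a) (ℚ.≤-trans (ℚ.<⇒≤ (ℚ.positive⁻¹ 1ℚ)) (1≤r b)) ⟩
        r a + r b  ≤⟨ p≤∣p∣ (r a + r b) ⟩
        ℚ.∣ r a + r b ∣  ∎

    √ : ℝ
    √ = mkℝ r root-cauchy

    √²≈ : √ *ℝ √ ≈ℝ constℝ d
    √²≈ = error-null

-- Linear algebra over ℚ

module LinearAlgebra {c ℓ} (F : NumberField c ℓ) where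
  open FieldProperties F
  open FS using (_:+_; _:*_; _:-_; :-_; _:=_; con)
  open Sum +-commutativeMonoid using (sum-remove; sum-cong-≋)
  open import Relation.Binary.Reasoning.Setoid setoid

  infix 7 _∙_
  _∙_ : ∀ {n} → (Fin n → ℚ) → (Fin n → Carrier) → Carrier
  a ∙ v = sum (λ i → ι (a i) * v i)

  Independent : ∀ {n} → (Fin n → Carrier) → Set ℓ
  Independent v = ∀ a → a ∙ v ≈ 0# → ∀ i → a i ≡ 0ℚ

  ∙-congˡ : ∀ {n} {a b : Fin n → ℚ} v → (∀ i → a i ≡ b i) → a ∙ v ≈ b ∙ v
  ∙-congˡ v a≗b = sum-cong-≋ (λ i → *-congʳ {v i} (ι-cong (a≗b i)))

  ∙-shift : ∀ {n} (a q : Fin n → ℚ) v z →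
    ∃[ x ] a ∙ (λ i → v i - ι (q i) * z) ≈ ι x * z + a ∙ v
  ∙-shift {zero}  a q v z = 0ℚ , ≈-sym (≈-trans (+-congʳ (≈-trans (*-congʳ ι0) (zeroˡ z))) (+-identityˡ 0#))
  ∙-shift {suc n} a q v z with ∙-shift (λ i → a (suc i)) (λ i → q (suc i)) (λ i → v (suc i)) z
  ... | x , eq = x ℚ.- a zero ℚ.* q zero , (begin
    ι a₀ * (v zero - ι q₀ * z) + _  ≈⟨ +-congˡ eq ⟩
    ι a₀ * (v zero - ι q₀ * z) + (ι x * z + rest)  ≈⟨ FS.solve 6 (λ a q v z x r → a :* (v :- q :* z) :+ (x :* z :+ r) := (x :- a :* q) :* z :+ (a :* v :+ r)) ≈-refl (ι a₀) (ι q₀) (v zero) z (ι x) rest ⟩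
    (ι x - ι a₀ * ι q₀) * z + (ι a₀ * v zero + rest)  ≈⟨ +-congʳ (*-congʳ (≈-trans (ι-+ x _) (+-congˡ (≈-trans (ι-neg _) (-‿cong (ι-* a₀ q₀)))))) ⟨
    ι (x ℚ.- a₀ ℚ.* q₀) * z + (ι a₀ * v zero + rest)  ∎)
    where
    a₀ = a zero
    q₀ = q zero
    rest = (λ i → a (suc i)) ∙ (λ i → v (suc i))

  ∙-minus : ∀ {n} (a b : Fin n → ℚ) q w → a ∙ w - ι q * (b ∙ w) ≈ (λ i → a i ℚ.- q ℚ.* b i) ∙ w
  ∙-minus {zero}  a b q w = ≈-trans (+-congˡ (-‿cong (zeroʳ (ι q)))) (-‿inverseʳ 0#)
  ∙-minus {suc n} a b q w = begin
    (ι a₀ * w₀ + a∙) - ι q * (ι b₀ * w₀ + b∙)  ≈⟨ FS.solve 6 (λ a w r q b s → (a :* w :+ r) :- q :* (b :* w :+ s) := (a :- q :* b) :* w :+ (r :- q :* s)) ≈-refl (ι a₀) w₀ a∙ (ι q) (ι b₀) b∙ ⟩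
    (ι a₀ - ι q * ι b₀) * w₀ + (a∙ - ι q * b∙)  ≈⟨ +-cong (*-congʳ (≈-sym (≈-trans (ι-+ a₀ _) (+-congˡ (≈-trans (ι-neg _) (-‿cong (ι-* q b₀)))))))
                                                        (∙-minus (λ i → a (suc i)) (λ i → b (suc i)) q (λ i → w (suc i))) ⟩
    _  ∎
    where
    a₀ = a zero
    b₀ = b zero
    w₀ = w zero
    a∙ = (λ i → a (suc i)) ∙ (λ i → w (suc i))
    b∙ = (λ i → b (suc i)) ∙ (λ i → w (suc i))

  dependent : ∀ n (w : Fin n → Carrier) (v : Fin (suc n) → Carrier) (A : Fin (suc n) → Fin n → ℚ) →
    (∀ i → v i ≈ A i ∙ w) → ∃[ a ] a ∙ v ≈ 0# × ∃[ i ] a i ≢ 0ℚ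
  dependent zero    w v A v≈ = (λ _ → 1ℚ) , ≈-trans (+-congʳ (≈-trans (*-congˡ (v≈ zero)) (zeroʳ _))) (+-identityˡ 0#) , zero , λ ()
  dependent (suc n) w v A v≈ with Fin.any? (λ i → ¬? (A i zero ℚ.≟ 0ℚ))
    where open import Relation.Nullary.Decidable using (¬?)
  ... | yes (p , Ap≢0) = pivot
    where
    r = proj₁ (1/ι (A p zero) Ap≢0)
    rAp≡1 = proj₂ (1/ι (A p zero) Ap≢0)
    A′ : Fin (suc n) → Fin (suc n) → ℚ
    A′ i = A (punchIn p i)
    q : Fin (suc n) → ℚ
    q i = A′ i zero ℚ.* r
    column₀ : ∀ i → A′ i zero ℚ.- q i ℚ.* A p zero ≡ 0ℚ
    column₀ i = trans (cong (λ z → A′ i zero ℚ.- z)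
        (trans (ℚ.*-assoc (A′ i zero) r (A p zero)) (trans (cong (A′ i zero ℚ.*_) rAp≡1) (ℚ.*-identityʳ _))))
      (ℚ.+-inverseʳ (A′ i zero))
    u : Fin (suc n) → Carrier
    u i = v (punchIn p i) - ι (q i) * v p
    B : Fin (suc n) → Fin n → ℚ
    B i j = A′ i (suc j) ℚ.- q i ℚ.* A p (suc j)
    u≈ : ∀ i → u i ≈ B i ∙ (λ j → w (suc j))
    u≈ i = begin
      v (punchIn p i) - ι (q i) * v p  ≈⟨ +-cong (v≈ (punchIn p i)) (-‿cong (*-congˡ (v≈ p))) ⟩
      A′ i ∙ w - ι (q i) * (A p ∙ w)  ≈⟨ ∙-minus (A′ i) (A p) (q i) w ⟩
      ι (A′ i zero ℚ.- q i ℚ.* A p zero) * w zero + _  ≈⟨ +-congʳ (*-congʳ (≈-trans (ι-cong (column₀ i)) ι0)) ⟩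
      0# * w zero + _  ≈⟨ +-congʳ (zeroˡ _) ⟩
      0# + _  ≈⟨ +-identityˡ _ ⟩
      B i ∙ (λ j → w (suc j))  ∎
    pivot : ∃[ a ] a ∙ v ≈ 0# × ∃[ i ] a i ≢ 0ℚ
    pivot = let b , b∙u≈0 , i , bi≢0 = dependent n (λ j → w (suc j)) u B u≈
                x , eq = ∙-shift b q (λ i → v (punchIn p i)) (v p)
            in insertAt b p x , (begin
      insertAt b p x ∙ v  ≈⟨ sum-remove {i = p} (λ i → ι (insertAt b p x i) * v i) ⟩
      ι (insertAt b p x p) * v p + _  ≈⟨ +-cong (*-congʳ (ι-cong (insertAt-lookup b p x)))
                                                                  (∙-congˡ (λ i → v (punchIn p i)) (insertAt-punchIn b p x)) ⟩
      ι x * v p + b ∙ (λ i → v (punchIn p i))  ≈⟨ eq ⟨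
      b ∙ u  ≈⟨ b∙u≈0 ⟩
      0#  ∎)
      , punchIn p i , λ eq → bi≢0 (trans (sym (insertAt-punchIn b p x i)) eq)
  ... | no all≡0 = drop
    where
    column₀ : ∀ i → A i zero ≡ 0ℚ
    column₀ i with A i zero ℚ.≟ 0ℚ
    ... | yes eq = eq
    ... | no neq = contradiction (i , neq) all≡0
    v′≈ : ∀ i → v (suc i) ≈ (λ j → A (suc i) (suc j)) ∙ (λ j → w (suc j))
    v′≈ i = ≈-trans (v≈ (suc i)) (≈-trans
      (+-congʳ (≈-trans (*-congʳ (≈-trans (ι-cong (column₀ (suc i))) ι0)) (zeroˡ _))) (+-identityˡ _))
    drop : ∃[ a ] a ∙ v ≈ 0# × ∃[ i ] a i ≢ 0ℚ
    drop = let b , b∙v≈0 , i , bi≢0 = dependent n (λ j → w (suc j)) (λ i → v (suc i)) (λ i j → A (suc i) (suc j)) v′≈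
           in (λ { zero → 0ℚ ; (suc i) → b i })
      , ≈-trans (+-cong (≈-trans (*-congʳ ι0) (zeroˡ _)) b∙v≈0) (+-identityˡ 0#)
      , suc i , bi≢0

  independent⇒spans : ∀ {n} → degree ≡ n → (v : Fin n → Carrier) → Independent v → ∀ x → ∃[ a ] x ≈ a ∙ v
  independent⇒spans refl v ind x with dependent degree basis x∷v (λ i → proj₁ (spans (x∷v i))) (λ i → proj₂ (spans (x∷v i)))
    where
    x∷v : Fin (suc degree) → Carrier
    x∷v zero    = x
    x∷v (suc i) = v i
  ... | a , eq , i , ai≢0 = (λ i → ℚ.- r ℚ.* a (suc i)) , (begin
      x  ≈⟨ FS.solve 2 (λ x r → x := con 1ℤ :* x :- r :* con 0ℤ) ≈-refl x (ι r) ⟩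
      con1 * x - ι r * ιℤ 0ℤ  ≈⟨ +-cong (*-congʳ (≈-trans (ι-cong (sym ra≡1)) (ι-* r (a zero)))) (-‿cong (*-congˡ (≈-trans ι0 (≈-sym eq)))) ⟩
      ι r * ι (a zero) * x - ι r * (ι (a zero) * x + rest)  ≈⟨ FS.solve 4 (λ r a x s → r :* a :* x :- r :* (a :* x :+ s) := con 0ℤ :- r :* s) ≈-refl (ι r) (ι (a zero)) x rest ⟩
      ιℤ 0ℤ - ι r * rest  ≈⟨ +-cong (≈-sym zero∙) ≈-refl ⟩
      (λ _ → 0ℚ) ∙ v - ι r * rest  ≈⟨ ∙-minus (λ _ → 0ℚ) (λ i → a (suc i)) r v ⟩
      (λ i → 0ℚ ℚ.- r ℚ.* a (suc i)) ∙ v  ≈⟨ ∙-congˡ v (λ i → trans (ℚ.+-identityˡ _) (ℚ.neg-distribˡ-* r (a (suc i)))) ⟩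
      (λ i → ℚ.- r ℚ.* a (suc i)) ∙ v  ∎)
    where
    con1 = ιℤ 1ℤ
    rest = (λ i → a (suc i)) ∙ v
    zero∙ : (λ _ → 0ℚ) ∙ v ≈ ιℤ 0ℤ
    zero∙ = ≈-trans (sum-cong-≋ (λ i → ≈-trans (*-congʳ ι0) (zeroˡ (v i)))) (≈-trans (sum-replicate-zero degree) (≈-sym ι0))
      where open import Algebra.Properties.Monoid.Sum +-monoid using (sum-replicate-zero)
    a₀≢0 : a zero ≢ 0ℚ
    a₀≢0 a₀≡0 = ai≢0 (all-zero i)
      where
      all-zero : ∀ i → a i ≡ 0ℚ
      all-zero zero    = a₀≡0
      all-zero (suc i) = ind (λ i → a (suc i)) (≈-trans (≈-sym (+-identityˡ rest))
        (≈-trans (+-congʳ (≈-sym (≈-trans (*-congʳ (≈-trans (ι-cong a₀≡0) ι0)) (zeroˡ x)))) eq)) i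
    r = proj₁ (1/ι (a zero) a₀≢0)
    ra≡1 = proj₂ (1/ι (a zero) a₀≢0)

-- Quadratic fields

IsDiscriminant : ℤ → Set
IsDiscriminant D = (+ 4 ∣ D) ⊎ (+ 4 ∣ D ℤ.- 1ℤ)

-- Discriminants of quadratic fields, except that 1 is allowed.
record Fundamental (D : ℤ) : Set where
  field
    discriminant : IsDiscriminant D
    reduced      : ∀ k → 2 ℕ.≤ k → ∀ E → D ≡ (+ k ℤ.* + k) ℤ.* E → ¬ IsDiscriminant E

isDiscriminant? : ∀ D → Dec (IsDiscriminant D)
isDiscriminant? D = (+ 4 ∣? D) ⊎-dec (+ 4 ∣? (D ℤ.- 1ℤ))

Reducible : ℤ → ℕ → Set
Reducible D k = 2 ℕ.≤ k × ∃[ E ] (D ≡ (+ k ℤ.* + k) ℤ.* E × IsDiscriminant E)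

reducible? : ∀ D k → Dec (Reducible D k)
reducible? D k with 2 ℕ.≤? k
... | no 2≰k = no λ r → 2≰k (proj₁ r)
... | yes 2≤k@(ℕ.s≤s (ℕ.s≤s _)) with (+ k ℤ.* + k) ∣? D
...   | no k²∤D = no λ (_ , E , eq , _) → k²∤D (divides E (trans eq (ℤ.*-comm (+ k ℤ.* + k) E)))
...   | yes (divides E eq) with isDiscriminant? E
...     | yes disc = yes (2≤k , E , trans eq (ℤ.*-comm E (+ k ℤ.* + k)) , disc)
...     | no ¬disc = no λ (_ , E′ , eq′ , disc) →
  ¬disc (subst IsDiscriminant (ℤ.*-cancelˡ-≡ (+ k ℤ.* + k) E′ E (trans (sym eq′) (trans eq (ℤ.*-comm E _)))) disc)

∣E∣-bounds : ∀ {D E k} → D ≢ 0ℤ → 2 ℕ.≤ k → D ≡ (+ k ℤ.* + k) ℤ.* E → ℤ.∣ E ∣ ℕ.< ℤ.∣ D ∣ × k ℕ.≤ ℤ.∣ D ∣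
∣E∣-bounds {D} {E} {k} D≢0 2≤k@(ℕ.s≤s (ℕ.s≤s _)) eq = subst (ℤ.∣ E ∣ ℕ.<_) (sym ∣D∣) E<
  , subst (k ℕ.≤_) (sym ∣D∣) (ℕ.≤-trans (ℕ.m≤m*n k k) (ℕ.m≤m*n (k ℕ.* k) ℤ.∣ E ∣ {{E≢0}}))
  where
  ∣D∣ : ℤ.∣ D ∣ ≡ k ℕ.* k ℕ.* ℤ.∣ E ∣
  ∣D∣ = trans (cong ℤ.∣_∣ eq) (trans (ℤ.abs-* (+ k ℤ.* + k) E) (cong (ℕ._* ℤ.∣ E ∣) (ℤ.abs-* (+ k) (+ k))))
  E≢0 : ℕ.NonZero ℤ.∣ E ∣
  E≢0 = ℕ.≢-nonZero λ E≡0 → D≢0 (trans eq (trans (cong ((+ k ℤ.* + k) ℤ.*_) (ℤ.∣i∣≡0⇒i≡0 E≡0)) (ℤ.*-zeroʳ (+ k ℤ.* + k))))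
  E< : ℤ.∣ E ∣ ℕ.< k ℕ.* k ℕ.* ℤ.∣ E ∣
  E< = subst (ℤ.∣ E ∣ ℕ.<_) (ℕ.*-comm ℤ.∣ E ∣ (k ℕ.* k)) (ℕ.m<m*n ℤ.∣ E ∣ (k ℕ.* k) {{E≢0}} (ℕ.*-mono-≤ {1} {k} {2} {k} (ℕ.≤-trans (ℕ.s≤s ℕ.z≤n) 2≤k) 2≤k))

module _ {c ℓ} (F : NumberField c ℓ) where
  open FieldProperties F

  Irrational : Carrier → Set ℓ
  Irrational s = ∀ a b → ι a + ι b * s ≈ 0# → a ≡ 0ℚ × b ≡ 0ℚ

  record QuadraticGenerator : Set (c ⊔ ℓ) where
    field
      s           : Carrier
      D           : ℤ
      s²≈D        : s * s ≈ ιℤ D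
      irrational  : Irrational s
      generates   : ∀ x → ∃₂ λ a b → x ≈ ι a + ι b * s
      fundamental : Fundamental D

ℚ-domain : ∀ x {y} → y ≢ 0ℚ → x ℚ.* y ≡ 0ℚ → x ≡ 0ℚ
ℚ-domain x {y} y≢0 eq = begin
  x  ≡⟨ ℚ.*-identityʳ x ⟨
  x ℚ.* 1ℚ  ≡⟨ cong (x ℚ.*_) (ℚ.*-inverseʳ y) ⟨
  x ℚ.* (y ℚ.* ℚ.1/ y)  ≡⟨ ℚ.*-assoc x y (ℚ.1/ y) ⟨
  x ℚ.* y ℚ.* ℚ.1/ y  ≡⟨ cong (ℚ._* ℚ.1/ y) eq ⟩
  0ℚ ℚ.* ℚ.1/ y  ≡⟨ ℚ.*-zeroˡ (ℚ.1/ y) ⟩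
  0ℚ  ∎
  where
  open ≡-Reasoning
  instance
    y-nonZero : ℚ.NonZero y
    y-nonZero = ℚ.≢-nonZero y≢0

ℚ-*-cancelʳ : ∀ x y {z} → z ≢ 0ℚ → x ℚ.* z ≡ y ℚ.* z → x ≡ y
ℚ-*-cancelʳ x y {z} z≢0 eq = begin
  x  ≡⟨ add-back x y ⟩
  x ℚ.- y ℚ.+ y  ≡⟨ cong (ℚ._+ y) (ℚ-domain (x ℚ.- y) z≢0 x-y≡0) ⟩
  0ℚ ℚ.+ y  ≡⟨ ℚ.+-identityˡ y ⟩
  y  ∎
  where
  open ≡-Reasoning
  x-y≡0 : (x ℚ.- y) ℚ.* z ≡ 0ℚ
  x-y≡0 = begin
    (x ℚ.- y) ℚ.* z  ≡⟨ ℚS.solve 3 (λ x y z → (x ℚS.:- y) ℚS.:* z ℚS.:= x ℚS.:* z ℚS.:- y ℚS.:* z) refl x y z ⟩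
    x ℚ.* z ℚ.- y ℚ.* z  ≡⟨ cong (ℚ._- y ℚ.* z) eq ⟩
    y ℚ.* z ℚ.- y ℚ.* z  ≡⟨ ℚ.+-inverseʳ (y ℚ.* z) ⟩
    0ℚ  ∎

module QuadraticField {c ℓ} (F : NumberField c ℓ) (degree≡2 : NumberField.degree F ≡ 2) where
  open FieldProperties F
  open FS using (_:+_; _:*_; _:-_; :-_; _:=_; con)
  open LinearAlgebra F
  open import Relation.Binary.Reasoning.Setoid setoid

  basis-of-degree : ∀ {n} → degree ≡ n → ∃[ v ] Independent {n} v × (∀ x → ∃[ a ] x ≈ a ∙ v)
  basis-of-degree refl = basis , independent , spans

  irrational-element : ∃[ θ ] Irrational F θ
  irrational-element =
    let v , ind , span = basis-of-degree degree≡2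
        u , 1≈u∙v = span 1#
    in go v ind u 1≈u∙v
    where
    0₂ : Fin 2
    0₂ = zero
    1₂ : Fin 2
    1₂ = suc zero
    go : ∀ v → Independent {2} v → ∀ u → 1# ≈ u ∙ v → ∃[ θ ] Irrational F θ
    go v ind u 1≈ with u 0₂ ℚ.≟ 0ℚ | u 1₂ ℚ.≟ 0ℚ
    ... | yes u₀≡0 | yes u₁≡0 = contradiction (≈-trans 1≈ (≈-trans
            (+-cong (kill u₀≡0) (≈-trans (+-congʳ (kill u₁≡0)) (+-identityˡ 0#))) (+-identityˡ 0#))) 1≉0
      where
      kill : ∀ {q x} → q ≡ 0ℚ → ι q * x ≈ 0#
      kill {q} {x} q≡0 = ≈-trans (*-congʳ (≈-trans (ι-cong q≡0) ι0)) (zeroˡ x)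
    ... | no u₀≢0  | _       = v 1₂ , λ a b eq →
      let w : Fin 2 → ℚ
          w = λ { zero → a ℚ.* u 0₂ ; (suc zero) → a ℚ.* u 1₂ ℚ.+ b }
          w∙v≈0 : w ∙ v ≈ 0#
          w∙v≈0 = begin
            ι (a ℚ.* u 0₂) * v 0₂ + (ι (a ℚ.* u 1₂ ℚ.+ b) * v 1₂ + 0#)
              ≈⟨ +-cong (*-congʳ (ι-* a (u 0₂))) (+-congʳ (*-congʳ (≈-trans (ι-+ _ b) (+-congʳ (ι-* a (u 1₂)))))) ⟩
            ι a * ι (u 0₂) * v 0₂ + ((ι a * ι (u 1₂) + ι b) * v 1₂ + 0#)
              ≈⟨ +-congˡ (+-identityʳ _) ⟩
            ι a * ι (u 0₂) * v 0₂ + (ι a * ι (u 1₂) + ι b) * v 1₂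
              ≈⟨ FS.solve 6 (λ a x p y q b → a :* x :* p :+ (a :* y :+ b) :* q := a :* (x :* p :+ y :* q) :+ b :* q) ≈-refl (ι a) (ι (u 0₂)) (v 0₂) (ι (u 1₂)) (v 1₂) (ι b) ⟩
            ι a * (ι (u 0₂) * v 0₂ + ι (u 1₂) * v 1₂) + ι b * v 1₂
              ≈⟨ +-congʳ (*-congˡ (≈-trans (+-congˡ (≈-sym (+-identityʳ _))) (≈-sym 1≈))) ⟩
            ι a * 1# + ι b * v 1₂
              ≈⟨ +-congʳ (*-identityʳ (ι a)) ⟩
            ι a + ι b * v 1₂
              ≈⟨ eq ⟩
            0# ∎
          a≡0 : a ≡ 0ℚ
          a≡0 = ℚ-domain a u₀≢0 (ind w w∙v≈0 0₂)
      in a≡0 , trans (sym (trans (cong (λ z → z ℚ.* u 1₂ ℚ.+ b) a≡0) (trans (cong (ℚ._+ b) (ℚ.*-zeroˡ (u 1₂))) (ℚ.+-identityˡ b)))) (ind w w∙v≈0 1₂)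
    ... | yes u₀≡0  | no u₁≢0 = v 0₂ , λ a b eq →
      let w : Fin 2 → ℚ
          w = λ { zero → a ℚ.* u 0₂ ℚ.+ b ; (suc zero) → a ℚ.* u 1₂ }
          w∙v≈0 : w ∙ v ≈ 0#
          w∙v≈0 = begin
            ι (a ℚ.* u 0₂ ℚ.+ b) * v 0₂ + (ι (a ℚ.* u 1₂) * v 1₂ + 0#)
              ≈⟨ +-cong (*-congʳ (≈-trans (ι-+ _ b) (+-congʳ (ι-* a (u 0₂))))) (+-congʳ (*-congʳ (ι-* a (u 1₂)))) ⟩
            (ι a * ι (u 0₂) + ι b) * v 0₂ + (ι a * ι (u 1₂) * v 1₂ + 0#)
              ≈⟨ +-congˡ (+-identityʳ _) ⟩
            (ι a * ι (u 0₂) + ι b) * v 0₂ + ι a * ι (u 1₂) * v 1₂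
              ≈⟨ FS.solve 6 (λ a x p y q b → (a :* x :+ b) :* p :+ a :* y :* q := a :* (x :* p :+ y :* q) :+ b :* p) ≈-refl (ι a) (ι (u 0₂)) (v 0₂) (ι (u 1₂)) (v 1₂) (ι b) ⟩
            ι a * (ι (u 0₂) * v 0₂ + ι (u 1₂) * v 1₂) + ι b * v 0₂
              ≈⟨ +-congʳ (*-congˡ (≈-trans (+-congˡ (≈-sym (+-identityʳ _))) (≈-sym 1≈))) ⟩
            ι a * 1# + ι b * v 0₂
              ≈⟨ +-congʳ (*-identityʳ (ι a)) ⟩
            ι a + ι b * v 0₂
              ≈⟨ eq ⟩
            0# ∎
          a≡0 : a ≡ 0ℚ
          a≡0 = ℚ-domain a u₁≢0 (ind w w∙v≈0 1₂)
      in a≡0 , trans (sym (trans (cong (λ z → z ℚ.* u 0₂ ℚ.+ b) a≡0) (trans (cong (ℚ._+ b) (ℚ.*-zeroˡ (u 0₂))) (ℚ.+-identityˡ b)))) (ind w w∙v≈0 0₂)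

  irrational⇒generates : ∀ {θ} → Irrational F θ → ∀ x → ∃₂ λ a b → x ≈ ι a + ι b * θ
  irrational⇒generates {θ} irr x =
    let a , x≈ = independent⇒spans degree≡2 v ind x
    in a zero , a (suc zero) , ≈-trans x≈ (+-cong (*-identityʳ _) (+-identityʳ _))
    where
    v : Fin 2 → Carrier
    v zero       = 1#
    v (suc zero) = θ
    ind : Independent v
    ind a eq = pick (irr (a zero) (a (suc zero)) (≈-trans (+-cong (≈-sym (*-identityʳ _)) (≈-sym (+-identityʳ _))) eq))
      where
      pick : a zero ≡ 0ℚ × a (suc zero) ≡ 0ℚ → ∀ i → a i ≡ 0ℚ
      pick (p , q) zero       = p
      pick (p , q) (suc zero) = q

  irrational-affine : ∀ {θ} → Irrational F θ → ∀ t u → u ≢ 0ℚ → Irrational F (ι t + ι u * θ)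
  irrational-affine {θ} irr t u u≢0 a b eq =
    let p , q = irr (a ℚ.+ b ℚ.* t) (b ℚ.* u) (begin
          ι (a ℚ.+ b ℚ.* t) + ι (b ℚ.* u) * θ  ≈⟨ +-cong (≈-trans (ι-+ a _) (+-congˡ (ι-* b t))) (*-congʳ (ι-* b u)) ⟩
          (ι a + ι b * ι t) + ι b * ι u * θ  ≈⟨ FS.solve 5 (λ a b t u θ → (a :+ b :* t) :+ b :* u :* θ := a :+ b :* (t :+ u :* θ)) ≈-refl (ι a) (ι b) (ι t) (ι u) θ ⟩
          ι a + ι b * (ι t + ι u * θ)  ≈⟨ eq ⟩
          0#  ∎)
        b≡0 = ℚ-domain b u≢0 q
    in trans (sym (trans (cong (λ z → a ℚ.+ z ℚ.* t) b≡0) (trans (cong (a ℚ.+_) (ℚ.*-zeroˡ t)) (ℚ.+-identityʳ a)))) p , b≡0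

  irrational-scale : ∀ {θ} → Irrational F θ → ∀ u → u ≢ 0ℚ → Irrational F (ι u * θ)
  irrational-scale {θ} irr u u≢0 a b eq = irrational-affine irr 0ℚ u u≢0 a b
    (≈-trans (+-congˡ (*-congˡ (≈-trans (+-congʳ ι0) (+-identityˡ _)))) eq)

  square-irrational⇒≢0 : ∀ {s D} → Irrational F s → s * s ≈ ιℤ D → D ≢ 0ℤ
  square-irrational⇒≢0 {s} {D} irr s²≈D D≡0 = 0≢1 (proj₂ (irr 0ℚ 1ℚ (begin
      ι 0ℚ + ι 1ℚ * s  ≈⟨ FS.solve 1 (λ s → con 0ℤ :+ con 1ℤ :* s := s) ≈-refl s ⟩
      s  ≈⟨ xy≈0⇒x≈0 s≉0 (≈-trans s²≈D (≈-trans (ιℤ-cong D≡0) ι0)) ⟩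
      0#  ∎)))
    where
    0≢1 : 1ℚ ≢ 0ℚ
    0≢1 ()
    s≉0 : ¬ (s ≈ 0#)
    s≉0 s≈0 = 0≢1 (proj₂ (irr 0ℚ 1ℚ (≈-trans (+-cong ι0 (≈-trans (*-congˡ s≈0) (zeroʳ _))) (+-identityˡ 0#))))

  reduce : ∀ {s D} → Acc ℕ._<_ ℤ.∣ D ∣ → IsDiscriminant D → Irrational F s → s * s ≈ ιℤ D → QuadraticGenerator F
  reduce {s} {D} (acc rec) disc irr s²≈D with ℕ.anyUpTo? (reducible? D) (suc ℤ.∣ D ∣)
  ... | no irreducible = record
    { s = s ; D = D ; s²≈D = s²≈D ; irrational = irr ; generates = irrational⇒generates irr
    ; fundamental = record
      { discriminant = disc
      ; reduced = λ k 2≤k E eq discE → irreducible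
          (k , ℕ.s≤s (proj₂ (∣E∣-bounds {D} {E} {k} (square-irrational⇒≢0 irr s²≈D) 2≤k eq)) , 2≤k , E , eq , discE) } }
  ... | yes (k , _ , 2≤k , E , eq , discE) =
    let k≢0 : fromℤ (+ k) ≢ 0ℚ
        k≢0 k≡0 = k≢0′ 2≤k (fromℤ-injective k≡0)
        r , rk≡1 = 1/ι (fromℤ (+ k)) k≢0
        r≢0 : r ≢ 0ℚ
        r≢0 r≡0 = 0≢1 (trans (sym rk≡1) (trans (cong (ℚ._* fromℤ (+ k)) r≡0) (ℚ.*-zeroˡ (fromℤ (+ k)))))
    in reduce {ι r * s} {E} (rec (proj₁ (∣E∣-bounds {D} {E} {k} (square-irrational⇒≢0 irr s²≈D) 2≤k eq))) discE
      (irrational-scale irr r r≢0) (begin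
        ι r * s * (ι r * s)  ≈⟨ FS.solve 2 (λ r s → r :* s :* (r :* s) := r :* r :* (s :* s)) ≈-refl (ι r) s ⟩
        ι r * ι r * (s * s)  ≈⟨ *-congˡ (≈-trans s²≈D (≈-trans (ιℤ-cong eq) (≈-trans (ιℤ-* (+ k ℤ.* + k) E) (*-congʳ (ιℤ-* (+ k) (+ k)))))) ⟩
        ι r * ι r * (ιℤ (+ k) * ιℤ (+ k) * ιℤ E)  ≈⟨ FS.solve 3 (λ r k e → r :* r :* (k :* k :* e) := (r :* k) :* (r :* k) :* e) ≈-refl (ι r) (ιℤ (+ k)) (ιℤ E) ⟩
        (ι r * ιℤ (+ k)) * (ι r * ιℤ (+ k)) * ιℤ E  ≈⟨ *-congʳ (*-cong (rk≈1 r rk≡1) (rk≈1 r rk≡1)) ⟩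
        1# * 1# * ιℤ E  ≈⟨ ≈-trans (*-congʳ (*-identityˡ 1#)) (*-identityˡ _) ⟩
        ιℤ E  ∎)
    where
    0≢1 : 1ℚ ≢ 0ℚ
    0≢1 ()
    k≢0′ : ∀ {k} → 2 ℕ.≤ k → + k ≢ 0ℤ
    k≢0′ (ℕ.s≤s _) ()
    rk≈1 : ∀ r → r ℚ.* fromℤ (+ k) ≡ 1ℚ → ι r * ιℤ (+ k) ≈ 1#
    rk≈1 r rk≡1 = ≈-trans (≈-sym (ι-* r _)) (≈-trans (ι-cong rk≡1) ι1)

  fundamentalGenerator : QuadraticGenerator F
  fundamentalGenerator =
    let θ , irr = irrational-element
        a , b , θ²≈ = irrational⇒generates irr (θ * θ)
    in complete-square θ irr a b θ²≈
    where
    complete-square : ∀ θ → Irrational F θ → ∀ a b → θ * θ ≈ ι a + ι b * θ → QuadraticGenerator F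
    complete-square θ irr a b θ²≈ = reduce (<-wellFounded _) (inj₁ (divides (n ℤ.* d) (ℤ.*-comm (+ 4) (n ℤ.* d))))
      (irrational-scale (irrational-affine irr (ℚ.- b) (fromℤ (+ 2)) (λ ())) (fromℤ (+ 2 ℤ.* d)) 2d≢0) (begin
        ιℤ (+ 2 ℤ.* d) * ψ * (ιℤ (+ 2 ℤ.* d) * ψ)  ≈⟨ *-cong (*-congʳ (ιℤ-* (+ 2) d)) (*-congʳ (ιℤ-* (+ 2) d)) ⟩
        ιℤ (+ 2) * ιℤ d * ψ * (ιℤ (+ 2) * ιℤ d * ψ)  ≈⟨ FS.solve 2 (λ d ψ → con (+ 2) :* d :* ψ :* (con (+ 2) :* d :* ψ) := con (+ 4) :* ((ψ :* ψ) :* d :* d)) ≈-refl (ιℤ d) ψ ⟩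
        ιℤ (+ 4) * (ψ * ψ * ιℤ d * ιℤ d)  ≈⟨ *-congˡ (*-congʳ (*-congʳ ψ²≈q)) ⟩
        ιℤ (+ 4) * (ι q * ιℤ d * ιℤ d)  ≈⟨ *-congˡ (*-congʳ (≈-trans (≈-sym (ι-* q _)) (ι-cong (↧*≡↥ q)))) ⟩
        ιℤ (+ 4) * (ιℤ n * ιℤ d)  ≈⟨ ≈-trans (ιℤ-* (+ 4) (n ℤ.* d)) (*-congˡ (ιℤ-* n d)) ⟨
        ιℤ (+ 4 ℤ.* (n ℤ.* d))  ∎)
      where
      q = fromℤ (+ 4) ℚ.* a ℚ.+ b ℚ.* b
      n = ℚ.↥ q
      d = ℚ.↧ q
      ψ = ι (ℚ.- b) + ιℤ (+ 2) * θ
      ψ²≈q : ψ * ψ ≈ ι q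
      ψ²≈q = begin
        ψ * ψ  ≈⟨ *-cong (+-congʳ (ι-neg b)) (+-congʳ (ι-neg b)) ⟩
        (- ι b + ιℤ (+ 2) * θ) * (- ι b + ιℤ (+ 2) * θ)  ≈⟨ FS.solve 2 (λ b θ → (:- b :+ con (+ 2) :* θ) :* (:- b :+ con (+ 2) :* θ) := con (+ 4) :* (θ :* θ :- b :* θ) :+ b :* b) ≈-refl (ι b) θ ⟩
        ιℤ (+ 4) * (θ * θ - ι b * θ) + ι b * ι b  ≈⟨ +-congʳ (*-congˡ (+-congʳ θ²≈)) ⟩
        ιℤ (+ 4) * (ι a + ι b * θ - ι b * θ) + ι b * ι b  ≈⟨ FS.solve 3 (λ a b θ → con (+ 4) :* (a :+ b :* θ :- b :* θ) :+ b :* b := con (+ 4) :* a :+ b :* b) ≈-refl (ι a) (ι b) θ ⟩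
        ιℤ (+ 4) * ι a + ι b * ι b  ≈⟨ ≈-trans (ι-+ _ _) (+-cong (ι-* _ a) (ι-* b b)) ⟨
        ι q  ∎
      2d≢0 : fromℤ (+ 2 ℤ.* d) ≢ 0ℚ
      2d≢0 eq = contradiction (fromℤ-injective {+ 2 ℤ.* d} {0ℤ} eq) λ ()

  abstract
    quadraticGenerator : QuadraticGenerator F
    quadraticGenerator = fundamentalGenerator

-- Biquadratic fields

module Quadruples {c₁ ℓ₁ c₂ ℓ₂} (C : CommutativeRing c₁ ℓ₁) (R : CommutativeRing c₂ ℓ₂)
  (φ : CommutativeRing.Carrier C → CommutativeRing.Carrier R)
  (φ-homo : IsRingHomomorphism (CommutativeRing.rawRing C) (CommutativeRing.rawRing R) φ)
  (p q : CommutativeRing.Carrier C) (u v : CommutativeRing.Carrier R)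
  (u²≈p : CommutativeRing._≈_ R (CommutativeRing._*_ R u u) (φ p))
  (v²≈q : CommutativeRing._≈_ R (CommutativeRing._*_ R v v) (φ q))
  where

  private
    module C = CommutativeRing C
    module φ = IsRingHomomorphism φ-homo
  open CommutativeRing R hiding (zero) renaming (refl to ≈-refl; sym to ≈-sym; trans to ≈-trans)
  open NaturalSolver commutativeSemiring
  open import Relation.Binary.Reasoning.Setoid setoid

  quad : C.Carrier → C.Carrier → C.Carrier → C.Carrier → Carrier
  quad a b c d = φ a + φ b * u + φ c * v + φ d * (u * v)

  quad-cong : ∀ {a b c d a′ b′ c′ d′} → a C.≈ a′ → b C.≈ b′ → c C.≈ c′ → d C.≈ d′ →
    quad a b c d ≈ quad a′ b′ c′ d′
  quad-cong a≈ b≈ c≈ d≈ = +-cong (+-cong (+-cong (φ.⟦⟧-cong a≈) (*-congʳ (φ.⟦⟧-cong b≈)))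
    (*-congʳ (φ.⟦⟧-cong c≈))) (*-congʳ (φ.⟦⟧-cong d≈))

  quad-+ : ∀ a b c d a′ b′ c′ d′ →
    quad a b c d + quad a′ b′ c′ d′ ≈ quad (a C.+ a′) (b C.+ b′) (c C.+ c′) (d C.+ d′)
  quad-+ a b c d a′ b′ c′ d′ = begin
    quad a b c d + quad a′ b′ c′ d′
      ≈⟨ solve 10 (λ a b c d a′ b′ c′ d′ u v →
           (a :+ b :* u :+ c :* v :+ d :* (u :* v)) :+ (a′ :+ b′ :* u :+ c′ :* v :+ d′ :* (u :* v)) :=
           (a :+ a′) :+ (b :+ b′) :* u :+ (c :+ c′) :* v :+ (d :+ d′) :* (u :* v)) ≈-refl
           (φ a) (φ b) (φ c) (φ d) (φ a′) (φ b′) (φ c′) (φ d′) u v ⟩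
    (φ a + φ a′) + (φ b + φ b′) * u + (φ c + φ c′) * v + (φ d + φ d′) * (u * v)
      ≈⟨ +-cong (+-cong (+-cong (φ.+-homo a a′) (*-congʳ (φ.+-homo b b′))) (*-congʳ (φ.+-homo c c′)))
           (*-congʳ (φ.+-homo d d′)) ⟨
    quad (a C.+ a′) (b C.+ b′) (c C.+ c′) (d C.+ d′) ∎

  private
    φ-*₃ : ∀ x y {z w} → w ≈ φ z → φ (x C.* y C.* z) ≈ φ x * φ y * w
    φ-*₃ x y {z} w≈ = ≈-trans (φ.*-homo (x C.* y) z) (*-cong (φ.*-homo x y) (≈-sym w≈))

    φ-+₂ : ∀ {x y x′ y′} → φ x ≈ x′ → φ y ≈ y′ → φ (x C.+ y) ≈ x′ + y′
    φ-+₂ {x} {y} x≈ y≈ = ≈-trans (φ.+-homo x y) (+-cong x≈ y≈)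

  quad-* : ∀ a b c d a′ b′ c′ d′ →
    quad a b c d * quad a′ b′ c′ d′ ≈
    quad (a C.* a′ C.+ b C.* b′ C.* p C.+ c C.* c′ C.* q C.+ d C.* d′ C.* (p C.* q))
         (a C.* b′ C.+ b C.* a′ C.+ c C.* d′ C.* q C.+ d C.* c′ C.* q)
         (a C.* c′ C.+ c C.* a′ C.+ b C.* d′ C.* p C.+ d C.* b′ C.* p)
         (a C.* d′ C.+ d C.* a′ C.+ b C.* c′ C.+ c C.* b′)
  quad-* a b c d a′ b′ c′ d′ = begin
    quad a b c d * quad a′ b′ c′ d′
      ≈⟨ solve 10 (λ a b c d a′ b′ c′ d′ u v →
           (a :+ b :* u :+ c :* v :+ d :* (u :* v)) :* (a′ :+ b′ :* u :+ c′ :* v :+ d′ :* (u :* v)) :=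
           (a :* a′ :+ b :* b′ :* (u :* u) :+ c :* c′ :* (v :* v) :+ d :* d′ :* ((u :* u) :* (v :* v)))
           :+ (a :* b′ :+ b :* a′ :+ c :* d′ :* (v :* v) :+ d :* c′ :* (v :* v)) :* u
           :+ (a :* c′ :+ c :* a′ :+ b :* d′ :* (u :* u) :+ d :* b′ :* (u :* u)) :* v
           :+ (a :* d′ :+ d :* a′ :+ b :* c′ :+ c :* b′) :* (u :* v)) ≈-refl
           (φ a) (φ b) (φ c) (φ d) (φ a′) (φ b′) (φ c′) (φ d′) u v ⟩
    _ ≈⟨ +-cong (+-cong (+-cong
           (φ-+₂ (φ-+₂ (φ-+₂ (φ.*-homo a a′) (φ-*₃ b b′ u²≈p)) (φ-*₃ c c′ v²≈q))
             (φ-*₃ d d′ (≈-trans (*-cong u²≈p v²≈q) (≈-sym (φ.*-homo p q)))))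
           (*-congʳ (φ-+₂ (φ-+₂ (φ-+₂ (φ.*-homo a b′) (φ.*-homo b a′)) (φ-*₃ c d′ v²≈q)) (φ-*₃ d c′ v²≈q))))
           (*-congʳ (φ-+₂ (φ-+₂ (φ-+₂ (φ.*-homo a c′) (φ.*-homo c a′)) (φ-*₃ b d′ u²≈p)) (φ-*₃ d b′ u²≈p))))
           (*-congʳ (φ-+₂ (φ-+₂ (φ-+₂ (φ.*-homo a d′) (φ.*-homo d a′)) (φ.*-homo b c′)) (φ.*-homo c b′))) ⟨
    quad (a C.* a′ C.+ b C.* b′ C.* p C.+ c C.* c′ C.* q C.+ d C.* d′ C.* (p C.* q))
         (a C.* b′ C.+ b C.* a′ C.+ c C.* d′ C.* q C.+ d C.* c′ C.* q)
         (a C.* c′ C.+ c C.* a′ C.+ b C.* d′ C.* p C.+ d C.* b′ C.* p)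
         (a C.* d′ C.+ d C.* a′ C.+ b C.* c′ C.+ c C.* b′) ∎

  quad-const : ∀ a → quad a C.0# C.0# C.0# ≈ φ a
  quad-const a = ≈-trans (+-cong (≈-trans (+-cong (≈-trans (+-congˡ (kill u)) (+-identityʳ _)) (kill v)) (+-identityʳ _)) (kill (u * v))) (+-identityʳ _)
    where
    kill : ∀ x → φ C.0# * x ≈ 0#
    kill x = ≈-trans (*-congʳ φ.0#-homo) (zeroˡ x)

module _ where
  open import Data.Integer.Base using (_+_; _*_; _-_; -_)
  open ℤS using (_:+_; _:*_; _:-_; :-_; _:=_; con)

  data Parity (z : ℤ) : Set where
    even : ∀ k → z ≡ + 2 * k → Parity z
    odd  : ∀ k → z ≡ + 2 * k + 1ℤ → Parity z

  parity : ∀ z → Parity z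
  parity z = go (z %ℕ 2) (z /ℕ 2) (n%ℕd<d z 2) (a≡a%ℕn+[a/ℕn]*n z 2)
    where
    go : ∀ r k → r ℕ.< 2 → z ≡ + r + k * + 2 → Parity z
    go zero       k _ eq = even k (trans eq (ℤS.solve 1 (λ k → con 0ℤ :+ k :* con (+ 2) := con (+ 2) :* k) refl k))
    go (suc zero) k _ eq = odd k (trans eq (ℤS.solve 1 (λ k → con 1ℤ :+ k :* con (+ 2) := con (+ 2) :* k :+ con 1ℤ) refl k))
    go (suc (suc r)) k (ℕ.s≤s (ℕ.s≤s ())) eq

  4∣⇒ : ∀ {D} → + 4 ∣ D → ∃[ d ] D ≡ + 4 * d
  4∣⇒ (divides d eq) = d , trans eq (ℤ.*-comm d (+ 4))

  ⇒4∣ : ∀ {D} d → D ≡ + 4 * d → + 4 ∣ D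
  ⇒4∣ d eq = divides d (trans eq (ℤ.*-comm (+ 4) d))

  discriminant-odd : ∀ {D} → + 4 ∣ D - 1ℤ → ∃[ d ] D ≡ + 4 * d + 1ℤ
  discriminant-odd {D} 4∣ = let d , eq = 4∣⇒ 4∣ in
    d , trans (ℤS.solve 1 (λ D → D := (D :- con 1ℤ) :+ con 1ℤ) refl D) (cong (ℤ._+ 1ℤ) eq)

  odd-discriminant : ∀ {D} d → D ≡ + 4 * d + 1ℤ → + 4 ∣ D - 1ℤ
  odd-discriminant {D} d eq = ⇒4∣ d (trans (cong (ℤ._- 1ℤ) eq)
    (ℤS.solve 1 (λ d → con (+ 4) :* d :+ con 1ℤ :- con 1ℤ := con (+ 4) :* d) refl d))

  square-discriminant : ∀ X W → IsDiscriminant (X * X - + 4 * W)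
  square-discriminant X W with parity X
  ... | even m refl = inj₁ (⇒4∣ (m * m - W)
    (ℤS.solve 2 (λ m w → (con (+ 2) :* m) :* (con (+ 2) :* m) :- con (+ 4) :* w := con (+ 4) :* (m :* m :- w)) refl m W))
  ... | odd m refl = inj₂ (odd-discriminant (m * m + m - W)
    (ℤS.solve 2 (λ m w → (con (+ 2) :* m :+ con 1ℤ) :* (con (+ 2) :* m :+ con 1ℤ) :- con (+ 4) :* w
      := con (+ 4) :* (m :* m :+ m :- w) :+ con 1ℤ) refl m W))

  -- Being a discriminant only depends on the residue class mod 4.
  discriminant-cancel-odd² : ∀ E k → IsDiscriminant (E * ((+ 2 * k + 1ℤ) * (+ 2 * k + 1ℤ))) → IsDiscriminant E
  discriminant-cancel-odd² E k (inj₁ 4∣) =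
    let d , eq = 4∣⇒ {E * (o * o)} 4∣ in inj₁ (⇒4∣ (d - w) (begin
      E  ≡⟨ expand ⟩
      E * (o * o) - + 4 * w  ≡⟨ cong (ℤ._- + 4 * w) eq ⟩
      + 4 * d - + 4 * w  ≡⟨ ℤS.solve 2 (λ d w → con (+ 4) :* d :- con (+ 4) :* w := con (+ 4) :* (d :- w)) refl d w ⟩
      + 4 * (d - w)  ∎))
    where
    open ≡-Reasoning
    o = + 2 * k + 1ℤ
    w = E * (k * k + k)
    expand : E ≡ E * (o * o) - + 4 * w
    expand = ℤS.solve 2 (λ e k → e := e :* ((con (+ 2) :* k :+ con 1ℤ) :* (con (+ 2) :* k :+ con 1ℤ)) :- con (+ 4) :* (e :* (k :* k :+ k))) refl E k
  discriminant-cancel-odd² E k (inj₂ 4∣) =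
    let d , eq = discriminant-odd {E * (o * o)} 4∣ in inj₂ (odd-discriminant (d - w) (begin
      E  ≡⟨ expand ⟩
      E * (o * o) - + 4 * w  ≡⟨ cong (ℤ._- + 4 * w) eq ⟩
      + 4 * d + 1ℤ - + 4 * w  ≡⟨ ℤS.solve 2 (λ d w → con (+ 4) :* d :+ con 1ℤ :- con (+ 4) :* w := con (+ 4) :* (d :- w) :+ con 1ℤ) refl d w ⟩
      + 4 * (d - w) + 1ℤ  ∎))
    where
    open ≡-Reasoning
    o = + 2 * k + 1ℤ
    w = E * (k * k + k)
    expand : E ≡ E * (o * o) - + 4 * w
    expand = ℤS.solve 2 (λ e k → e := e :* ((con (+ 2) :* k :+ con 1ℤ) :* (con (+ 2) :* k :+ con 1ℤ)) :- con (+ 4) :* (e :* (k :* k :+ k))) refl E k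

  coprime-cancel : ∀ e f z w → Coprimality.Coprime ℤ.∣ e ∣ ℤ.∣ f ∣ → z * e ≡ w * f → ∃[ y ] z ≡ y * f
  coprime-cancel e f z w c eq = _∣_.quotient f∣z , _∣_.equality f∣z
    where
    f∣z : f ∣ z
    f∣z = ∣ᵤ⇒∣ (Coprimality.coprime-divisor (Coprimality.sym c)
      (subst (ℤ.∣ f ∣ ℕ∣.∣_) (trans (ℤ.abs-* z e) (ℕ.*-comm ℤ.∣ z ∣ ℤ.∣ e ∣)) (∣⇒∣ᵤ (divides w eq))))

  coprime-parts : ∀ q → Coprimality.Coprime ℤ.∣ ℚ.↥ q ∣ (ℚ.↧ₙ q)
  coprime-parts (ℚ.mkℚ n d-1 c) = Coprimality.recompute c

  denominator-1 : ∀ q → ℚ.↧ₙ q ≡ 1 → q ≡ fromℤ (ℚ.↥ q)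
  denominator-1 q eq = trans (sym (trans (cong (λ n → q ℚ.* fromℤ (+ n)) eq) (ℚ.*-identityʳ q))) (↧*≡↥ q)

  reduced-fraction : ∀ {D} → Fundamental D → ∀ e f X W → 2 ℕ.≤ f → Coprimality.Coprime ℤ.∣ e ∣ f →
    (D * e) * e ≢ ((X * X - + 4 * W) * + f) * + f
  reduced-fraction {D} fund e f′ X W 2≤f@(ℕ.s≤s _) coprime De²≡Mf² =
    let y , De≡yf = coprime-cancel e f (D * e) (M * f) coprime De²≡Mf²
        D′ , D≡D′f = coprime-cancel e f D y coprime De≡yf
    in step₁ D′ D≡D′f
    where
    open Fundamental fund
    open ≡-Reasoning
    f = + f′
    M = X * X - + 4 * W
    cancel-f : ∀ i j → i * f ≡ j * f → i ≡ j
    cancel-f i j = ℤ.*-cancelʳ-≡ i j f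
    once : ∀ D₀ D₁ N → D₀ ≡ D₁ * f → (D₀ * e) * e ≡ N * f → (D₁ * e) * e ≡ N
    once D₀ D₁ N D₀≡D₁f D₀e²≡Nf = cancel-f ((D₁ * e) * e) N (begin
      D₁ * e * e * f  ≡⟨ ℤS.solve 3 (λ d e f → d :* e :* e :* f := (d :* f) :* e :* e) refl D₁ e f ⟩
      (D₁ * f) * e * e  ≡⟨ cong (λ z → z * e * e) D₀≡D₁f ⟨
      D₀ * e * e  ≡⟨ D₀e²≡Nf ⟩
      N * f  ∎)
    2∣abs : ∀ z k → z ≡ + 2 * k → 2 ℕ∣.∣ ℤ.∣ z ∣
    2∣abs z k eq = ∣⇒∣ᵤ {+ 2} {z} (divides k (trans eq (ℤ.*-comm (+ 2) k)))
    E-disc : ∀ E → E * (e * e) ≡ M → D ≡ f * f * E → Parity e → Parity f → IsDiscriminant E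
    E-disc E Ee²≡M _ (odd k e≡) _ = discriminant-cancel-odd² E k
      (subst (λ z → IsDiscriminant (E * (z * z))) e≡ (subst IsDiscriminant (sym Ee²≡M) (square-discriminant X W)))
    E-disc E _ D≡f²E (even k e≡) (odd l f≡) = discriminant-cancel-odd² E l
      (subst (λ z → IsDiscriminant (E * (z * z))) f≡ (subst IsDiscriminant (trans D≡f²E (ℤ.*-comm (f * f) E)) discriminant))
    E-disc E _ _ (even k e≡) (even l f≡) = contradiction (coprime (2∣abs e k e≡ , 2∣abs f l f≡)) λ ()
    step₂ : ∀ D′ E → D ≡ D′ * f → D′ * e * e ≡ M * f → D′ ≡ E * f → ⊥
    step₂ D′ E D≡D′f D′e²≡Mf D′≡Ef = reduced f′ 2≤f E D≡f²E
      (E-disc E (trans (sym (ℤ.*-assoc E e e)) (once D′ E M D′≡Ef D′e²≡Mf)) D≡f²E (parity e) (parity f))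
      where
      D≡f²E : D ≡ f * f * E
      D≡f²E = begin
        D  ≡⟨ D≡D′f ⟩
        D′ * f  ≡⟨ cong (ℤ._* f) D′≡Ef ⟩
        E * f * f  ≡⟨ ℤS.solve 2 (λ e f → e :* f :* f := f :* f :* e) refl E f ⟩
        f * f * E  ∎
    step₁ : ∀ D′ → D ≡ D′ * f → ⊥
    step₁ D′ D≡D′f =
      let D′e²≡Mf = once D D′ (M * f) D≡D′f De²≡Mf²
          y , D′e≡yf = coprime-cancel e f (D′ * e) M coprime D′e²≡Mf
          E , D′≡Ef = coprime-cancel e f D′ y coprime D′e≡yf
      in step₂ D′ E D≡D′f D′e²≡Mf D′≡Ef

  fundamental-denominator : ∀ {D} → Fundamental D → ∀ q X W →
    fromℤ D ℚ.* (q ℚ.* q) ≡ fromℤ (X * X - + 4 * W) → ∃[ z ] q ≡ fromℤ z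
  fundamental-denominator {D} fund q X W eq = ℚ.↥ q , denominator-1 q (f≡1 (ℚ.↧ₙ q) refl)
    where
    clear-denominators : ∀ e f M → q ℚ.* fromℤ f ≡ fromℤ e → fromℤ D ℚ.* (q ℚ.* q) ≡ fromℤ M →
      (D * e) * e ≡ (M * f) * f
    clear-denominators e f M qf≡e Dq²≡M = fromℤ-injective (begin
      fromℤ ((D * e) * e)  ≡⟨ trans (fromℤ-* (D * e) e) (cong (ℚ._* fromℤ e) (fromℤ-* D e)) ⟩
      fromℤ D ℚ.* fromℤ e ℚ.* fromℤ e  ≡⟨ cong (λ z → fromℤ D ℚ.* z ℚ.* z) qf≡e ⟨
      fromℤ D ℚ.* (q ℚ.* fromℤ f) ℚ.* (q ℚ.* fromℤ f)  ≡⟨ ℚS.solve 3 (λ d q f → d ℚS.:* (q ℚS.:* f) ℚS.:* (q ℚS.:* f) ℚS.:= (d ℚS.:* (q ℚS.:* q)) ℚS.:* f ℚS.:* f) refl (fromℤ D) q (fromℤ f) ⟩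
      fromℤ D ℚ.* (q ℚ.* q) ℚ.* fromℤ f ℚ.* fromℤ f  ≡⟨ cong (λ z → z ℚ.* fromℤ f ℚ.* fromℤ f) Dq²≡M ⟩
      fromℤ M ℚ.* fromℤ f ℚ.* fromℤ f  ≡⟨ trans (fromℤ-* (M * f) f) (cong (ℚ._* fromℤ f) (fromℤ-* M f)) ⟨
      fromℤ ((M * f) * f)  ∎)
      where open ≡-Reasoning
    f≡1 : ∀ n → n ≡ ℚ.↧ₙ q → ℚ.↧ₙ q ≡ 1
    f≡1 zero ()
    f≡1 (suc zero) n≡f = sym n≡f
    f≡1 (suc (suc n)) n≡f = ⊥-elim (reduced-fraction fund (ℚ.↥ q) (ℚ.↧ₙ q) X W
      (subst (2 ℕ.≤_) n≡f (ℕ.s≤s (ℕ.s≤s ℕ.z≤n))) (coprime-parts q)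
      (clear-denominators (ℚ.↥ q) (ℚ.↧ q) (X * X - + 4 * W) (↧*≡↥ q) eq))

-- Integrality

abs-quotient-< : ∀ {N w f} → N ≢ 0ℤ → 2 ℕ.≤ f → N ≡ w ℤ.* + f → ℤ.∣ w ∣ ℕ.< ℤ.∣ N ∣ × w ≢ 0ℤ
abs-quotient-< {N} {w} {f} N≢0 2≤f N≡wf = subst (ℤ.∣ w ∣ ℕ.<_) (sym (trans (cong ℤ.∣_∣ N≡wf) (ℤ.abs-* w (+ f))))
    (ℕ.m<m*n ℤ.∣ w ∣ f {{ℕ.≢-nonZero (λ w≡0 → w≢0 (ℤ.∣i∣≡0⇒i≡0 w≡0))}} 2≤f) , w≢0
  where
  w≢0 : w ≢ 0ℤ
  w≢0 w≡0 = N≢0 (trans N≡wf (trans (cong (ℤ._* + f) w≡0) (ℤ.*-zeroˡ (+ f))))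

module Powers {c ℓ} (R : CommutativeRing c ℓ) where
  open CommutativeRing R hiding (zero) renaming (refl to ≈-refl; sym to ≈-sym; trans to ≈-trans)
  open import Algebra.Properties.Semiring.Exp semiring public using (_^_)
  open import Algebra.Properties.CommutativeSemigroup *-commutativeSemigroup using (interchange)

  ^-distrib : ∀ x y k → (x * y) ^ k ≈ x ^ k * y ^ k
  ^-distrib x y zero    = ≈-sym (*-identityˡ 1#)
  ^-distrib x y (suc k) = ≈-trans (*-congˡ (^-distrib x y k)) (interchange x y (x ^ k) (y ^ k))

open Powers ℚ.+-*-commutativeRing using () renaming (_^_ to _^ℚ_)

module _ (q : ℚ) where
  -- If N qᵏ is an integer for all k, the denominator f of q divides all these
  -- integers, so N can be replaced by N / f.
  power-denominators : ∀ N → N ≢ 0ℤ → (∀ k → ∃[ z ] fromℤ N ℚ.* q ^ℚ k ≡ fromℤ z) → Acc ℕ._<_ ℤ.∣ N ∣ → ℚ.↧ₙ q ≡ 1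
  power-denominators N N≢0 h (acc rec) = go (ℚ.↧ₙ q) refl
    where
    open ≡-Reasoning
    divided : ∀ k → ∃[ w ] proj₁ (h k) ≡ w ℤ.* ℚ.↧ q
    divided k = step (proj₁ (h k)) (proj₁ (h (suc k))) (proj₂ (h k)) (proj₂ (h (suc k)))
      where
      step : ∀ z z′ → fromℤ N ℚ.* q ^ℚ k ≡ fromℤ z → fromℤ N ℚ.* (q ℚ.* q ^ℚ k) ≡ fromℤ z′ → ∃[ w ] z ≡ w ℤ.* ℚ.↧ q
      step z z′ eq eq′ = coprime-cancel (ℚ.↥ q) (ℚ.↧ q) z z′ (coprime-parts q) (cleared (ℚ.↥ q) (ℚ.↧ q) (↧*≡↥ q))
        where
        cleared : ∀ e f → q ℚ.* fromℤ f ≡ fromℤ e → z ℤ.* e ≡ z′ ℤ.* f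
        cleared e f qf≡e = fromℤ-injective (begin
          fromℤ (z ℤ.* e)  ≡⟨ fromℤ-* z e ⟩
          fromℤ z ℚ.* fromℤ e  ≡⟨ cong₂ ℚ._*_ eq qf≡e ⟨
          fromℤ N ℚ.* q ^ℚ k ℚ.* (q ℚ.* fromℤ f)  ≡⟨ ℚS.solve 4 (λ n p q f → n :* p :* (q :* f) := n :* (q :* p) :* f) refl (fromℤ N) (q ^ℚ k) q (fromℤ f) ⟩
          fromℤ N ℚ.* (q ℚ.* q ^ℚ k) ℚ.* fromℤ f  ≡⟨ cong (ℚ._* fromℤ f) eq′ ⟩
          fromℤ z′ ℚ.* fromℤ f  ≡⟨ fromℤ-* z′ f ⟨
          fromℤ (z′ ℤ.* f)  ∎)
          where open ℚS using (_:*_; _:=_)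
    go : ∀ n → n ≡ ℚ.↧ₙ q → ℚ.↧ₙ q ≡ 1
    go zero ()
    go (suc zero) n≡f = sym n≡f
    go (suc (suc n)) n≡f = descend (ℚ.↧ₙ q) (subst (2 ℕ.≤_) n≡f (ℕ.s≤s (ℕ.s≤s ℕ.z≤n))) divided
      where
      descend : ∀ f → 2 ℕ.≤ f → (∀ k → ∃[ w ] proj₁ (h k) ≡ w ℤ.* + f) → ℚ.↧ₙ q ≡ 1
      descend f@(suc f-1) 2≤f div =
        let w<N , w≢0 = abs-quotient-< {N} {w₀} {f} N≢0 2≤f N≡w₀f
        in power-denominators w₀ w≢0 smaller (rec w<N)
        where
        w₀ = proj₁ (div 0)
        N≡w₀f : N ≡ w₀ ℤ.* + f
        N≡w₀f = trans (fromℤ-injective (trans (sym (ℚ.*-identityʳ (fromℤ N))) (proj₂ (h 0)))) (proj₂ (div 0))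
        smaller : ∀ k → ∃[ z ] fromℤ w₀ ℚ.* q ^ℚ k ≡ fromℤ z
        smaller k = proj₁ (div k) , cancel (proj₁ (div k)) (proj₁ (h k)) (proj₂ (div k)) (proj₂ (h k))
          where
          cancel : ∀ w z → z ≡ w ℤ.* + f → fromℤ N ℚ.* q ^ℚ k ≡ fromℤ z → fromℤ w₀ ℚ.* q ^ℚ k ≡ fromℤ w
          cancel w z z≡wf eq = ℚ-*-cancelʳ (fromℤ w₀ ℚ.* q ^ℚ k) (fromℤ w) f≢0 (begin
            (fromℤ w₀ ℚ.* q ^ℚ k) ℚ.* fromℤ (+ f)  ≡⟨ ℚS.solve 3 (λ w p f → w :* p :* f := (w :* f) :* p) refl (fromℤ w₀) (q ^ℚ k) (fromℤ (+ f)) ⟩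
            (fromℤ w₀ ℚ.* fromℤ (+ f)) ℚ.* q ^ℚ k  ≡⟨ cong (ℚ._* q ^ℚ k) (trans (cong fromℤ N≡w₀f) (fromℤ-* w₀ (+ f))) ⟨
            fromℤ N ℚ.* q ^ℚ k  ≡⟨ eq ⟩
            fromℤ z  ≡⟨ trans (cong fromℤ z≡wf) (fromℤ-* w (+ f)) ⟩
            fromℤ w ℚ.* fromℤ (+ f)  ∎)
            where
            open ℚS using (_:*_; _:=_)
            f≢0 : fromℤ (+ f) ≢ 0ℚ
            f≢0 f≡0 = contradiction (fromℤ-injective {+ f} {0ℤ} f≡0) λ ()

  powers-bounded⇒integer : ∀ N → N ≢ 0ℤ → (∀ k → ∃[ z ] fromℤ N ℚ.* q ^ℚ k ≡ fromℤ z) → ∃[ z ] q ≡ fromℤ z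
  powers-bounded⇒integer N N≢0 h = ℚ.↥ q , denominator-1 q (power-denominators N N≢0 h (<-wellFounded _))

-- Indecomposables of a quadratic order

∣∣-multiple : ∀ z → ∃[ ε ] + ℤ.∣ z ∣ ≡ ε ℤ.* z
∣∣-multiple (+ n)    = 1ℤ , sym (ℤ.*-identityˡ (+ n))
∣∣-multiple -[1+ n ] = ℤ.-1ℤ , sym (ℤ.-1*i≡-i -[1+ n ])

bézout : ∀ x y → ∃[ g ] ∃₂ λ x′ y′ → ∃₂ λ u v → x ≡ + g ℤ.* x′ × y ≡ + g ℤ.* y′ × u ℤ.* x ℤ.+ v ℤ.* y ≡ + g
bézout x y = go (GCD.Bézout.lemma ℤ.∣ x ∣ ℤ.∣ y ∣)
  where
  open ≡-Reasoning
  open ℤS using (_:+_; _:*_; _:-_; :-_; _:=_; con)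
  multiple : ∀ {g} z → g ℕ∣.∣ ℤ.∣ z ∣ → ∃[ z′ ] z ≡ + g ℤ.* z′
  multiple {g} z g∣z = let p = ∣ᵤ⇒∣ {+ g} {z} g∣z in
    _∣_.quotient p , trans (_∣_.equality p) (ℤ.*-comm (_∣_.quotient p) (+ g))
  σ = proj₁ (∣∣-multiple x)
  σ-eq = proj₂ (∣∣-multiple x)
  τ = proj₁ (∣∣-multiple y)
  τ-eq = proj₂ (∣∣-multiple y)
  combine : ∀ g a b m n → (+ a ≡ σ ℤ.* m) → (+ b ≡ τ ℤ.* n) → ∀ p q → g ℕ.+ q ℕ.* b ≡ p ℕ.* a →
    (+ p ℤ.* σ) ℤ.* m ℤ.+ (ℤ.- (+ q) ℤ.* τ) ℤ.* n ≡ + g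
  combine g a b m n a≡ b≡ p q eq = begin
    (+ p ℤ.* σ) ℤ.* m ℤ.+ (ℤ.- (+ q) ℤ.* τ) ℤ.* n  ≡⟨ ℤS.solve 6 (λ p s m q t n → (p :* s) :* m :+ (:- q :* t) :* n := p :* (s :* m) :- q :* (t :* n)) refl (+ p) σ m (+ q) τ n ⟩
    + p ℤ.* (σ ℤ.* m) ℤ.- + q ℤ.* (τ ℤ.* n)  ≡⟨ cong₂ (λ v w → + p ℤ.* v ℤ.- + q ℤ.* w) a≡ b≡ ⟨
    + p ℤ.* + a ℤ.- + q ℤ.* + b  ≡⟨ cong₂ ℤ._-_ (ℤ.pos-* p a) (ℤ.pos-* q b) ⟨
    + (p ℕ.* a) ℤ.- + (q ℕ.* b)  ≡⟨ cong (λ v → + v ℤ.- + (q ℕ.* b)) eq ⟨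
    + (g ℕ.+ q ℕ.* b) ℤ.- + (q ℕ.* b)  ≡⟨ cong (ℤ._- + (q ℕ.* b)) (ℤ.pos-+ g (q ℕ.* b)) ⟩
    + g ℤ.+ + (q ℕ.* b) ℤ.- + (q ℕ.* b)  ≡⟨ ℤS.solve 2 (λ g w → g :+ w :- w := g) refl (+ g) (+ (q ℕ.* b)) ⟩
    + g  ∎
  combine′ : ∀ g a b m n → (+ a ≡ σ ℤ.* m) → (+ b ≡ τ ℤ.* n) → ∀ p q → g ℕ.+ p ℕ.* a ≡ q ℕ.* b →
    (ℤ.- (+ p) ℤ.* σ) ℤ.* m ℤ.+ (+ q ℤ.* τ) ℤ.* n ≡ + g
  combine′ g a b m n a≡ b≡ p q eq = begin
    (ℤ.- (+ p) ℤ.* σ) ℤ.* m ℤ.+ (+ q ℤ.* τ) ℤ.* n  ≡⟨ ℤS.solve 6 (λ p s m q t n → (:- p :* s) :* m :+ (q :* t) :* n := q :* (t :* n) :- p :* (s :* m)) refl (+ p) σ m (+ q) τ n ⟩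
    + q ℤ.* (τ ℤ.* n) ℤ.- + p ℤ.* (σ ℤ.* m)  ≡⟨ cong₂ (λ v w → + q ℤ.* w ℤ.- + p ℤ.* v) a≡ b≡ ⟨
    + q ℤ.* + b ℤ.- + p ℤ.* + a  ≡⟨ cong₂ ℤ._-_ (ℤ.pos-* q b) (ℤ.pos-* p a) ⟨
    + (q ℕ.* b) ℤ.- + (p ℕ.* a)  ≡⟨ cong (λ v → + v ℤ.- + (p ℕ.* a)) eq ⟨
    + (g ℕ.+ p ℕ.* a) ℤ.- + (p ℕ.* a)  ≡⟨ cong (ℤ._- + (p ℕ.* a)) (ℤ.pos-+ g (p ℕ.* a)) ⟩
    + g ℤ.+ + (p ℕ.* a) ℤ.- + (p ℕ.* a)  ≡⟨ ℤS.solve 2 (λ g w → g :+ w :- w := g) refl (+ g) (+ (p ℕ.* a)) ⟩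
    + g  ∎
  go : GCD.Bézout.Lemma ℤ.∣ x ∣ ℤ.∣ y ∣ →
    ∃[ g ] ∃₂ λ x′ y′ → ∃₂ λ u v → x ≡ + g ℤ.* x′ × y ≡ + g ℤ.* y′ × u ℤ.* x ℤ.+ v ℤ.* y ≡ + g
  go (GCD.Bézout.result g gcd (GCD.Bézout.+- p q eq)) =
    let x′ , x≡ = multiple x (GCD.GCD.gcd∣m gcd)
        y′ , y≡ = multiple y (GCD.GCD.gcd∣n gcd)
    in g , x′ , y′ , + p ℤ.* σ , ℤ.- (+ q) ℤ.* τ , x≡ , y≡ , combine g ℤ.∣ x ∣ ℤ.∣ y ∣ x y σ-eq τ-eq p q eq
  go (GCD.Bézout.result g gcd (GCD.Bézout.-+ p q eq)) =
    let x′ , x≡ = multiple x (GCD.GCD.gcd∣m gcd)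
        y′ , y≡ = multiple y (GCD.GCD.gcd∣n gcd)
    in g , x′ , y′ , ℤ.- (+ p) ℤ.* σ , + q ℤ.* τ , x≡ , y≡ , combine′ g ℤ.∣ x ∣ ℤ.∣ y ∣ x y σ-eq τ-eq p q eq

ℤ-*-pos : ∀ {m n} → 0ℤ ℤ.< m → 0ℤ ℤ.< n → 0ℤ ℤ.< m ℤ.* n
ℤ-*-pos {m} {n} 0<m 0<n = subst (ℤ._< m ℤ.* n) (ℤ.*-zeroʳ m) (ℤ.*-monoˡ-<-pos m {{ℤ.positive 0<m}} 0<n)

ℤ-*-pos⁻¹ : ∀ {m n} → 0ℤ ℤ.< n → 0ℤ ℤ.< m ℤ.* n → 0ℤ ℤ.< m
ℤ-*-pos⁻¹ {m} {n} 0<n 0<mn = ℤ.*-cancelʳ-<-nonNeg {0ℤ} {m} n {{ℤ.nonNegative (ℤ.<⇒≤ 0<n)}} (subst (ℤ._< m ℤ.* n) (sym (ℤ.*-zeroˡ n)) 0<mn)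

square-pos : ∀ {h} → h ≢ 0ℤ → 0ℤ ℤ.< h ℤ.* h
square-pos {+ zero}    h≢0 = contradiction refl h≢0
square-pos {+ suc n}   _   = ℤ.+<+ (ℕ.s≤s ℕ.z≤n)
square-pos { -[1+ n ]} _   = ℤ.+<+ (ℕ.s≤s ℕ.z≤n)

-- The quadratic form of the order ℤ + ℤω with ω = (D + √D) / 2.
module NormForm (D m : ℤ) (D²≡ : D ℤ.* D ≡ D ℤ.+ + 4 ℤ.* m) where
  open import Data.Integer.Base using (_+_; _*_; _-_; -_; _<_; _≤_)
  open ℤS using (_:+_; _:*_; _:-_; :-_; _:=_; con)
  open ≡-Reasoning

  norm : ℤ → ℤ → ℤ
  norm x y = x * x + D * (x * y) + m * (y * y)

  polar : ℤ → ℤ → ℤ → ℤ → ℤ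
  polar x y a b = + 2 * (x * a) + D * (x * b + a * y) + + 2 * (m * (y * b))

  det : ℤ → ℤ → ℤ → ℤ → ℤ
  det a b x y = a * y - x * b

  private
    normᵖ : ∀ {n} (D m x y : ℤS.Polynomial n) → ℤS.Polynomial n
    normᵖ D m x y = x :* x :+ D :* (x :* y) :+ m :* (y :* y)

    polarᵖ : ∀ {n} (D m x y a b : ℤS.Polynomial n) → ℤS.Polynomial n
    polarᵖ D m x y a b = con (+ 2) :* (x :* a) :+ D :* (x :* b :+ a :* y) :+ con (+ 2) :* (m :* (y :* b))

  gram : ∀ x y a b → polar x y a b * polar x y a b ≡ D * (det a b x y * det a b x y) + + 4 * (norm a b * norm x y)
  gram x y a b = begin
    polar x y a b * polar x y a b
      ≡⟨ ℤS.solve 6 (λ D m x y a b → polarᵖ D m x y a b :* polarᵖ D m x y a b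
           := (D :* D :- con (+ 4) :* m) :* ((a :* y :- x :* b) :* (a :* y :- x :* b)) :+ con (+ 4) :* (normᵖ D m a b :* normᵖ D m x y)) refl D m x y a b ⟩
    (D * D - + 4 * m) * (det a b x y * det a b x y) + + 4 * (norm a b * norm x y)
      ≡⟨ cong (λ z → z * (det a b x y * det a b x y) + + 4 * (norm a b * norm x y))
           (trans (cong (ℤ._- + 4 * m) D²≡) (ℤS.solve 2 (λ D m → D :+ con (+ 4) :* m :- con (+ 4) :* m := D) refl D m)) ⟩
    D * (det a b x y * det a b x y) + + 4 * (norm a b * norm x y) ∎

  norm-scale : ∀ g x y → norm (g * x) (g * y) ≡ (g * g) * norm x y
  norm-scale = ℤS.solve 5 (λ D m g x y → normᵖ D m (g :* x) (g :* y) := (g :* g) :* normᵖ D m x y) refl D m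

  polar-scale : ∀ f g x y → polar (f * x) (f * y) (g * x) (g * y) ≡ + 2 * (f * g) * norm x y
  polar-scale = ℤS.solve 6 (λ D m f g x y →
    polarᵖ D m (f :* x) (f :* y) (g :* x) (g :* y) := con (+ 2) :* (f :* g) :* normᵖ D m x y) refl D m

  norm-minus : ∀ x y a b → norm (a - x) (b - y) ≡ (norm a b - polar x y a b) + norm x y
  norm-minus = ℤS.solve 6 (λ D m x y a b →
    normᵖ D m (a :- x) (b :- y) := (normᵖ D m a b :- polarᵖ D m x y a b) :+ normᵖ D m x y) refl D m

  polar-minus : ∀ x y a b → polar (a - x) (b - y) a b ≡ norm a b + (norm a b - polar x y a b)
  polar-minus = ℤS.solve 6 (λ D m x y a b →
    polarᵖ D m (a :- x) (b :- y) a b := normᵖ D m a b :+ (normᵖ D m a b :- polarᵖ D m x y a b)) refl D m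

  polar-shift : ∀ x y a b k → polar (x - k * a) (y - k * b) a b ≡ polar x y a b - k * (+ 2 * norm a b)
  polar-shift = ℤS.solve 7 (λ D m x y a b k →
    polarᵖ D m (x :- k :* a) (y :- k :* b) a b := polarᵖ D m x y a b :- k :* (con (+ 2) :* normᵖ D m a b)) refl D m

  polar-neg : ∀ x y a b → polar (- x) (- y) a b ≡ - polar x y a b
  polar-neg = ℤS.solve 6 (λ D m x y a b → polarᵖ D m (:- x) (:- y) a b := :- polarᵖ D m x y a b) refl D m

  -- A ℤ-basis (α , η) of the order whose second member is as orthogonal to
  -- the given primitive α as possible.
  reduced-mate : ∀ a b u v → u * a + v * b ≡ 1ℤ → 0ℤ < norm a b →
    ∃₂ λ x y → det a b x y * det a b x y ≡ 1ℤ × 0ℤ ≤ polar x y a b × polar x y a b ≤ norm a b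
  reduced-mate a b u v bez 0<N = go (norm a b) 0<N refl
    where
    x₀ = - v
    y₀ = u
    det-shifted : ∀ k → det a b (x₀ - k * a) (y₀ - k * b) ≡ 1ℤ
    det-shifted k = trans (ℤS.solve 5 (λ a b u v k → a :* (u :- k :* b) :- (:- v :- k :* a) :* b := u :* a :+ v :* b) refl a b u v k) bez
    det-neg : ∀ x y → det a b (- x) (- y) * det a b (- x) (- y) ≡ det a b x y * det a b x y
    det-neg x y = ℤS.solve 4 (λ a b x y → (a :* :- y :- :- x :* b) :* (a :* :- y :- :- x :* b) := (a :* y :- x :* b) :* (a :* y :- x :* b)) refl a b x y
    go : ∀ N → 0ℤ < N → N ≡ norm a b →
      ∃₂ λ x y → det a b x y * det a b x y ≡ 1ℤ × 0ℤ ≤ polar x y a b × polar x y a b ≤ norm a b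
    go (+ zero) (ℤ.+<+ ()) _
    go N@(+ suc n) 0<N N≡ = sign-choice (ℤ.≤-total 0ℤ h)
      where
      p = polar x₀ y₀ a b
      n₂ = 2 ℕ.* suc n
      r = (p + N) %ℕ n₂
      k = (p + N) /ℕ n₂
      x = x₀ - k * a
      y = y₀ - k * b
      h = polar x y a b
      h≡ : h ≡ + r - N
      h≡ = begin
        h  ≡⟨ polar-shift x₀ y₀ a b k ⟩
        p - k * (+ 2 * norm a b)  ≡⟨ cong (λ z → p - k * (+ 2 * z)) N≡ ⟨
        p - k * (+ 2 * N)  ≡⟨ ℤS.solve 3 (λ p w n → p :- w := (p :+ n) :- w :- n) refl p (k * (+ 2 * N)) N ⟩
        (p + N) - k * (+ 2 * N) - N  ≡⟨ cong (λ z → z - k * (+ 2 * N) - N) (a≡a%ℕn+[a/ℕn]*n (p + N) n₂) ⟩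
        (+ r + k * + n₂) - k * (+ 2 * N) - N  ≡⟨ cong (λ z → (+ r + k * z) - k * (+ 2 * N) - N) (ℤ.pos-* 2 (suc n)) ⟩
        (+ r + k * (+ 2 * N)) - k * (+ 2 * N) - N  ≡⟨ ℤS.solve 3 (λ r w n → (r :+ w) :- w :- n := r :- n) refl (+ r) (k * (+ 2 * N)) N ⟩
        + r - N  ∎
      h≤N : h ≤ norm a b
      h≤N = subst₂ ℤ._≤_ (sym h≡) N≡ (subst (+ r - N ℤ.≤_)
        (trans (cong (ℤ._- N) (ℤ.pos-* 2 (suc n))) (ℤS.solve 1 (λ n → con (+ 2) :* n :- n := n) refl N))
        (ℤ.+-monoˡ-≤ (- N) (ℤ.+≤+ (ℕ.<⇒≤ (n%ℕd<d (p + N) n₂)))))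
      -h≤N : - h ≤ norm a b
      -h≤N = subst₂ ℤ._≤_ (sym (trans (cong ℤ.-_ h≡) (ℤS.solve 2 (λ r n → :- (r :- n) := n :- r) refl (+ r) N))) N≡
        (subst (N - + r ℤ.≤_) (ℤ.+-identityʳ N) (ℤ.+-monoʳ-≤ N (ℤ.neg-mono-≤ {0ℤ} {+ r} (ℤ.+≤+ ℕ.z≤n))))
      sign-choice : 0ℤ ≤ h ⊎ h ≤ 0ℤ →
        ∃₂ λ x y → det a b x y * det a b x y ≡ 1ℤ × 0ℤ ≤ polar x y a b × polar x y a b ≤ norm a b
      sign-choice (inj₁ 0≤h) = x , y , cong (λ z → z * z) (det-shifted k) , 0≤h , h≤N
      sign-choice (inj₂ h≤0) = - x , - y , trans (det-neg x y) (cong (λ z → z * z) (det-shifted k))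
        , subst (0ℤ ℤ.≤_) (sym (polar-neg x y a b)) (ℤ.neg-mono-≤ {h} {0ℤ} h≤0)
        , subst (ℤ._≤ norm a b) (sym (polar-neg x y a b)) -h≤N

ℤ-≤-diff : ∀ {m n} → m ℤ.≤ n → 0ℤ ℤ.≤ n ℤ.- m
ℤ-≤-diff {m} {n} m≤n = subst (ℤ._≤ n ℤ.- m) (ℤ.+-inverseʳ m) (ℤ.+-monoˡ-≤ (ℤ.- m) m≤n)

module QuadraticOrder {c ℓ} (F : NumberField c ℓ) (s : NumberField.Carrier F) (D m : ℤ)
  (s²≈D : NumberField._≈_ F (NumberField._*_ F s s) (NumberField.ιℤ F D))
  (D²≡ : D ℤ.* D ≡ D ℤ.+ + 4 ℤ.* m) where
  open FieldProperties F
  open NormForm D m D²≡ public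
  open FS using (_:+_; _:*_; _:-_; :-_; _:=_; con)
  open import Relation.Binary.Reasoning.Setoid setoid

  ω : Carrier
  ω = ι ½ * (ιℤ D + s)

  el : ℤ → ℤ → Carrier
  el x y = ιℤ x + ιℤ y * ω

  el-cong : ∀ {x y x′ y′} → x ≡ x′ → y ≡ y′ → el x y ≈ el x′ y′
  el-cong refl refl = ≈-refl

  ½+½ : ι ½ + ι ½ ≈ ιℤ 1ℤ
  ½+½ = ≈-sym (ι-+ ½ ½)

  2ω : ιℤ (+ 2) * ω ≈ ιℤ D + s
  2ω = begin
    ιℤ (+ 2) * (ι ½ * (ιℤ D + s))  ≈⟨ FS.solve 2 (λ h w → con (+ 2) :* (h :* w) := (h :+ h) :* w) ≈-refl (ι ½) (ιℤ D + s) ⟩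
    (ι ½ + ι ½) * (ιℤ D + s)  ≈⟨ *-congʳ ½+½ ⟩
    ιℤ 1ℤ * (ιℤ D + s)  ≈⟨ *-congʳ ι1 ⟩
    1# * (ιℤ D + s)  ≈⟨ *-identityˡ _ ⟩
    ιℤ D + s  ∎

  ω² : ω * ω ≈ ιℤ D * ω - ιℤ m
  ω² = *-cancelʳ (ι≉0 {fromℤ (+ 4)} (λ ())) (begin
    ω * ω * ιℤ (+ 4)  ≈⟨ FS.solve 1 (λ w → w :* w :* con (+ 4) := (con (+ 2) :* w) :* (con (+ 2) :* w)) ≈-refl ω ⟩
    ιℤ (+ 2) * ω * (ιℤ (+ 2) * ω)  ≈⟨ *-cong 2ω 2ω ⟩
    (ιℤ D + s) * (ιℤ D + s)  ≈⟨ FS.solve 2 (λ d s → (d :+ s) :* (d :+ s) := d :* d :+ con (+ 2) :* (d :* s) :+ s :* s) ≈-refl (ιℤ D) s ⟩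
    ιℤ D * ιℤ D + ιℤ (+ 2) * (ιℤ D * s) + s * s  ≈⟨ +-congˡ (≈-trans s²≈D D≈) ⟩
    ιℤ D * ιℤ D + ιℤ (+ 2) * (ιℤ D * s) + (ιℤ D * ιℤ D - ιℤ (+ 4) * ιℤ m)
      ≈⟨ FS.solve 3 (λ d s m → d :* d :+ con (+ 2) :* (d :* s) :+ (d :* d :- con (+ 4) :* m) := con (+ 2) :* (d :* (d :+ s)) :- con (+ 4) :* m) ≈-refl (ιℤ D) s (ιℤ m) ⟩
    ιℤ (+ 2) * (ιℤ D * (ιℤ D + s)) - ιℤ (+ 4) * ιℤ m  ≈⟨ +-congʳ (*-congˡ (*-congˡ 2ω)) ⟨
    ιℤ (+ 2) * (ιℤ D * (ιℤ (+ 2) * ω)) - ιℤ (+ 4) * ιℤ m  ≈⟨ FS.solve 3 (λ d w m → con (+ 2) :* (d :* (con (+ 2) :* w)) :- con (+ 4) :* m := (d :* w :- m) :* con (+ 4)) ≈-refl (ιℤ D) ω (ιℤ m) ⟩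
    (ιℤ D * ω - ιℤ m) * ιℤ (+ 4)  ∎)
    where
    D≈ : ιℤ D ≈ ιℤ D * ιℤ D - ιℤ (+ 4) * ιℤ m
    D≈ = begin
      ιℤ D  ≈⟨ FS.solve 2 (λ d w → d := (d :+ w) :- w) ≈-refl (ιℤ D) (ιℤ (+ 4) * ιℤ m) ⟩
      (ιℤ D + ιℤ (+ 4) * ιℤ m) - ιℤ (+ 4) * ιℤ m  ≈⟨ +-congʳ (≈-trans (+-congˡ (≈-sym (ιℤ-* (+ 4) m))) (≈-sym (ιℤ-+ D (+ 4 ℤ.* m)))) ⟩
      ιℤ (D ℤ.+ + 4 ℤ.* m) - ιℤ (+ 4) * ιℤ m  ≈⟨ +-congʳ (≈-trans (ιℤ-cong (sym D²≡)) (ιℤ-* D D)) ⟩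
      ιℤ D * ιℤ D - ιℤ (+ 4) * ιℤ m  ∎

  el-+ : ∀ x y x′ y′ → el x y + el x′ y′ ≈ el (x ℤ.+ x′) (y ℤ.+ y′)
  el-+ x y x′ y′ = ≈-trans
    (FS.solve 5 (λ x y x′ y′ w → (x :+ y :* w) :+ (x′ :+ y′ :* w) := (x :+ x′) :+ (y :+ y′) :* w) ≈-refl (ιℤ x) (ιℤ y) (ιℤ x′) (ιℤ y′) ω)
    (+-cong (≈-sym (ιℤ-+ x x′)) (*-congʳ (≈-sym (ιℤ-+ y y′))))

  el-* : ∀ x y x′ y′ → el x y * el x′ y′ ≈ el (x ℤ.* x′ ℤ.- m ℤ.* (y ℤ.* y′)) (x ℤ.* y′ ℤ.+ x′ ℤ.* y ℤ.+ D ℤ.* (y ℤ.* y′))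
  el-* x y x′ y′ = begin
    el x y * el x′ y′
      ≈⟨ FS.solve 5 (λ x y x′ y′ w → (x :+ y :* w) :* (x′ :+ y′ :* w) := x :* x′ :+ (x :* y′ :+ x′ :* y) :* w :+ (y :* y′) :* (w :* w)) ≈-refl (ιℤ x) (ιℤ y) (ιℤ x′) (ιℤ y′) ω ⟩
    ιℤ x * ιℤ x′ + (ιℤ x * ιℤ y′ + ιℤ x′ * ιℤ y) * ω + (ιℤ y * ιℤ y′) * (ω * ω)
      ≈⟨ +-congˡ (*-congˡ ω²) ⟩
    ιℤ x * ιℤ x′ + (ιℤ x * ιℤ y′ + ιℤ x′ * ιℤ y) * ω + (ιℤ y * ιℤ y′) * (ιℤ D * ω - ιℤ m)
      ≈⟨ FS.solve 7 (λ x y x′ y′ w d m → x :* x′ :+ (x :* y′ :+ x′ :* y) :* w :+ (y :* y′) :* (d :* w :- m)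
           := (x :* x′ :- m :* (y :* y′)) :+ (x :* y′ :+ x′ :* y :+ d :* (y :* y′)) :* w) ≈-refl (ιℤ x) (ιℤ y) (ιℤ x′) (ιℤ y′) ω (ιℤ D) (ιℤ m) ⟩
    (ιℤ x * ιℤ x′ - ιℤ m * (ιℤ y * ιℤ y′)) + (ιℤ x * ιℤ y′ + ιℤ x′ * ιℤ y + ιℤ D * (ιℤ y * ιℤ y′)) * ω
      ≈⟨ +-cong
           (≈-trans (ιℤ-+ (x ℤ.* x′) (ℤ.- (m ℤ.* (y ℤ.* y′)))) (+-cong (ιℤ-* x x′)
             (≈-trans (ιℤ-neg (m ℤ.* (y ℤ.* y′))) (-‿cong (≈-trans (ιℤ-* m (y ℤ.* y′)) (*-congˡ (ιℤ-* y y′)))))))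
           (*-congʳ (≈-trans (ιℤ-+ (x ℤ.* y′ ℤ.+ x′ ℤ.* y) (D ℤ.* (y ℤ.* y′)))
             (+-cong (≈-trans (ιℤ-+ (x ℤ.* y′) (x′ ℤ.* y)) (+-cong (ιℤ-* x y′) (ιℤ-* x′ y)))
               (≈-trans (ιℤ-* D (y ℤ.* y′)) (*-congˡ (ιℤ-* y y′)))))) ⟨
    el (x ℤ.* x′ ℤ.- m ℤ.* (y ℤ.* y′)) (x ℤ.* y′ ℤ.+ x′ ℤ.* y ℤ.+ D ℤ.* (y ℤ.* y′)) ∎

  el-const : ∀ z → el z 0ℤ ≈ ιℤ z
  el-const z = ≈-trans (+-congˡ (≈-trans (*-congʳ ι0) (zeroˡ ω))) (+-identityʳ _)

  bar : ℤ → ℤ → Carrier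
  bar x y = el (x ℤ.+ D ℤ.* y) (ℤ.- y)

  el*bar : ∀ x y → el x y * bar x y ≈ ιℤ (norm x y)
  el*bar x y = ≈-trans (el-* x y (x ℤ.+ D ℤ.* y) (ℤ.- y)) (≈-trans (el-cong
    (ℤS.solve 4 (λ D m x y → x ℤS.:* (x ℤS.:+ D ℤS.:* y) ℤS.:- m ℤS.:* (y ℤS.:* (ℤS.:- y)) ℤS.:= x ℤS.:* x ℤS.:+ D ℤS.:* (x ℤS.:* y) ℤS.:+ m ℤS.:* (y ℤS.:* y)) refl D m x y)
    (ℤS.solve 3 (λ D x y → x ℤS.:* (ℤS.:- y) ℤS.:+ (x ℤS.:+ D ℤS.:* y) ℤS.:* y ℤS.:+ D ℤS.:* (y ℤS.:* (ℤS.:- y)) ℤS.:= ℤS.con 0ℤ) refl D x y))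
    (el-const (norm x y)))

  polarization : ∀ x y a b → el x y * bar a b + bar x y * el a b ≈ ιℤ (polar x y a b)
  polarization x y a b = ≈-trans (+-cong (el-* x y (a ℤ.+ D ℤ.* b) (ℤ.- b)) (el-* (x ℤ.+ D ℤ.* y) (ℤ.- y) a b))
    (≈-trans (el-+ p q p′ q′) (≈-trans (el-cong
      (ℤS.solve 6 (λ D m x y a b →
        (x ℤS.:* (a ℤS.:+ D ℤS.:* b) ℤS.:- m ℤS.:* (y ℤS.:* (ℤS.:- b))) ℤS.:+ ((x ℤS.:+ D ℤS.:* y) ℤS.:* a ℤS.:- m ℤS.:* ((ℤS.:- y) ℤS.:* b))
        ℤS.:= ℤS.con (+ 2) ℤS.:* (x ℤS.:* a) ℤS.:+ D ℤS.:* (x ℤS.:* b ℤS.:+ a ℤS.:* y) ℤS.:+ ℤS.con (+ 2) ℤS.:* (m ℤS.:* (y ℤS.:* b))) refl D m x y a b)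
      (ℤS.solve 5 (λ D x y a b →
        (x ℤS.:* (ℤS.:- b) ℤS.:+ (a ℤS.:+ D ℤS.:* b) ℤS.:* y ℤS.:+ D ℤS.:* (y ℤS.:* (ℤS.:- b)))
        ℤS.:+ ((x ℤS.:+ D ℤS.:* y) ℤS.:* b ℤS.:+ a ℤS.:* (ℤS.:- y) ℤS.:+ D ℤS.:* ((ℤS.:- y) ℤS.:* b))
        ℤS.:= ℤS.con 0ℤ) refl D x y a b)) (el-const (polar x y a b))))
    where
    p q p′ q′ : ℤ
    p  = x ℤ.* (a ℤ.+ D ℤ.* b) ℤ.- m ℤ.* (y ℤ.* (ℤ.- b))
    q  = x ℤ.* (ℤ.- b) ℤ.+ (a ℤ.+ D ℤ.* b) ℤ.* y ℤ.+ D ℤ.* (y ℤ.* (ℤ.- b))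
    p′ = (x ℤ.+ D ℤ.* y) ℤ.* a ℤ.- m ℤ.* ((ℤ.- y) ℤ.* b)
    q′ = (x ℤ.+ D ℤ.* y) ℤ.* b ℤ.+ a ℤ.* (ℤ.- y) ℤ.+ D ℤ.* ((ℤ.- y) ℤ.* b)

  el-integral : ∀ x y → Integral F (el x y)
  el-integral x y = norm x y ∷ ℤ.- (+ 2 ℤ.* x ℤ.+ D ℤ.* y) ∷ [] , (begin
    ιℤ (norm x y) + ξ * (ιℤ (ℤ.- t) + ξ * 1#)  ≈⟨ +-cong (≈-sym (el*bar x y)) (*-congˡ (+-cong (ιℤ-neg t) (*-identityʳ ξ))) ⟩
    ξ * bar x y + ξ * (- ιℤ t + ξ)  ≈⟨ +-congˡ (*-congˡ (+-congʳ (-‿cong (≈-trans (≈-sym (el-const t)) (≈-sym trace))))) ⟩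
    ξ * bar x y + ξ * (- (ξ + bar x y) + ξ)  ≈⟨ FS.solve 2 (λ a b → a :* b :+ a :* (:- (a :+ b) :+ a) := con 0ℤ) ≈-refl ξ (bar x y) ⟩
    ιℤ 0ℤ  ≈⟨ ι0 ⟩
    0#  ∎)
    where
    ξ = el x y
    t = + 2 ℤ.* x ℤ.+ D ℤ.* y
    trace : ξ + bar x y ≈ el t 0ℤ
    trace = ≈-trans (el-+ x y (x ℤ.+ D ℤ.* y) (ℤ.- y)) (el-cong
      (ℤS.solve 3 (λ D x y → x ℤS.:+ (x ℤS.:+ D ℤS.:* y) ℤS.:= ℤS.con (+ 2) ℤS.:* x ℤS.:+ D ℤS.:* y) refl D x y) (ℤ.+-inverseʳ y))

  module Indecomposables {α} (a b : ℤ) (α≈ : α ≈ el a b) (α-indecomposable : Indecomposable F α)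
    (0<Nα : 0ℤ ℤ.< norm a b) where

    totally-positive : ∀ x y → 0ℤ ℤ.< norm x y → 0ℤ ℤ.< polar x y a b → TotallyPositive F (el x y)
    totally-positive x y 0<N 0<B σ σ-mono = P-quotient P-ξᾱ (P-quotient P-ᾱα P-α)
      where
      open OrderingProperties (ordering F σ σ-mono)
      P-α : P (el a b)
      P-α = P-resp α≈ (proj₂ (proj₁ α-indecomposable) σ σ-mono)
      P-ᾱα : P (bar a b * el a b)
      P-ᾱα = P-resp (≈-trans (≈-sym (el*bar a b)) (*-comm _ _)) (P-ℤ 0<Nα)
      P-ξᾱ : P (el x y * bar a b)
      P-ξᾱ = P-sum-product (P-resp (≈-sym (polarization x y a b)) (P-ℤ 0<B))
        (P-resp (≈-sym (begin
          el x y * bar a b * (bar x y * el a b)  ≈⟨ FS.solve 4 (λ x a x′ a′ → x :* a :* (x′ :* a′) := (x :* x′) :* (a′ :* a)) ≈-refl (el x y) (bar a b) (bar x y) (el a b) ⟩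
          (el x y * bar x y) * (el a b * bar a b)  ≈⟨ *-cong (el*bar x y) (el*bar a b) ⟩
          ιℤ (norm x y) * ιℤ (norm a b)  ≈⟨ ιℤ-* (norm x y) (norm a b) ⟨
          ιℤ (norm x y ℤ.* norm a b)  ∎)) (P-ℤ (ℤ-*-pos 0<N 0<Nα)))

    indecomposable : ∀ x y x′ y′ → a ≡ x ℤ.+ x′ → b ≡ y ℤ.+ y′ →
      0ℤ ℤ.< norm x y → 0ℤ ℤ.< polar x y a b → 0ℤ ℤ.< norm x′ y′ → ¬ (0ℤ ℤ.< polar x′ y′ a b)
    indecomposable x y x′ y′ a≡ b≡ 0<N 0<B 0<N′ 0<B′ = proj₂ α-indecomposable
      ( el x y , el x′ y′
      , (el-integral x y , totally-positive x y 0<N 0<B)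
      , (el-integral x′ y′ , totally-positive x′ y′ 0<N′ 0<B′)
      , ≈-trans α≈ (≈-trans (el-cong a≡ b≡) (≈-sym (el-+ x y x′ y′))))

    coordinates-coprime : ∃₂ λ u v → u ℤ.* a ℤ.+ v ℤ.* b ≡ 1ℤ
    coordinates-coprime = let g , a′ , b′ , u , v , a≡ , b≡ , uv = bézout a b in go g a′ b′ u v a≡ b≡ uv
      where
      go : ∀ g a′ b′ u v → a ≡ + g ℤ.* a′ → b ≡ + g ℤ.* b′ → u ℤ.* a ℤ.+ v ℤ.* b ≡ + g → ∃₂ λ u v → u ℤ.* a ℤ.+ v ℤ.* b ≡ 1ℤ
      go zero a′ b′ u v a≡ b≡ uv = contradiction (subst (0ℤ ℤ.<_) N≡0 0<Nα) (ℤ.<-irrefl refl)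
        where
        N≡0 : norm a b ≡ 0ℤ
        N≡0 = trans (cong₂ norm a≡ b≡) (norm-scale 0ℤ a′ b′)
      go (suc zero) a′ b′ u v a≡ b≡ uv = u , v , uv
      go (suc (suc n)) a′ b′ u v a≡ b≡ uv = ⊥-elim (indecomposable (1ℤ ℤ.* a′) (1ℤ ℤ.* b′) (f ℤ.* a′) (f ℤ.* b′)
          (split a≡) (split b≡)
          (subst (0ℤ ℤ.<_) (sym (norm-scale 1ℤ a′ b′)) (ℤ-*-pos {1ℤ ℤ.* 1ℤ} (ℤ.+<+ (ℕ.s≤s ℕ.z≤n)) 0<N′))
          (polar-pos 1ℤ (ℤ.+<+ (ℕ.s≤s ℕ.z≤n)))
          (subst (0ℤ ℤ.<_) (sym (norm-scale f a′ b′)) (ℤ-*-pos {f ℤ.* f} (ℤ-*-pos 0<f 0<f) 0<N′))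
          (polar-pos f 0<f))
        where
        g f : ℤ
        g = + suc (suc n)
        f = + suc n
        0<g : 0ℤ ℤ.< g
        0<g = ℤ.+<+ (ℕ.s≤s ℕ.z≤n)
        0<f : 0ℤ ℤ.< f
        0<f = ℤ.+<+ (ℕ.s≤s ℕ.z≤n)
        0<N′ : 0ℤ ℤ.< norm a′ b′
        0<N′ = ℤ-*-pos⁻¹ {norm a′ b′} {g ℤ.* g} (ℤ-*-pos 0<g 0<g)
          (subst (0ℤ ℤ.<_) (trans (cong₂ norm a≡ b≡) (trans (norm-scale g a′ b′) (ℤ.*-comm (g ℤ.* g) (norm a′ b′)))) 0<Nα)
        split : ∀ {z z′} → z ≡ g ℤ.* z′ → z ≡ 1ℤ ℤ.* z′ ℤ.+ f ℤ.* z′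
        split {z} {z′} eq = trans eq (ℤ.*-distribʳ-+ z′ 1ℤ f)
        polar-pos : ∀ k → 0ℤ ℤ.< k → 0ℤ ℤ.< polar (k ℤ.* a′) (k ℤ.* b′) a b
        polar-pos k 0<k = subst (0ℤ ℤ.<_) (sym (trans (cong₂ (polar (k ℤ.* a′) (k ℤ.* b′)) a≡ b≡) (polar-scale k g a′ b′)))
          (ℤ-*-pos {+ 2 ℤ.* (k ℤ.* g)} (ℤ-*-pos {+ 2} (ℤ.+<+ (ℕ.s≤s ℕ.z≤n)) (ℤ-*-pos 0<k 0<g)) 0<N′)

    -- If the reduced mate η had positive norm, it would be totally positive
    -- together with α - η.
    mixed-mate : 0ℤ ℤ.< D → (∀ h → h ℤ.* h ≢ D) →
      ∃₂ λ x y → det a b x y ℤ.* det a b x y ≡ 1ℤ × norm x y ℤ.< 0ℤ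
    mixed-mate 0<D D-nonsquare =
      let u , v , uv = coordinates-coprime
          x , y , det² , 0≤h , h≤N = reduced-mate a b u v uv 0<Nα
      in x , y , det² , negative x y det² 0≤h h≤N
      where
      negative : ∀ x y → det a b x y ℤ.* det a b x y ≡ 1ℤ → 0ℤ ℤ.≤ polar x y a b → polar x y a b ℤ.≤ norm a b → norm x y ℤ.< 0ℤ
      negative x y det² 0≤h h≤N = by-sign (ℤ.<-cmp (norm x y) 0ℤ)
        where
        h = polar x y a b
        h²≡ : h ℤ.* h ≡ D ℤ.+ + 4 ℤ.* (norm a b ℤ.* norm x y)
        h²≡ = trans (gram x y a b) (cong (ℤ._+ + 4 ℤ.* (norm a b ℤ.* norm x y)) (trans (cong (D ℤ.*_) det²) (ℤ.*-identityʳ D)))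
        by-sign : Tri (norm x y ℤ.< 0ℤ) (norm x y ≡ 0ℤ) (norm x y ℤ.> 0ℤ) → norm x y ℤ.< 0ℤ
        by-sign (tri< N<0 _ _) = N<0
        by-sign (tri≈ _ N≡0 _) = contradiction (trans h²≡ (trans (cong (λ z → D ℤ.+ + 4 ℤ.* (norm a b ℤ.* z)) N≡0)
          (ℤS.solve 2 (λ d n → d ℤS.:+ ℤS.con (+ 4) ℤS.:* (n ℤS.:* ℤS.con 0ℤ) ℤS.:= d) refl D (norm a b)))) (D-nonsquare h)
        by-sign (tri> _ _ 0<N) = ⊥-elim (indecomposable x y (a ℤ.- x) (b ℤ.- y) (split a x) (split b y) 0<N 0<h
          (subst (0ℤ ℤ.<_) (sym (norm-minus x y a b)) (ℤ.+-mono-≤-< (ℤ-≤-diff h≤N) 0<N))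
          (subst (0ℤ ℤ.<_) (sym (polar-minus x y a b)) (ℤ.+-mono-<-≤ 0<Nα (ℤ-≤-diff h≤N))))
          where
          split : ∀ p q → p ≡ q ℤ.+ (p ℤ.- q)
          split = ℤS.solve 2 (λ p q → p ℤS.:= q ℤS.:+ (p ℤS.:- q)) refl
          0<h² : 0ℤ ℤ.< h ℤ.* h
          0<h² = subst (0ℤ ℤ.<_) (sym h²≡) (ℤ.+-mono-< 0<D (ℤ-*-pos {+ 4} (ℤ.+<+ (ℕ.s≤s ℕ.z≤n)) (ℤ-*-pos 0<Nα 0<N)))
          0<h : 0ℤ ℤ.< h
          0<h = ℤ.≤∧≢⇒< 0≤h (λ 0≡h → ℤ.<-irrefl (cong (λ z → z ℤ.* z) 0≡h) 0<h²)

-- The arithmetic obstruction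

module _ where
  open import Data.Integer.Base using (_+_; _*_; _-_; -_; _<_; _≤_)

  import Data.Nat.Divisibility as ℕ∣

  -- v₂(D) is 0, 2 or 3.
  data Class (D : ℤ) : Set where
    class₀ : ∀ d → D ≡ + 4 * d + 1ℤ → Class D
    class₁ : ∀ e → D ≡ + 4 * (+ 4 * e + + 3) → Class D
    class₂ : ∀ e → D ≡ + 4 * (+ 4 * e + + 2) → Class D

  rank : ∀ {D} → Class D → ℕ
  rank (class₀ _ _) = 0
  rank (class₁ _ _) = 1
  rank (class₂ _ _) = 2

  residue∤ : ∀ m r → 0 ℕ.< r → r ℕ.< m → ∀ W → + m * W + + r ≢ 0ℤ
  residue∤ m r 0<r r<m W eq = ℕ.<⇒≱ r<m (ℕ∣.∣⇒≤ {{ℕ.>-nonZero 0<r}} (∣⇒∣ᵤ {+ m} {+ r} (divides (- W) (begin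
      + r  ≡⟨ ℤS.solve 3 (λ m w r → r ℤS.:= (m ℤS.:* w ℤS.:+ r) ℤS.:+ (ℤS.:- w) ℤS.:* m) refl (+ m) W (+ r) ⟩
      (+ m * W + + r) + - W * + m  ≡⟨ cong (ℤ._+ - W * + m) eq ⟩
      0ℤ + - W * + m  ≡⟨ ℤ.+-identityˡ (- W * + m) ⟩
      - W * + m  ∎))))
    where open ≡-Reasoning

  difference-zero : ∀ {m n} → m ≡ n → n - m ≡ 0ℤ
  difference-zero {m} refl = ℤ.+-inverseʳ m

  abstract
    classify : ∀ {D} → Fundamental D → Class D
    classify {D} fund with Fundamental.discriminant fund
    ... | inj₂ 4∣D-1 = let d , eq = discriminant-odd 4∣D-1 in class₀ d eq
    ... | inj₁ 4∣D   = let d , eq = 4∣⇒ 4∣D in go d eq (parity d)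
      where
      go : ∀ d → D ≡ + 4 * d → Parity d → Class D
      go d eq (even k d≡) = go₀ (parity k)
        where
        go₀ : Parity k → Class D
        go₀ (even l k≡) = ⊥-elim (Fundamental.reduced fund 2 (ℕ.s≤s (ℕ.s≤s ℕ.z≤n)) d eq
          (inj₁ (⇒4∣ l (trans d≡ (trans (cong (+ 2 ℤ.*_) k≡) (ℤS.solve 1 (λ l → con (+ 2) :* (con (+ 2) :* l) := con (+ 4) :* l) refl l))))))
          where open ℤS using (_:+_; _:*_; _:-_; :-_; _:=_; con)
        go₀ (odd l k≡) = class₂ l (trans eq (cong (+ 4 ℤ.*_) (trans d≡ (trans (cong (+ 2 ℤ.*_) k≡)
          (ℤS.solve 1 (λ l → con (+ 2) :* (con (+ 2) :* l :+ con 1ℤ) := con (+ 4) :* l :+ con (+ 2)) refl l)))))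
          where open ℤS using (_:+_; _:*_; _:-_; :-_; _:=_; con)
      go d eq (odd k d≡) = go₁ (parity k)
        where
        open ℤS using (_:+_; _:*_; _:-_; :-_; _:=_; con)
        go₁ : Parity k → Class D
        go₁ (even l k≡) = ⊥-elim (Fundamental.reduced fund 2 (ℕ.s≤s (ℕ.s≤s ℕ.z≤n)) d eq
          (inj₂ (odd-discriminant l (trans d≡ (trans (cong (λ z → + 2 * z + 1ℤ) k≡)
            (ℤS.solve 1 (λ l → con (+ 2) :* (con (+ 2) :* l) :+ con 1ℤ := con (+ 4) :* l :+ con 1ℤ) refl l))))))
        go₁ (odd l k≡) = class₁ l (trans eq (cong (+ 4 ℤ.*_) (trans d≡ (trans (cong (λ z → + 2 * z + 1ℤ) k≡)
          (ℤS.solve 1 (λ l → con (+ 2) :* (con (+ 2) :* l :+ con 1ℤ) :+ con 1ℤ := con (+ 4) :* l :+ con (+ 3)) refl l)))))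

  even-root : ∀ A k → A * A ≡ + 4 * k → ∃[ T ] A ≡ + 2 * T
  even-root A k eq with parity A
  ... | even T A≡ = T , A≡
  ... | odd T A≡  = ⊥-elim (residue∤ 4 1 (ℕ.s≤s ℕ.z≤n) (ℕ.s≤s (ℕ.s≤s ℕ.z≤n)) (T * T + T - k) (trans
      (ℤS.solve 2 (λ t k → con (+ 4) :* (t :* t :+ t :- k) :+ con 1ℤ := (con (+ 2) :* t :+ con 1ℤ) :* (con (+ 2) :* t :+ con 1ℤ) :- con (+ 4) :* k) refl T k)
      (difference-zero (sym (trans (cong (λ z → z * z) (sym A≡)) eq)))))
    where open ℤS using (_:+_; _:*_; _:-_; :-_; _:=_; con)

  module _ where
    open ℤS using (Polynomial; ⟦_⟧; ⟦_⟧↓; prove; _:+_; _:*_; _:-_; con)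

    -- The equation satisfied by the relative norm to ℚ(T), divided by 16.
    NormEquation : (d₁ d₂ T B X Z : ℤ) → Set
    NormEquation d₁ d₂ T B X Z = + 4 * (d₁ * X) ≡
      d₁ * (T * T) + d₁ * (d₂ * (B * B)) - d₁ * d₁ - d₂ * ((T * B - + 2 * Z) * (T * B - + 2 * Z))

    private
      c : ∀ {n} → ℕ → Polynomial n
      c k = con (+ k)

      defect : ∀ {n} (d₁ d₂ T B X Z : Polynomial n) → Polynomial n
      defect d₁ d₂ T B X Z = (d₁ :* (T :* T) :+ d₁ :* (d₂ :* (B :* B)) :- d₁ :* d₁
        :- d₂ :* ((T :* B :- c 2 :* Z) :* (T :* B :- c 2 :* Z))) :- c 4 :* (d₁ :* X)

      residue-nonzero : ∀ {n} m r → 0 ℕ.< r → r ℕ.< m → (W E : Polynomial n) → ∀ ρ →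
        ⟦ c m :* W :+ c r ⟧↓ ρ ≡ ⟦ E ⟧↓ ρ → ⟦ E ⟧ ρ ≢ 0ℤ
      residue-nonzero m r 0<r r<m W E ρ eq E≡0 =
        residue∤ m r 0<r r<m (⟦ W ⟧ ρ) (trans (prove ρ (c m :* W :+ c r) E eq) E≡0)

      pos : ∀ {n} → 0 ℕ.< suc n
      pos = ℕ.s≤s ℕ.z≤n
      2<4 : 2 ℕ.< 4
      2<4 = ℕ.s≤s (ℕ.s≤s pos)

      e′ f′ t′ B′ X′ Z′ : Polynomial 6
      e′ = ℤS.var 0F
      f′ = ℤS.var 1F
      t′ = ℤS.var 2F
      B′ = ℤS.var 3F
      X′ = ℤS.var 4F
      Z′ = ℤS.var 5F

    norm-equation-3-2 : ∀ e f T B X Z → ¬ NormEquation (+ 4 * e + + 3) (+ 4 * f + + 2) T B X Z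
    norm-equation-3-2 e f T B X Z eq with parity T
    ... | even t refl = residue-nonzero 2 1 pos (ℕ.s≤s pos)
      (c 2 :* (d₁ :* (t′ :* t′)) :+ c 2 :* ((c 4 :* (e′ :* f′) :+ c 2 :* e′ :+ c 3 :* f′) :* (B′ :* B′)) :+ c 3 :* (B′ :* B′)
        :- c 5 :- c 8 :* (e′ :* e′) :- c 12 :* e′ :- c 2 :* (d₂ :* ((t′ :* B′ :- Z′) :* (t′ :* B′ :- Z′))) :- c 2 :* (d₁ :* X′))
      (defect d₁ d₂ (c 2 :* t′) B′ X′ Z′) (e ∷ f ∷ t ∷ B ∷ X ∷ Z ∷ []) refl (difference-zero eq)
      where
      d₁ = c 4 :* e′ :+ c 3
      d₂ = c 4 :* f′ :+ c 2
    ... | odd t refl = residue-nonzero 4 2 pos 2<4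
      (e′ :* (c 4 :* (t′ :* t′) :+ c 4 :* t′ :+ c 1) :+ c 3 :* (t′ :* t′ :+ t′)
        :+ (c 4 :* (e′ :* f′) :+ c 2 :* e′ :+ c 3 :* f′) :* (B′ :* B′) :+ B′ :* B′ :- c 2 :- c 4 :* (e′ :* e′) :- c 6 :* e′
        :- f′ :* (w :* w) :- c 2 :* ((t′ :* t′ :+ t′) :* (B′ :* B′)) :+ c 2 :* (T′ :* (B′ :* Z′)) :- c 2 :* (Z′ :* Z′) :- d₁ :* X′)
      (defect d₁ d₂ T′ B′ X′ Z′) (e ∷ f ∷ t ∷ B ∷ X ∷ Z ∷ []) refl (difference-zero eq)
      where
      d₁ = c 4 :* e′ :+ c 3
      d₂ = c 4 :* f′ :+ c 2
      T′ = c 2 :* t′ :+ c 1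
      w  = T′ :* B′ :- c 2 :* Z′

    norm-equation-3 : ∀ e d₂ T X Z → ¬ NormEquation (+ 4 * e + + 3) d₂ T 0ℤ X Z
    norm-equation-3 e d T X Z eq with parity T
    ... | even t refl = residue-nonzero 4 3 pos (ℕ.s≤s (ℕ.s≤s (ℕ.s≤s pos)))
      (d₁ :* (t′ :* t′) :- c 4 :* (e′ :* e′) :- c 6 :* e′ :- c 3 :- f′ :* (Z′ :* Z′) :- d₁ :* X′)
      (defect d₁ f′ (c 2 :* t′) (c 0) X′ Z′) (e ∷ d ∷ t ∷ 0ℤ ∷ X ∷ Z ∷ []) refl (difference-zero eq)
      where
      d₁ = c 4 :* e′ :+ c 3
    ... | odd t refl = residue-nonzero 4 2 pos 2<4
      (e′ :* (c 4 :* (t′ :* t′) :+ c 4 :* t′ :+ c 1) :+ c 3 :* (t′ :* t′ :+ t′) :- c 2 :- c 4 :* (e′ :* e′) :- c 6 :* e′ :- f′ :* (Z′ :* Z′) :- d₁ :* X′)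
      (defect d₁ f′ (c 2 :* t′ :+ c 1) (c 0) X′ Z′) (e ∷ d ∷ t ∷ 0ℤ ∷ X ∷ Z ∷ []) refl (difference-zero eq)
      where
      d₁ = c 4 :* e′ :+ c 3

    norm-equation-2 : ∀ e f T X Z → ¬ NormEquation (+ 4 * e + + 2) (+ 4 * f + + 2) T 0ℤ X Z
    norm-equation-2 e f T X Z eq with parity T
    ... | even t refl = residue-nonzero 8 4 pos (ℕ.s≤s (ℕ.s≤s (ℕ.s≤s (ℕ.s≤s pos))))
      (o :* (t′ :* t′) :- c 2 :* (e′ :* e′) :- c 2 :* e′ :- c 1 :- (c 2 :* f′ :+ c 1) :* (Z′ :* Z′) :- o :* X′)
      (defect d₁ d₂ (c 2 :* t′) (c 0) X′ Z′) (e ∷ f ∷ t ∷ 0ℤ ∷ X ∷ Z ∷ []) refl (difference-zero eq)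
      where
      d₁ = c 4 :* e′ :+ c 2
      d₂ = c 4 :* f′ :+ c 2
      o  = c 2 :* e′ :+ c 1
    ... | odd t refl = residue-nonzero 4 2 pos 2<4
      (e′ :* (c 4 :* (t′ :* t′) :+ c 4 :* t′ :+ c 1) :+ c 2 :* (t′ :* t′ :+ t′) :- c 1 :- c 4 :* (e′ :* e′) :- c 4 :* e′ :- d₂ :* (Z′ :* Z′) :- d₁ :* X′)
      (defect d₁ d₂ (c 2 :* t′ :+ c 1) (c 0) X′ Z′) (e ∷ f ∷ t ∷ 0ℤ ∷ X ∷ Z ∷ []) refl (difference-zero eq)
      where
      d₁ = c 4 :* e′ :+ c 2
      d₂ = c 4 :* f′ :+ c 2

  small⇒zero : ∀ {D₁ D₂} B → 0ℤ < D₂ → D₁ ≤ D₂ → (B * B) * D₂ < D₁ → B ≡ 0ℤ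
  small⇒zero {D₁} {D₂} B 0<D₂ D₁≤D₂ B²D₂<D₁ with B ℤ.≟ 0ℤ
  ... | yes B≡0 = B≡0
  ... | no  B≢0 = contradiction (ℤ.<-≤-trans B²D₂<D₁ (ℤ.≤-trans D₁≤D₂ D₂≤B²D₂)) (ℤ.<-irrefl refl)
    where
    D₂≤B²D₂ : D₂ ≤ (B * B) * D₂
    D₂≤B²D₂ = subst (ℤ._≤ (B * B) * D₂) (ℤ.*-identityˡ D₂)
      (ℤ.*-monoʳ-≤-nonNeg D₂ {{ℤ.nonNegative (ℤ.<⇒≤ 0<D₂)}} (ℤ.i<j⇒suc[i]≤j (square-pos B≢0)))

  _≼_ : ∀ {D₁ D₂} → Class D₁ → Class D₂ → Set
  _≼_ {D₁} {D₂} C₁ C₂ = rank C₁ ℕ.< rank C₂ ⊎ (rank C₁ ≡ rank C₂ × D₁ ≤ D₂)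

  module _ {D₁ D₂ A B R k X Z R′ : ℤ} (0<D₂ : 0ℤ < D₂)
    (A²≡D₁ : A * A ≡ D₁ + + 4 * k)
    (A²≡D₂B² : A * A - D₂ * (B * B) ≡ + 4 * R)
    (X²≡D₂Z² : X * X - D₂ * (Z * Z) ≡ + 4 * R′)
    (norm-eq : + 8 * (D₁ * X) ≡ D₁ * (A * A) + D₁ * (D₂ * (B * B)) - D₁ * D₁
       - D₂ * ((A * B - + 4 * Z) * (A * B - + 4 * Z)))
    (B²D₂<D₁ : (B * B) * D₂ < D₁)
    where
    open ℤS using (_:+_; _:*_; _:-_; :-_; _:=_; con)
    open ≡-Reasoning

    private
      D₁≡D₂B² : D₁ ≡ D₂ * (B * B) + + 4 * (R - k)
      D₁≡D₂B² = begin
        D₁  ≡⟨ ℤS.solve 2 (λ d k → d := d :+ con (+ 4) :* k :- con (+ 4) :* k) refl D₁ k ⟩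
        D₁ + + 4 * k - + 4 * k  ≡⟨ cong (ℤ._- + 4 * k) A²≡D₁ ⟨
        A * A - + 4 * k  ≡⟨ ℤS.solve 3 (λ a d k → a :- con (+ 4) :* k := d :+ ((a :- d) :- con (+ 4) :* k)) refl (A * A) (D₂ * (B * B)) k ⟩
        D₂ * (B * B) + ((A * A - D₂ * (B * B)) - + 4 * k)  ≡⟨ cong (λ z → D₂ * (B * B) + (z - + 4 * k)) A²≡D₂B² ⟩
        D₂ * (B * B) + (+ 4 * R - + 4 * k)  ≡⟨ ℤS.solve 3 (λ x r k → x :+ (con (+ 4) :* r :- con (+ 4) :* k) := x :+ con (+ 4) :* (r :- k)) refl (D₂ * (B * B)) R k ⟩
        D₂ * (B * B) + + 4 * (R - k)  ∎

      odd-multiple-of-4 : ∀ d w → D₁ ≡ + 4 * d + 1ℤ → D₁ ≢ + 4 * w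
      odd-multiple-of-4 d w D₁≡ D₁≡4w = residue∤ 4 1 (ℕ.s≤s ℕ.z≤n) (ℕ.s≤s (ℕ.s≤s ℕ.z≤n)) (d - w) (trans
        (ℤS.solve 2 (λ d w → con (+ 4) :* (d :- w) :+ con 1ℤ := con (+ 4) :* d :+ con 1ℤ :- con (+ 4) :* w) refl d w)
        (difference-zero (trans (sym D₁≡4w) D₁≡)))

      even-case : ∀ d₁ d₂ → D₁ ≡ + 4 * d₁ → D₂ ≡ + 4 * d₂ → ∃₂ λ T X′ → NormEquation d₁ d₂ T B X′ Z
      even-case d₁ d₂ D₁≡ D₂≡ =
        let T , A≡ = even-root A (d₁ + k) (begin
              A * A  ≡⟨ A²≡D₁ ⟩
              D₁ + + 4 * k  ≡⟨ cong (ℤ._+ + 4 * k) D₁≡ ⟩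
              + 4 * d₁ + + 4 * k  ≡⟨ ℤ.*-distribˡ-+ (+ 4) d₁ k ⟨
              + 4 * (d₁ + k)  ∎)
            X′ , X≡ = even-root X (R′ + d₂ * (Z * Z)) (begin
              X * X  ≡⟨ ℤS.solve 2 (λ x y → x := (x :- y) :+ y) refl (X * X) (D₂ * (Z * Z)) ⟩
              (X * X - D₂ * (Z * Z)) + D₂ * (Z * Z)  ≡⟨ cong₂ (λ v w → v + w * (Z * Z)) X²≡D₂Z² D₂≡ ⟩
              + 4 * R′ + + 4 * d₂ * (Z * Z)  ≡⟨ ℤS.solve 3 (λ r d z → con (+ 4) :* r :+ con (+ 4) :* d :* z := con (+ 4) :* (r :+ d :* z)) refl R′ d₂ (Z * Z) ⟩
              + 4 * (R′ + d₂ * (Z * Z))  ∎)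
        in T , X′ , divide T X′ A≡ X≡ D₁≡ D₂≡ norm-eq
        where
        divide : ∀ {D₁ D₂ A X} T X′ → A ≡ + 2 * T → X ≡ + 2 * X′ → D₁ ≡ + 4 * d₁ → D₂ ≡ + 4 * d₂ →
          + 8 * (D₁ * X) ≡ D₁ * (A * A) + D₁ * (D₂ * (B * B)) - D₁ * D₁
            - D₂ * ((A * B - + 4 * Z) * (A * B - + 4 * Z)) →
          NormEquation d₁ d₂ T B X′ Z
        divide T X′ refl refl refl refl eq = ℤ.*-cancelˡ-≡ (+ 16) _ _ (trans
          (ℤS.solve 2 (λ d x → con (+ 16) :* (con (+ 4) :* (d :* x)) := con (+ 8) :* ((con (+ 4) :* d) :* (con (+ 2) :* x))) refl d₁ X′)
          (trans eq (ℤS.solve 5 (λ d₁ d₂ t b z → let D₁ = con (+ 4) :* d₁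
                                                     D₂ = con (+ 4) :* d₂
                                                     A  = con (+ 2) :* t in
            D₁ :* (A :* A) :+ D₁ :* (D₂ :* (b :* b)) :- D₁ :* D₁ :- D₂ :* ((A :* b :- con (+ 4) :* z) :* (A :* b :- con (+ 4) :* z))
            := con (+ 16) :* (d₁ :* (t :* t) :+ d₁ :* (d₂ :* (b :* b)) :- d₁ :* d₁ :- d₂ :* ((t :* b :- con (+ 2) :* z) :* (t :* b :- con (+ 2) :* z))))
            refl d₁ d₂ T B Z)))

      B≡0 : D₁ ≤ D₂ → B ≡ 0ℤ
      B≡0 D₁≤D₂ = small⇒zero B 0<D₂ D₁≤D₂ B²D₂<D₁

      odd-even : ∀ d d₂ → D₁ ≡ + 4 * d + 1ℤ → D₂ ≡ + 4 * d₂ → ⊥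
      odd-even d d₂ D₁≡ D₂≡ = odd-multiple-of-4 d (d₂ * (B * B) + (R - k)) D₁≡ (begin
        D₁  ≡⟨ D₁≡D₂B² ⟩
        D₂ * (B * B) + + 4 * (R - k)  ≡⟨ cong (λ z → z * (B * B) + + 4 * (R - k)) D₂≡ ⟩
        + 4 * d₂ * (B * B) + + 4 * (R - k)  ≡⟨ ℤS.solve 3 (λ d b w → con (+ 4) :* d :* b :+ con (+ 4) :* w := con (+ 4) :* (d :* b :+ w)) refl d₂ (B * B) (R - k) ⟩
        + 4 * (d₂ * (B * B) + (R - k))  ∎)

    no-solution : (C₁ : Class D₁) (C₂ : Class D₂) → ¬ (C₁ ≼ C₂)
    no-solution (class₀ d D₁≡) (class₀ _ _) (inj₂ (_ , D₁≤D₂)) = odd-multiple-of-4 d (R - k) D₁≡ (begin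
      D₁  ≡⟨ D₁≡D₂B² ⟩
      D₂ * (B * B) + + 4 * (R - k)  ≡⟨ cong (λ z → D₂ * (z * z) + + 4 * (R - k)) (B≡0 D₁≤D₂) ⟩
      D₂ * 0ℤ + + 4 * (R - k)  ≡⟨ ℤS.solve 2 (λ d w → d :* con 0ℤ :+ w := w) refl D₂ (+ 4 * (R - k)) ⟩
      + 4 * (R - k)  ∎)
    no-solution (class₀ d D₁≡) (class₁ f D₂≡) _ = odd-even d _ D₁≡ D₂≡
    no-solution (class₀ d D₁≡) (class₂ f D₂≡) _ = odd-even d _ D₁≡ D₂≡
    no-solution (class₁ e D₁≡) (class₂ f D₂≡) _ =
      let T , X′ , eq = even-case _ _ D₁≡ D₂≡ in norm-equation-3-2 e f T B X′ Z eq
    no-solution (class₁ e D₁≡) (class₁ f D₂≡) (inj₂ (_ , D₁≤D₂)) =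
      let T , X′ , eq = even-case _ _ D₁≡ D₂≡
      in norm-equation-3 e (+ 4 * f + + 3) T X′ Z (subst (λ b → NormEquation (+ 4 * e + + 3) (+ 4 * f + + 3) T b X′ Z) (B≡0 D₁≤D₂) eq)
    no-solution (class₂ e D₁≡) (class₂ f D₂≡) (inj₂ (_ , D₁≤D₂)) =
      let T , X′ , eq = even-case _ _ D₁≡ D₂≡
      in norm-equation-2 e f T X′ Z (subst (λ b → NormEquation (+ 4 * e + + 2) (+ 4 * f + + 2) T b X′ Z) (B≡0 D₁≤D₂) eq)
    no-solution (class₀ _ _) (class₀ _ _) (inj₁ ())
    no-solution (class₁ _ _) (class₀ _ _) (inj₁ ())
    no-solution (class₁ _ _) (class₀ _ _) (inj₂ ())
    no-solution (class₁ _ _) (class₁ _ _) (inj₁ (ℕ.s≤s ()))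
    no-solution (class₂ _ _) (class₀ _ _) (inj₁ ())
    no-solution (class₂ _ _) (class₀ _ _) (inj₂ ())
    no-solution (class₂ _ _) (class₁ _ _) (inj₁ (ℕ.s≤s ()))
    no-solution (class₂ _ _) (class₁ _ _) (inj₂ ())
    no-solution (class₂ _ _) (class₂ _ _) (inj₁ (ℕ.s≤s (ℕ.s≤s ())))

module _ {c ℓ c′ ℓ′} (F : NumberField c ℓ) (R : CommutativeRing c′ ℓ′) where
  open FieldProperties F
  private module R = CommutativeRing R

  field-homomorphism-injective : ¬ (R.1# R.≈ R.0#) → ∀ {f} → IsRingHomomorphism rawRing R.rawRing f →
    IsRingMonomorphism rawRing R.rawRing f
  field-homomorphism-injective 1≉0 {f} f-homo = record
    { isRingHomomorphism = f-homo
    ; injective = λ {x} {y} → injective x y }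
    where
    module f = IsRingHomomorphism f-homo
    injective : ∀ x y → f x R.≈ f y → x ≈ y
    injective x y fx≈fy with x ≈? y
    ... | yes x≈y = x≈y
    ... | no  x≉y =
      let w , xw≈1 = inverse (x - y) (λ eq → x≉y (x-y≈0⇒x≈y x y eq))
      in contradiction (R.trans (R.sym f.1#-homo) (R.trans (f.⟦⟧-cong (≈-sym xw≈1)) (R.trans (f.*-homo (x - y) w)
           (R.trans (R.*-congʳ fx-y≈0) (R.zeroˡ (f w)))))) 1≉0
      where
      fx-y≈0 : f (x - y) R.≈ R.0#
      fx-y≈0 = R.trans (f.+-homo x (- y)) (R.trans (R.+-cong fx≈fy (f.-‿homo y)) (R.-‿inverseʳ (f y)))

module Biquadratic {c ℓ} (K : NumberField c ℓ) (D₁ D₂ : ℤ) (S T : NumberField.Carrier K)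
  (S²≈D₁ : NumberField._≈_ K (NumberField._*_ K S S) (NumberField.ιℤ K D₁))
  (T²≈D₂ : NumberField._≈_ K (NumberField._*_ K T T) (NumberField.ιℤ K D₂))
  where
  open FieldProperties K

  open Quadruples ℚ.+-*-commutativeRing commutativeRing ι ι-homo (fromℤ D₁) (fromℤ D₂) S T S²≈D₁ T²≈D₂ public

  record IsBasis : Set (c ⊔ ℓ) where
    field
      quad-independent : ∀ a b c d → quad a b c d ≈ 0# → a ≡ 0ℚ × b ≡ 0ℚ × c ≡ 0ℚ × d ≡ 0ℚ
      quad-spans       : ∀ x → ∃₂ λ a b → ∃₂ λ c d → x ≈ quad a b c d

  module Automorphisms (isBasis : IsBasis) where
    open IsBasis isBasis public

    quad-injective : ∀ a b c d a′ b′ c′ d′ → quad a b c d ≈ quad a′ b′ c′ d′ → a ≡ a′ × b ≡ b′ × c ≡ c′ × d ≡ d′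
    quad-injective a b c d a′ b′ c′ d′ eq =
      let p , q , r , s = quad-independent (a ℚ.- a′) (b ℚ.- b′) (c ℚ.- c′) (d ℚ.- d′) (begin
            Δ  ≈⟨ FS.solve 2 (λ x y → x FS.:= (x FS.:+ y) FS.:- y) ≈-refl Δ y′ ⟩
            (Δ + y′) - y′  ≈⟨ +-congʳ (quad-+ _ _ _ _ a′ b′ c′ d′) ⟩
            quad _ _ _ _ - y′  ≈⟨ +-congʳ (quad-cong (add-back a a′) (add-back b b′) (add-back c c′) (add-back d d′)) ⟨
            quad a b c d - y′  ≈⟨ x≈y⇒x-y≈0 eq ⟩
            0#  ∎)
      in p-q≡0 p , p-q≡0 q , p-q≡0 r , p-q≡0 s
      where
      open import Relation.Binary.Reasoning.Setoid setoid
      Δ  = quad (a ℚ.- a′) (b ℚ.- b′) (c ℚ.- c′) (d ℚ.- d′)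
      y′ = quad a′ b′ c′ d′
      p-q≡0 : ∀ {p q} → p ℚ.- q ≡ 0ℚ → p ≡ q
      p-q≡0 {p} {q} eq = trans (add-back p q) (trans (cong (ℚ._+ q) eq) (ℚ.+-identityˡ q))

    module Extension {c′ ℓ′} (R : CommutativeRing c′ ℓ′) (φ : ℚ → CommutativeRing.Carrier R)
      (φ-homo : IsRingHomomorphism ℚ.+-*-rawRing (CommutativeRing.rawRing R) φ)
      (u v : CommutativeRing.Carrier R)
      (u²≈D₁ : CommutativeRing._≈_ R (CommutativeRing._*_ R u u) (φ (fromℤ D₁)))
      (v²≈D₂ : CommutativeRing._≈_ R (CommutativeRing._*_ R v v) (φ (fromℤ D₂)))
      where
      private
        module R = CommutativeRing R
        module φ = IsRingHomomorphism φ-homo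
      module Q = Quadruples ℚ.+-*-commutativeRing R φ φ-homo (fromℤ D₁) (fromℤ D₂) u v u²≈D₁ v²≈D₂

      ext : Carrier → R.Carrier
      ext x = let a , b , c , d , _ = quad-spans x in Q.quad a b c d

      ext-quad : ∀ {x} a b c d → x ≈ quad a b c d → ext x R.≈ Q.quad a b c d
      ext-quad {x} a b c d eq =
        let a′ , b′ , c′ , d′ , eq′ = quad-spans x
            p , q , r , s = quad-injective a′ b′ c′ d′ a b c d (≈-trans (≈-sym eq′) eq)
        in Q.quad-cong p q r s

      ext-cong : ∀ {x y} → x ≈ y → ext x R.≈ ext y
      ext-cong {x} {y} x≈y = let a , b , c , d , eq = quad-spans y in ext-quad a b c d (≈-trans x≈y eq)

      ext-+ : ∀ x y → ext (x + y) R.≈ ext x R.+ ext y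
      ext-+ x y =
        let a , b , c , d , eq = quad-spans x
            a′ , b′ , c′ , d′ , eq′ = quad-spans y
        in R.trans (ext-quad _ _ _ _ (≈-trans (+-cong eq eq′) (quad-+ a b c d a′ b′ c′ d′)))
                   (R.sym (Q.quad-+ a b c d a′ b′ c′ d′))

      ext-* : ∀ x y → ext (x * y) R.≈ ext x R.* ext y
      ext-* x y =
        let a , b , c , d , eq = quad-spans x
            a′ , b′ , c′ , d′ , eq′ = quad-spans y
        in R.trans (ext-quad _ _ _ _ (≈-trans (*-cong eq eq′) (quad-* a b c d a′ b′ c′ d′)))
                   (R.sym (Q.quad-* a b c d a′ b′ c′ d′))

      ext-ι : ∀ q → ext (ι q) R.≈ φ q
      ext-ι q = R.trans (ext-quad q 0ℚ 0ℚ 0ℚ (≈-sym (quad-const q))) (Q.quad-const q)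

      ext-0 : ext 0# R.≈ R.0#
      ext-0 = R.trans (ext-cong (≈-sym ι0)) (R.trans (ext-ι 0ℚ) φ.0#-homo)

      ext-1 : ext 1# R.≈ R.1#
      ext-1 = R.trans (ext-cong (≈-sym ι1)) (R.trans (ext-ι 1ℚ) φ.1#-homo)

      ext-neg : ∀ x → ext (- x) R.≈ R.- ext x
      ext-neg x = GroupProperties.inverseˡ-unique R.+-group (ext (- x)) (ext x)
        (R.trans (R.sym (ext-+ (- x) x)) (R.trans (ext-cong (-‿inverseˡ x)) ext-0))

      ext-homo : IsRingHomomorphism rawRing R.rawRing ext
      ext-homo = record
        { isSemiringHomomorphism = record
          { isNearSemiringHomomorphism = record
            { +-isMonoidHomomorphism = record
              { isMagmaHomomorphism = record { isRelHomomorphism = record { cong = ext-cong } ; homo = ext-+ }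
              ; ε-homo = ext-0 }
            ; *-homo = ext-* }
          ; 1#-homo = ext-1 }
        ; -‿homo = ext-neg }

    private
      -x²≈ : ∀ {x y} → x * x ≈ y → (- x) * (- x) ≈ y
      -x²≈ {x} eq = ≈-trans (FS.solve 1 (λ x → (FS.:- x) FS.:* (FS.:- x) FS.:= x FS.:* x) ≈-refl x) eq

    module E₁ = Extension commutativeRing ι ι-homo S (- T) S²≈D₁ (-x²≈ T²≈D₂)
    module E₂ = Extension commutativeRing ι ι-homo (- S) T (-x²≈ S²≈D₁) T²≈D₂
    module E₃ = Extension commutativeRing ι ι-homo (- S) (- T) (-x²≈ S²≈D₁) (-x²≈ T²≈D₂)

    -- τᵢ fixes the i-th of the subfields ℚ(S), ℚ(T), ℚ(ST).
    τ₁ τ₂ τ₃ : Carrier → Carrier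
    τ₁ = E₁.ext
    τ₂ = E₂.ext
    τ₃ = E₃.ext

    open FS using (_:+_; _:*_; _:-_; :-_; _:=_; con)

    τ₁-quad : ∀ {x} a b c d → x ≈ quad a b c d → τ₁ x ≈ quad a b (ℚ.- c) (ℚ.- d)
    τ₁-quad a b c d eq = ≈-trans (E₁.ext-quad a b c d eq) (≈-trans
      (FS.solve 6 (λ a b c d s t → a :+ b :* s :+ c :* (:- t) :+ d :* (s :* (:- t)) := a :+ b :* s :+ (:- c) :* t :+ (:- d) :* (s :* t)) ≈-refl (ι a) (ι b) (ι c) (ι d) S T)
      (+-cong (+-congˡ (*-congʳ (≈-sym (ι-neg c)))) (*-congʳ (≈-sym (ι-neg d)))))

    τ₂-quad : ∀ {x} a b c d → x ≈ quad a b c d → τ₂ x ≈ quad a (ℚ.- b) c (ℚ.- d)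
    τ₂-quad a b c d eq = ≈-trans (E₂.ext-quad a b c d eq) (≈-trans
      (FS.solve 6 (λ a b c d s t → a :+ b :* (:- s) :+ c :* t :+ d :* ((:- s) :* t) := a :+ (:- b) :* s :+ c :* t :+ (:- d) :* (s :* t)) ≈-refl (ι a) (ι b) (ι c) (ι d) S T)
      (+-cong (+-congʳ (+-congˡ (*-congʳ (≈-sym (ι-neg b))))) (*-congʳ (≈-sym (ι-neg d)))))

    τ₃-quad : ∀ {x} a b c d → x ≈ quad a b c d → τ₃ x ≈ quad a (ℚ.- b) (ℚ.- c) d
    τ₃-quad a b c d eq = ≈-trans (E₃.ext-quad a b c d eq) (≈-trans
      (FS.solve 6 (λ a b c d s t → a :+ b :* (:- s) :+ c :* (:- t) :+ d :* ((:- s) :* (:- t)) := a :+ (:- b) :* s :+ (:- c) :* t :+ d :* (s :* t)) ≈-refl (ι a) (ι b) (ι c) (ι d) S T)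
      (+-congʳ (+-cong (+-congˡ (*-congʳ (≈-sym (ι-neg b)))) (*-congʳ (≈-sym (ι-neg c))))))

module AlmostIntegrality {c ℓ} (K : NumberField c ℓ) (D₁ D₂ : ℤ) (S T : NumberField.Carrier K)
  (S²≈D₁ : NumberField._≈_ K (NumberField._*_ K S S) (NumberField.ιℤ K D₁))
  (T²≈D₂ : NumberField._≈_ K (NumberField._*_ K T T) (NumberField.ιℤ K D₂))
  (isBasis : Biquadratic.IsBasis K D₁ D₂ S T S²≈D₁ T²≈D₂)
  where
  open FieldProperties K
  open Biquadratic K D₁ D₂ S T S²≈D₁ T²≈D₂
  open Automorphisms isBasis
  open Powers commutativeRing
  open FS using (_:+_; _:*_; _:-_; :-_; _:=_; con)
  open import Relation.Binary.Reasoning.Setoid setoid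

  ιℤ-homo : IsRingHomomorphism (CommutativeRing.rawRing ℤ.+-*-commutativeRing) rawRing ιℤ
  ιℤ-homo = record
    { isSemiringHomomorphism = record
      { isNearSemiringHomomorphism = record
        { +-isMonoidHomomorphism = record
          { isMagmaHomomorphism = record { isRelHomomorphism = record { cong = ιℤ-cong } ; homo = ιℤ-+ }
          ; ε-homo = ι0 }
        ; *-homo = ιℤ-* }
      ; 1#-homo = ι1 }
    ; -‿homo = ιℤ-neg }

  private
    module Z = Quadruples ℤ.+-*-commutativeRing commutativeRing ιℤ ιℤ-homo D₁ D₂ S T S²≈D₁ T²≈D₂

  InOrder : Carrier → Set ℓ
  InOrder x = ∃₂ λ a b → ∃₂ λ c d → x ≈ Z.quad a b c d

  order-resp : ∀ {x y} → x ≈ y → InOrder x → InOrder y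
  order-resp x≈y (a , b , c , d , eq) = a , b , c , d , ≈-trans (≈-sym x≈y) eq

  order-+ : ∀ {x y} → InOrder x → InOrder y → InOrder (x + y)
  order-+ (a , b , c , d , eq) (a′ , b′ , c′ , d′ , eq′) =
    a ℤ.+ a′ , b ℤ.+ b′ , c ℤ.+ c′ , d ℤ.+ d′ , ≈-trans (+-cong eq eq′) (Z.quad-+ a b c d a′ b′ c′ d′)

  order-* : ∀ {x y} → InOrder x → InOrder y → InOrder (x * y)
  order-* (a , b , c , d , eq) (a′ , b′ , c′ , d′ , eq′) =
    a ℤ.* a′ ℤ.+ b ℤ.* b′ ℤ.* D₁ ℤ.+ c ℤ.* c′ ℤ.* D₂ ℤ.+ d ℤ.* d′ ℤ.* (D₁ ℤ.* D₂) ,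
    a ℤ.* b′ ℤ.+ b ℤ.* a′ ℤ.+ c ℤ.* d′ ℤ.* D₂ ℤ.+ d ℤ.* c′ ℤ.* D₂ ,
    a ℤ.* c′ ℤ.+ c ℤ.* a′ ℤ.+ b ℤ.* d′ ℤ.* D₁ ℤ.+ d ℤ.* b′ ℤ.* D₁ ,
    a ℤ.* d′ ℤ.+ d ℤ.* a′ ℤ.+ b ℤ.* c′ ℤ.+ c ℤ.* b′ ,
    ≈-trans (*-cong eq eq′) (Z.quad-* a b c d a′ b′ c′ d′)

  order-ιℤ : ∀ z → InOrder (ιℤ z)
  order-ιℤ z = z , 0ℤ , 0ℤ , 0ℤ , ≈-sym (Z.quad-const z)

  order-0 : InOrder 0#
  order-0 = order-resp ι0 (order-ιℤ 0ℤ)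

  -- Unlike integrality, this passes to sums and products without any
  -- elimination theory.
  AlmostIntegral : Carrier → Set ℓ
  AlmostIntegral x = ∃[ N ] N ≢ 0ℤ × ∀ k → InOrder (ιℤ N * x ^ k)

  ℤ-domain : ∀ {m n} → m ≢ 0ℤ → n ≢ 0ℤ → m ℤ.* n ≢ 0ℤ
  ℤ-domain {m} m≢0 n≢0 mn≡0 with ℤ.i*j≡0⇒i≡0∨j≡0 m mn≡0
  ... | inj₁ m≡0 = m≢0 m≡0
  ... | inj₂ n≡0 = n≢0 n≡0

  ^-cong : ∀ {x y} k → x ≈ y → x ^ k ≈ y ^ k
  ^-cong zero    x≈y = ≈-refl
  ^-cong (suc k) x≈y = *-cong x≈y (^-cong k x≈y)

  ai-resp : ∀ {x y} → x ≈ y → AlmostIntegral x → AlmostIntegral y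
  ai-resp x≈y (N , N≢0 , h) = N , N≢0 , λ k → order-resp (*-congˡ (^-cong k x≈y)) (h k)

  ai-* : ∀ {x y} → AlmostIntegral x → AlmostIntegral y → AlmostIntegral (x * y)
  ai-* {x} {y} (M , M≢0 , f) (N , N≢0 , g) = M ℤ.* N , ℤ-domain M≢0 N≢0 , λ k → order-resp (begin
    (ιℤ M * x ^ k) * (ιℤ N * y ^ k)  ≈⟨ FS.solve 4 (λ m p n q → (m :* p) :* (n :* q) := (m :* n) :* (p :* q)) ≈-refl (ιℤ M) (x ^ k) (ιℤ N) (y ^ k) ⟩
    (ιℤ M * ιℤ N) * (x ^ k * y ^ k)  ≈⟨ *-cong (ιℤ-* M N) (^-distrib x y k) ⟨
    ιℤ (M ℤ.* N) * (x * y) ^ k  ∎) (order-* (f k) (g k))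

  ai-+ : ∀ {x y} → AlmostIntegral x → AlmostIntegral y → AlmostIntegral (x + y)
  ai-+ {x} {y} (M , M≢0 , f) (N , N≢0 , g) = M ℤ.* N , ℤ-domain M≢0 N≢0 , λ k →
    order-resp (*-congˡ (≈-trans (*-congʳ (*-identityˡ 1#)) (*-identityˡ _))) (mixed k 0 0)
    where
    mixed : ∀ k i j → InOrder (ιℤ (M ℤ.* N) * ((x ^ i * y ^ j) * (x + y) ^ k))
    mixed zero    i j = order-resp (begin
      (ιℤ M * x ^ i) * (ιℤ N * y ^ j)  ≈⟨ FS.solve 4 (λ m p n q → (m :* p) :* (n :* q) := (m :* n) :* (p :* q)) ≈-refl (ιℤ M) (x ^ i) (ιℤ N) (y ^ j) ⟩
      (ιℤ M * ιℤ N) * (x ^ i * y ^ j)  ≈⟨ *-cong (≈-sym (ιℤ-* M N)) (≈-sym (*-identityʳ _)) ⟩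
      ιℤ (M ℤ.* N) * ((x ^ i * y ^ j) * 1#)  ∎) (order-* (f i) (g j))
    mixed (suc k) i j = order-resp
      (FS.solve 6 (λ n p q x y r → n :* (((x :* p) :* q) :* r) :+ n :* ((p :* (y :* q)) :* r) := n :* ((p :* q) :* ((x :+ y) :* r)))
        ≈-refl (ιℤ (M ℤ.* N)) (x ^ i) (y ^ j) x y ((x + y) ^ k))
      (order-+ (mixed k (suc i) j) (mixed k i (suc j)))

  module _ {f : Carrier → Carrier} (f-homo : IsRingHomomorphism rawRing rawRing f)
    (f-ι : ∀ q → f (ι q) ≈ ι q) (f-order : ∀ {x} → InOrder x → InOrder (f x)) where
    private module f = IsRingHomomorphism f-homo

    ^-homo : ∀ x k → f (x ^ k) ≈ f x ^ k
    ^-homo x zero    = f.1#-homo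
    ^-homo x (suc k) = ≈-trans (f.*-homo x (x ^ k)) (*-congˡ (^-homo x k))

    ai-map : ∀ {x} → AlmostIntegral x → AlmostIntegral (f x)
    ai-map {x} (N , N≢0 , h) = N , N≢0 , λ k →
      order-resp (≈-trans (f.*-homo (ιℤ N) (x ^ k)) (*-cong (f-ι (fromℤ N)) (^-homo x k))) (f-order (h k))

  τ₁-order : ∀ {x} → InOrder x → InOrder (τ₁ x)
  τ₁-order (a , b , c , d , eq) = a , b , ℤ.- c , ℤ.- d , ≈-trans (τ₁-quad _ _ _ _ eq)
    (quad-cong refl refl (sym (fromℤ-neg c)) (sym (fromℤ-neg d)))

  τ₂-order : ∀ {x} → InOrder x → InOrder (τ₂ x)
  τ₂-order (a , b , c , d , eq) = a , ℤ.- b , c , ℤ.- d , ≈-trans (τ₂-quad _ _ _ _ eq)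
    (quad-cong refl (sym (fromℤ-neg b)) refl (sym (fromℤ-neg d)))

  ai-τ₁ : ∀ {x} → AlmostIntegral x → AlmostIntegral (τ₁ x)
  ai-τ₁ = ai-map E₁.ext-homo E₁.ext-ι τ₁-order

  ai-τ₂ : ∀ {x} → AlmostIntegral x → AlmostIntegral (τ₂ x)
  ai-τ₂ = ai-map E₂.ext-homo E₂.ext-ι τ₂-order

  common-denominator : ∀ x → ∃[ N ] N ≢ 0ℤ × InOrder (ιℤ N * x)
  common-denominator x = let a , b , c , d , eq = quad-spans x in go a b c d eq
    where
    go : ∀ a b c d → x ≈ quad a b c d → ∃[ N ] N ≢ 0ℤ × InOrder (ιℤ N * x)
    go a b c d eq = N
      , ℤ-domain (ℤ-domain (↧≢0 a) (↧≢0 b)) (ℤ-domain (↧≢0 c) (↧≢0 d))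
      , order-resp (*-congˡ (≈-sym eq)) (order-resp expand
          (order-+ (order-+ (order-+
            (order-* (order-* (order-ιℤ (↧ b)) (order-ιℤ (↧ c ℤ.* ↧ d))) (order-ιℤ (ℚ.↥ a)))
            (order-* (order-* (order-* (order-ιℤ (↧ a)) (order-ιℤ (↧ c ℤ.* ↧ d))) (order-ιℤ (ℚ.↥ b))) order-S))
            (order-* (order-* (order-* (order-ιℤ (↧ a ℤ.* ↧ b)) (order-ιℤ (↧ d))) (order-ιℤ (ℚ.↥ c))) order-T))
            (order-* (order-* (order-* (order-ιℤ (↧ a ℤ.* ↧ b)) (order-ιℤ (↧ c))) (order-ιℤ (ℚ.↥ d))) (order-* order-S order-T))))
      where
      ↧ = ℚ.↧_
      N = (↧ a ℤ.* ↧ b) ℤ.* (↧ c ℤ.* ↧ d)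
      ↧≢0 : ∀ q → ↧ q ≢ 0ℤ
      ↧≢0 (ℚ.mkℚ _ _ _) ()
      order-S : InOrder S
      order-S = 0ℤ , 1ℤ , 0ℤ , 0ℤ , FS.solve 2 (λ s t → s := con 0ℤ :+ con 1ℤ :* s :+ con 0ℤ :* t :+ con 0ℤ :* (s :* t)) ≈-refl S T
      order-T : InOrder T
      order-T = 0ℤ , 0ℤ , 1ℤ , 0ℤ , FS.solve 2 (λ s t → t := con 0ℤ :+ con 0ℤ :* s :+ con 1ℤ :* t :+ con 0ℤ :* (s :* t)) ≈-refl S T
      clear : ∀ q → ιℤ (ℚ.↥ q) ≈ ι q * ιℤ (↧ q)
      clear q = ≈-trans (ι-cong (sym (↧*≡↥ q))) (ι-* q (fromℤ (↧ q)))
      expand : ιℤ (↧ b) * ιℤ (↧ c ℤ.* ↧ d) * ιℤ (ℚ.↥ a) + ιℤ (↧ a) * ιℤ (↧ c ℤ.* ↧ d) * ιℤ (ℚ.↥ b) * S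
        + ιℤ (↧ a ℤ.* ↧ b) * ιℤ (↧ d) * ιℤ (ℚ.↥ c) * T + ιℤ (↧ a ℤ.* ↧ b) * ιℤ (↧ c) * ιℤ (ℚ.↥ d) * (S * T) ≈ ιℤ N * quad a b c d
      expand = begin
        _ ≈⟨ +-cong (+-cong (+-cong
               (*-cong (*-congˡ (ιℤ-* (↧ c) (↧ d))) (clear a))
               (*-congʳ (*-cong (*-congˡ (ιℤ-* (↧ c) (↧ d))) (clear b))))
               (*-congʳ (*-cong (*-congʳ (ιℤ-* (↧ a) (↧ b))) (clear c))))
               (*-congʳ (*-cong (*-congʳ (ιℤ-* (↧ a) (↧ b))) (clear d))) ⟩
        _ ≈⟨ FS.solve 10 (λ a b c d p q r s S T →
               q :* (r :* s) :* (a :* p) :+ p :* (r :* s) :* (b :* q) :* S :+ p :* q :* s :* (c :* r) :* T :+ p :* q :* r :* (d :* s) :* (S :* T)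
               := ((p :* q) :* (r :* s)) :* (a :+ b :* S :+ c :* T :+ d :* (S :* T))) ≈-refl
               (ι a) (ι b) (ι c) (ι d) (ιℤ (↧ a)) (ιℤ (↧ b)) (ιℤ (↧ c)) (ιℤ (↧ d)) S T ⟩
        (ιℤ (↧ a) * ιℤ (↧ b)) * (ιℤ (↧ c) * ιℤ (↧ d)) * quad a b c d
          ≈⟨ *-congʳ (≈-trans (ιℤ-* (↧ a ℤ.* ↧ b) (↧ c ℤ.* ↧ d)) (*-cong (ιℤ-* (↧ a) (↧ b)) (ιℤ-* (↧ c) (↧ d)))) ⟨
        ιℤ N * quad a b c d ∎

  power-denominator : ∀ x n → ∃[ N ] N ≢ 0ℤ × ∀ k → k ℕ.< n → InOrder (ιℤ N * x ^ k)
  power-denominator x zero    = 1ℤ , (λ ()) , λ _ ()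
  power-denominator x (suc n) =
    let M , M≢0 , f = power-denominator x n
        N , N≢0 , g = common-denominator (x ^ n)
    in M ℤ.* N , ℤ-domain M≢0 N≢0 , λ k k<sn → step M N f g k (ℕ.m<1+n⇒m<n∨m≡n k<sn)
    where
    step : ∀ M N → (∀ k → k ℕ.< n → InOrder (ιℤ M * x ^ k)) → InOrder (ιℤ N * x ^ n) →
      ∀ k → k ℕ.< n ⊎ k ≡ n → InOrder (ιℤ (M ℤ.* N) * x ^ k)
    step M N f g k (inj₁ k<n) = order-resp
      (≈-trans (FS.solve 3 (λ m n p → n :* (m :* p) := (m :* n) :* p) ≈-refl (ιℤ M) (ιℤ N) (x ^ k)) (*-congʳ (≈-sym (ιℤ-* M N))))
      (order-* (order-ιℤ N) (f k k<n))
    step M N f g k (inj₂ refl) = order-resp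
      (≈-trans (≈-sym (*-assoc (ιℤ M) (ιℤ N) (x ^ n))) (*-congʳ (≈-sym (ιℤ-* M N))))
      (order-* (order-ιℤ M) g)

  -- Horner: the terms of lower degree of N xᵏ f(x) lie in the order, hence so
  -- does its leading term.
  leading-term : ∀ N x as k → (∀ i → i ℕ.< length as → InOrder (ιℤ N * x ^ (k ℕ.+ i))) →
    InOrder (ιℤ N * (x ^ k * evalMonic K as x)) → InOrder (ιℤ N * x ^ (k ℕ.+ length as))
  leading-term N x [] k low all = subst (λ m → InOrder (ιℤ N * x ^ m)) (sym (ℕ.+-identityʳ k))
    (order-resp (*-congˡ (*-identityʳ (x ^ k))) all)
  leading-term N x (a ∷ as) k low all =
    subst (λ m → InOrder (ιℤ N * x ^ m)) (sym (ℕ.+-suc k (length as)))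
      (leading-term N x as (suc k)
        (λ i i< → subst (λ m → InOrder (ιℤ N * x ^ m)) (ℕ.+-suc k i) (low (suc i) (ℕ.s≤s i<)))
        (order-resp (begin
            ιℤ N * (x ^ k * (ιℤ a + x * ev)) + ιℤ (ℤ.- a) * (ιℤ N * x ^ k)  ≈⟨ +-congˡ (*-congʳ (ιℤ-neg a)) ⟩
            ιℤ N * (x ^ k * (ιℤ a + x * ev)) + - ιℤ a * (ιℤ N * x ^ k)  ≈⟨ FS.solve 5 (λ n p a x e → n :* (p :* (a :+ x :* e)) :+ :- a :* (n :* p) := n :* ((x :* p) :* e)) ≈-refl (ιℤ N) (x ^ k) (ιℤ a) x ev ⟩
            ιℤ N * ((x * x ^ k) * ev)  ∎)
          (order-+ all (order-* (order-ιℤ (ℤ.- a))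
            (subst (λ m → InOrder (ιℤ N * x ^ m)) (ℕ.+-identityʳ k) (low 0 (ℕ.s≤s ℕ.z≤n)))))))
    where ev = evalMonic K as x

  integral⇒ai : ∀ {x} → Integral K x → AlmostIntegral x
  integral⇒ai {x} ([] , 1≈0) = contradiction 1≈0 1≉0
  integral⇒ai {x} (as@(_ ∷ _) , eq) =
    let N , N≢0 , base = power-denominator x (length as)
    in N , N≢0 , λ k → subst (λ m → InOrder (ιℤ N * x ^ m)) (ℕ.+-identityʳ k) (window N base k 0 (ℕ.s≤s ℕ.z≤n))
    where
    window : ∀ N → (∀ k → k ℕ.< length as → InOrder (ιℤ N * x ^ k)) →
      ∀ j i → i ℕ.< length as → InOrder (ιℤ N * x ^ (j ℕ.+ i))
    window N base zero    i i< = base i i<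
    window N base (suc j) i i< = subst (λ m → InOrder (ιℤ N * x ^ m)) (ℕ.+-suc j i) (next (ℕ.m≤n⇒m<n∨m≡n i<))
      where
      next : suc i ℕ.< length as ⊎ suc i ≡ length as → InOrder (ιℤ N * x ^ (j ℕ.+ suc i))
      next (inj₁ si<) = window N base j (suc i) si<
      next (inj₂ si≡) = subst (λ m → InOrder (ιℤ N * x ^ (j ℕ.+ m))) (sym si≡)
        (leading-term N x as j (window N base j)
          (order-resp (≈-sym (≈-trans (*-congˡ (≈-trans (*-congˡ eq) (zeroʳ (x ^ j)))) (zeroʳ (ιℤ N)))) order-0))

  ι-^ : ∀ q k → ι (q ^ℚ k) ≈ ι q ^ k
  ι-^ q zero    = ι1
  ι-^ q (suc k) = ≈-trans (ι-* q (q ^ℚ k)) (*-congˡ (ι-^ q k))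

  ai-rational : ∀ {q} → AlmostIntegral (ι q) → ∃[ z ] q ≡ fromℤ z
  ai-rational {q} (N , N≢0 , h) = powers-bounded⇒integer q N N≢0 λ k → integer k (h k)
    where
    integer : ∀ k → InOrder (ιℤ N * ι q ^ k) → ∃[ z ] fromℤ N ℚ.* q ^ℚ k ≡ fromℤ z
    integer k (a , b , c , d , eq) = a , proj₁ (quad-injective _ _ _ _ _ _ _ _
      (≈-trans (quad-const (fromℤ N ℚ.* q ^ℚ k)) (≈-trans (≈-trans (ι-* (fromℤ N) (q ^ℚ k)) (*-congˡ (ι-^ q k))) eq)))

discriminant-square : ∀ {D} → IsDiscriminant D → ∃[ m ] D ℤ.* D ≡ D ℤ.+ + 4 ℤ.* m
discriminant-square {D} (inj₁ 4∣D) = let d , eq = 4∣⇒ {D} 4∣D in go d eq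
  where
  go : ∀ d → D ≡ + 4 ℤ.* d → ∃[ m ] D ℤ.* D ≡ D ℤ.+ + 4 ℤ.* m
  go d refl = + 4 ℤ.* (d ℤ.* d) ℤ.- d ,
    ℤS.solve 1 (λ d → (con (+ 4) :* d) :* (con (+ 4) :* d) := con (+ 4) :* d :+ con (+ 4) :* (con (+ 4) :* (d :* d) :- d)) refl d
    where open ℤS using (_:+_; _:*_; _:-_; :-_; _:=_; con)
discriminant-square {D} (inj₂ 4∣D-1) = let d , eq = discriminant-odd {D} 4∣D-1 in go d eq
  where
  go : ∀ d → D ≡ + 4 ℤ.* d ℤ.+ 1ℤ → ∃[ m ] D ℤ.* D ≡ D ℤ.+ + 4 ℤ.* m
  go d refl = d ℤ.* (+ 4 ℤ.* d ℤ.+ 1ℤ) ,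
    ℤS.solve 1 (λ d → (con (+ 4) :* d :+ con 1ℤ) :* (con (+ 4) :* d :+ con 1ℤ) := con (+ 4) :* d :+ con 1ℤ :+ con (+ 4) :* (d :* (con (+ 4) :* d :+ con 1ℤ))) refl d
    where open ℤS using (_:+_; _:*_; _:-_; :-_; _:=_; con)

half-integers : ∀ {D} → Fundamental D → ∀ a b X W → a ℚ.+ a ≡ fromℤ X → a ℚ.* a ℚ.- b ℚ.* b ℚ.* fromℤ D ≡ fromℤ W →
  ∃[ Z ] b ℚ.+ b ≡ fromℤ Z × X ℤ.* X ℤ.- D ℤ.* (Z ℤ.* Z) ≡ + 4 ℤ.* W
half-integers {D} fund a b X W 2a≡X norm≡W =
  let Z , 2b≡Z = fundamental-denominator fund (b ℚ.+ b) X W D4b²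
  in Z , 2b≡Z , fromℤ-injective (equation Z 2b≡Z)
  where
  open ≡-Reasoning
  open ℚS using (_:+_; _:*_; _:-_; :-_; _:=_; con)
  fromℤ-M : fromℤ (X ℤ.* X ℤ.- + 4 ℤ.* W) ≡ fromℤ X ℚ.* fromℤ X ℚ.- fromℤ (+ 4) ℚ.* fromℤ W
  fromℤ-M = trans (fromℤ-minus (X ℤ.* X) (+ 4 ℤ.* W)) (cong₂ ℚ._-_ (fromℤ-* X X) (fromℤ-* (+ 4) W))
  D4b² : fromℤ D ℚ.* ((b ℚ.+ b) ℚ.* (b ℚ.+ b)) ≡ fromℤ (X ℤ.* X ℤ.- + 4 ℤ.* W)
  D4b² = begin
    fromℤ D ℚ.* ((b ℚ.+ b) ℚ.* (b ℚ.+ b))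
      ≡⟨ ℚS.solve 3 (λ d a b → d :* ((b :+ b) :* (b :+ b)) := (a :+ a) :* (a :+ a) :- con (+ 4) :* (a :* a :- b :* b :* d)) refl (fromℤ D) a b ⟩
    (a ℚ.+ a) ℚ.* (a ℚ.+ a) ℚ.- fromℤ (+ 4) ℚ.* (a ℚ.* a ℚ.- b ℚ.* b ℚ.* fromℤ D)
      ≡⟨ cong₂ (λ x w → x ℚ.* x ℚ.- fromℤ (+ 4) ℚ.* w) 2a≡X norm≡W ⟩
    fromℤ X ℚ.* fromℤ X ℚ.- fromℤ (+ 4) ℚ.* fromℤ W
      ≡⟨ fromℤ-M ⟨
    fromℤ (X ℤ.* X ℤ.- + 4 ℤ.* W) ∎
  equation : ∀ Z → b ℚ.+ b ≡ fromℤ Z → fromℤ (X ℤ.* X ℤ.- D ℤ.* (Z ℤ.* Z)) ≡ fromℤ (+ 4 ℤ.* W)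
  equation Z 2b≡Z = begin
    fromℤ (X ℤ.* X ℤ.- D ℤ.* (Z ℤ.* Z))
      ≡⟨ trans (fromℤ-minus (X ℤ.* X) (D ℤ.* (Z ℤ.* Z))) (cong₂ ℚ._-_ (fromℤ-* X X)
           (trans (fromℤ-* D (Z ℤ.* Z)) (cong (fromℤ D ℚ.*_) (fromℤ-* Z Z)))) ⟩
    fromℤ X ℚ.* fromℤ X ℚ.- fromℤ D ℚ.* (fromℤ Z ℚ.* fromℤ Z)
      ≡⟨ cong₂ (λ x z → x ℚ.* x ℚ.- fromℤ D ℚ.* (z ℚ.* z)) 2a≡X 2b≡Z ⟨
    (a ℚ.+ a) ℚ.* (a ℚ.+ a) ℚ.- fromℤ D ℚ.* ((b ℚ.+ b) ℚ.* (b ℚ.+ b))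
      ≡⟨ ℚS.solve 3 (λ d a b → (a :+ a) :* (a :+ a) :- d :* ((b :+ b) :* (b :+ b)) := con (+ 4) :* (a :* a :- b :* b :* d)) refl (fromℤ D) a b ⟩
    fromℤ (+ 4) ℚ.* (a ℚ.* a ℚ.- b ℚ.* b ℚ.* fromℤ D)
      ≡⟨ cong (fromℤ (+ 4) ℚ.*_) norm≡W ⟩
    fromℤ (+ 4) ℚ.* fromℤ W
      ≡⟨ fromℤ-* (+ 4) W ⟨
    fromℤ (+ 4 ℤ.* W) ∎

same-parity : ∀ {D m} → D ℤ.* D ≡ D ℤ.+ + 4 ℤ.* m → ∀ X Z W → X ℤ.* X ℤ.- D ℤ.* (Z ℤ.* Z) ≡ + 4 ℤ.* W →
  ∃[ x ] X ≡ + 2 ℤ.* x ℤ.+ D ℤ.* Z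
same-parity {D} {m} D²≡ X Z W eq = go (parity (X ℤ.- D ℤ.* Z))
  where
  open ℤS using (_:+_; _:*_; _:-_; :-_; _:=_; con)
  open ≡-Reasoning
  split : ∀ {y} → X ℤ.- D ℤ.* Z ≡ y → X ≡ y ℤ.+ D ℤ.* Z
  split {y} eq = trans (ℤS.solve 2 (λ x w → x := x :- w :+ w) refl X (D ℤ.* Z)) (cong (ℤ._+ D ℤ.* Z) eq)
  square-even : (X ℤ.- D ℤ.* Z) ℤ.* (X ℤ.- D ℤ.* Z) ≡ + 2 ℤ.* (D ℤ.* (Z ℤ.* Z) ℤ.+ + 2 ℤ.* (m ℤ.* (Z ℤ.* Z)) ℤ.+ + 2 ℤ.* W ℤ.- D ℤ.* (X ℤ.* Z))
  square-even = begin
    (X ℤ.- D ℤ.* Z) ℤ.* (X ℤ.- D ℤ.* Z)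
      ≡⟨ ℤS.solve 3 (λ x d z → (x :- d :* z) :* (x :- d :* z) := (x :* x :- d :* (z :* z)) :+ (d :* (z :* z) :+ (d :* d) :* (z :* z) :- con (+ 2) :* (d :* (x :* z)))) refl X D Z ⟩
    (X ℤ.* X ℤ.- D ℤ.* (Z ℤ.* Z)) ℤ.+ (D ℤ.* (Z ℤ.* Z) ℤ.+ (D ℤ.* D) ℤ.* (Z ℤ.* Z) ℤ.- + 2 ℤ.* (D ℤ.* (X ℤ.* Z)))
      ≡⟨ cong₂ (λ v w → v ℤ.+ (D ℤ.* (Z ℤ.* Z) ℤ.+ w ℤ.* (Z ℤ.* Z) ℤ.- + 2 ℤ.* (D ℤ.* (X ℤ.* Z)))) eq D²≡ ⟩
    + 4 ℤ.* W ℤ.+ (D ℤ.* (Z ℤ.* Z) ℤ.+ (D ℤ.+ + 4 ℤ.* m) ℤ.* (Z ℤ.* Z) ℤ.- + 2 ℤ.* (D ℤ.* (X ℤ.* Z)))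
      ≡⟨ ℤS.solve 5 (λ w d zz m xz → con (+ 4) :* w :+ (d :* zz :+ (d :+ con (+ 4) :* m) :* zz :- con (+ 2) :* (d :* xz))
           := con (+ 2) :* (d :* zz :+ con (+ 2) :* (m :* zz) :+ con (+ 2) :* w :- d :* xz)) refl W D (Z ℤ.* Z) m (X ℤ.* Z) ⟩
    _ ∎
  go : Parity (X ℤ.- D ℤ.* Z) → ∃[ x ] X ≡ + 2 ℤ.* x ℤ.+ D ℤ.* Z
  go (even x eq) = x , split eq
  go (odd x eq)  = ⊥-elim (residue∤ 2 1 (ℕ.s≤s ℕ.z≤n) (ℕ.s≤s (ℕ.s≤s ℕ.z≤n)) (+ 2 ℤ.* (x ℤ.* x ℤ.+ x) ℤ.- w) (trans
      (ℤS.solve 2 (λ x w → con (+ 2) :* (con (+ 2) :* (x :* x :+ x) :- w) :+ con 1ℤ := (con (+ 2) :* x :+ con 1ℤ) :* (con (+ 2) :* x :+ con 1ℤ) :- con (+ 2) :* w) refl x w)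
      (difference-zero (sym (trans (cong (λ z → z ℤ.* z) (sym eq)) square-even)))))
    where w = D ℤ.* (Z ℤ.* Z) ℤ.+ + 2 ℤ.* (m ℤ.* (Z ℤ.* Z)) ℤ.+ + 2 ℤ.* W ℤ.- D ℤ.* (X ℤ.* Z)

module Subfields {c ℓ} (K : NumberField c ℓ) (D₁ D₂ : ℤ) (S T : NumberField.Carrier K)
  (S²≈D₁ : NumberField._≈_ K (NumberField._*_ K S S) (NumberField.ιℤ K D₁))
  (T²≈D₂ : NumberField._≈_ K (NumberField._*_ K T T) (NumberField.ιℤ K D₂))
  (isBasis : Biquadratic.IsBasis K D₁ D₂ S T S²≈D₁ T²≈D₂)
  (fund₁ : Fundamental D₁) (fund₂ : Fundamental D₂)
  (m : ℤ) (D₁²≡ : D₁ ℤ.* D₁ ≡ D₁ ℤ.+ + 4 ℤ.* m)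
  where
  open FieldProperties K
  open Biquadratic K D₁ D₂ S T S²≈D₁ T²≈D₂ public
  open Automorphisms isBasis public
  open AlmostIntegrality K D₁ D₂ S T S²≈D₁ T²≈D₂ isBasis public
  open QuadraticOrder K S D₁ m S²≈D₁ D₁²≡ public
  open import Relation.Binary.Reasoning.Setoid setoid
  private
    module τ₁ = IsRingHomomorphism E₁.ext-homo
    module τ₂ = IsRingHomomorphism E₂.ext-homo
    module τ₃ = IsRingHomomorphism E₃.ext-homo

  el-quad : ∀ x y → el x y ≈ quad (½ ℚ.* fromℤ (+ 2 ℤ.* x ℤ.+ D₁ ℤ.* y)) (½ ℚ.* fromℤ y) 0ℚ 0ℚ
  el-quad x y = begin
    ιℤ x + ιℤ y * (ι ½ * (ιℤ D₁ + S))
      ≈⟨ +-congʳ (≈-trans (ι-cong x≡) (≈-trans (ι-* ½ (fromℤ (+ 2) ℚ.* fromℤ x)) (*-congˡ (ι-* (fromℤ (+ 2)) (fromℤ x))))) ⟩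
    ι ½ * (ιℤ (+ 2) * ιℤ x) + ιℤ y * (ι ½ * (ιℤ D₁ + S))
      ≈⟨ FS.solve 6 (λ h x y d s t → h FS.:* (FS.con (+ 2) FS.:* x) FS.:+ y FS.:* (h FS.:* (d FS.:+ s))
           FS.:= h FS.:* (FS.con (+ 2) FS.:* x FS.:+ d FS.:* y) FS.:+ (h FS.:* y) FS.:* s FS.:+ FS.con 0ℤ FS.:* t FS.:+ FS.con 0ℤ FS.:* (s FS.:* t)) ≈-refl (ι ½) (ιℤ x) (ιℤ y) (ιℤ D₁) S T ⟩
    ι ½ * (ιℤ (+ 2) * ιℤ x + ιℤ D₁ * ιℤ y) + (ι ½ * ιℤ y) * S + ι 0ℚ * T + ι 0ℚ * (S * T)
      ≈⟨ +-congʳ (+-congʳ (+-cong (≈-trans (ι-* ½ _) (*-congˡ (≈-trans (ιℤ-+ (+ 2 ℤ.* x) (D₁ ℤ.* y)) (+-cong (ιℤ-* (+ 2) x) (ιℤ-* D₁ y)))))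
           (*-congʳ (ι-* ½ (fromℤ y))))) ⟨
    quad (½ ℚ.* fromℤ (+ 2 ℤ.* x ℤ.+ D₁ ℤ.* y)) (½ ℚ.* fromℤ y) 0ℚ 0ℚ ∎
    where
    x≡ : fromℤ x ≡ ½ ℚ.* (fromℤ (+ 2) ℚ.* fromℤ x)
    x≡ = sym (trans (sym (ℚ.*-assoc ½ (fromℤ (+ 2)) (fromℤ x))) (ℚ.*-identityˡ (fromℤ x)))

  bar-quad : ∀ x y → bar x y ≈ quad (½ ℚ.* fromℤ (+ 2 ℤ.* x ℤ.+ D₁ ℤ.* y)) (ℚ.- (½ ℚ.* fromℤ y)) 0ℚ 0ℚ
  bar-quad x y = ≈-trans (el-quad (x ℤ.+ D₁ ℤ.* y) (ℤ.- y)) (quad-cong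
    (cong (λ z → ½ ℚ.* fromℤ z) (ℤS.solve 3 (λ d x y → ℤS.con (+ 2) ℤS.:* (x ℤS.:+ d ℤS.:* y) ℤS.:+ d ℤS.:* (ℤS.:- y) ℤS.:= ℤS.con (+ 2) ℤS.:* x ℤS.:+ d ℤS.:* y) refl D₁ x y))
    (trans (cong (½ ℚ.*_) (fromℤ-neg y)) (sym (ℚ.neg-distribʳ-* ½ (fromℤ y)))) refl refl)

  τ₁-bar : ∀ x y → τ₁ (bar x y) ≈ bar x y
  τ₁-bar x y = ≈-trans (τ₁-quad _ _ _ _ (bar-quad x y)) (≈-sym (bar-quad x y))

  τ₂-el : ∀ x y → τ₂ (el x y) ≈ bar x y
  τ₂-el x y = ≈-trans (τ₂-quad _ _ _ _ (el-quad x y)) (≈-sym (bar-quad x y))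

  τ₂-bar : ∀ x y → τ₂ (bar x y) ≈ el x y
  τ₂-bar x y = ≈-trans (τ₂-quad _ _ _ _ (bar-quad x y))
    (≈-trans (quad-cong refl (RingProperties.-‿involutive (CommutativeRing.ring ℚ.+-*-commutativeRing) _) refl refl) (≈-sym (el-quad x y)))

  τ₃-bar : ∀ x y → τ₃ (bar x y) ≈ el x y
  τ₃-bar x y = ≈-trans (τ₃-quad _ _ _ _ (bar-quad x y))
    (≈-trans (quad-cong refl (RingProperties.-‿involutive (CommutativeRing.ring ℚ.+-*-commutativeRing) _) refl refl) (≈-sym (el-quad x y)))

  ai-el : ∀ x y → AlmostIntegral (el x y)
  ai-el x y = integral⇒ai (el-integral x y)

  ai-first : ∀ {x} a b → x ≈ quad a b 0ℚ 0ℚ → AlmostIntegral x → ∃₂ λ u v → x ≈ el u v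
  ai-first {x} a b x≈ ai-x =
    let X , 2a≡X = ai-rational {a ℚ.+ a} (ai-resp trace (ai-+ ai-x (ai-τ₂ ai-x)))
        W , N≡W = ai-rational {a ℚ.* a ℚ.- b ℚ.* b ℚ.* fromℤ D₁} (ai-resp norm′ (ai-* ai-x (ai-τ₂ ai-x)))
        Z , 2b≡Z , eq = half-integers fund₁ a b X W 2a≡X N≡W
        u , X≡ = same-parity {D₁} {m} D₁²≡ X Z W eq
    in u , Z , ≈-trans x≈ (≈-trans (quad-cong (half {a} {X} 2a≡X X≡) (half′ {b} {Z} 2b≡Z) refl refl) (≈-sym (el-quad u Z)))
    where
    open ℚS using (_:+_; _:*_; _:-_; :-_; _:=_; con)
    trace : x + τ₂ x ≈ ι (a ℚ.+ a)
    trace = ≈-trans (+-cong x≈ (τ₂-quad a b 0ℚ 0ℚ x≈)) (≈-trans (quad-+ a b 0ℚ 0ℚ a (ℚ.- b) 0ℚ (ℚ.- 0ℚ))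
      (≈-trans (quad-cong refl (ℚ.+-inverseʳ b) refl refl) (quad-const (a ℚ.+ a))))
    norm′ : x * τ₂ x ≈ ι (a ℚ.* a ℚ.- b ℚ.* b ℚ.* fromℤ D₁)
    norm′ = ≈-trans (*-cong x≈ (τ₂-quad a b 0ℚ 0ℚ x≈)) (≈-trans (quad-* a b 0ℚ 0ℚ a (ℚ.- b) 0ℚ 0ℚ)
      (≈-trans (quad-cong
        (ℚS.solve 4 (λ a b p q → a :* a :+ b :* (:- b) :* p :+ con 0ℤ :* con 0ℤ :* q :+ con 0ℤ :* con 0ℤ :* (p :* q) := a :* a :- b :* b :* p) refl a b (fromℤ D₁) (fromℤ D₂))
        (ℚS.solve 3 (λ a b q → a :* (:- b) :+ b :* a :+ con 0ℤ :* con 0ℤ :* q :+ con 0ℤ :* con 0ℤ :* q := con 0ℤ) refl a b (fromℤ D₂))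
        (ℚS.solve 3 (λ a b p → a :* con 0ℤ :+ con 0ℤ :* a :+ b :* con 0ℤ :* p :+ con 0ℤ :* (:- b) :* p := con 0ℤ) refl a b (fromℤ D₁))
        (ℚS.solve 2 (λ a b → a :* con 0ℤ :+ con 0ℤ :* a :+ b :* con 0ℤ :+ con 0ℤ :* (:- b) := con 0ℤ) refl a b))
        (quad-const _)))
    half′ : ∀ {c Y} → c ℚ.+ c ≡ fromℤ Y → c ≡ ½ ℚ.* fromℤ Y
    half′ {c} {Y} eq = trans (sym (half+half c)) (trans (ℚS.solve 2 (λ c h → c :* h :+ c :* h := h :* (c :+ c)) refl c ½) (cong (½ ℚ.*_) eq))
    half : ∀ {c X Y} → c ℚ.+ c ≡ fromℤ X → X ≡ Y → c ≡ ½ ℚ.* fromℤ Y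
    half {c} {X} eq refl = half′ {c} {X} eq

  ai-second : ∀ {x} a c → x ≈ quad a 0ℚ c 0ℚ → AlmostIntegral x →
    ∃₂ λ X Z → ∃[ W ] a ℚ.+ a ≡ fromℤ X × c ℚ.+ c ≡ fromℤ Z × X ℤ.* X ℤ.- D₂ ℤ.* (Z ℤ.* Z) ≡ + 4 ℤ.* W
  ai-second {x} a c x≈ ai-x =
    let X , 2a≡X = ai-rational {a ℚ.+ a} (ai-resp trace (ai-+ ai-x (ai-τ₁ ai-x)))
        W , N≡W = ai-rational {a ℚ.* a ℚ.- c ℚ.* c ℚ.* fromℤ D₂} (ai-resp norm′ (ai-* ai-x (ai-τ₁ ai-x)))
        Z , 2c≡Z , eq = half-integers fund₂ a c X W 2a≡X N≡W
    in X , Z , W , 2a≡X , 2c≡Z , eq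
    where
    open ℚS using (_:+_; _:*_; _:-_; :-_; _:=_; con)
    trace : x + τ₁ x ≈ ι (a ℚ.+ a)
    trace = ≈-trans (+-cong x≈ (τ₁-quad a 0ℚ c 0ℚ x≈)) (≈-trans (quad-+ a 0ℚ c 0ℚ a 0ℚ (ℚ.- c) (ℚ.- 0ℚ))
      (≈-trans (quad-cong refl refl (ℚ.+-inverseʳ c) refl) (quad-const (a ℚ.+ a))))
    norm′ : x * τ₁ x ≈ ι (a ℚ.* a ℚ.- c ℚ.* c ℚ.* fromℤ D₂)
    norm′ = ≈-trans (*-cong x≈ (τ₁-quad a 0ℚ c 0ℚ x≈)) (≈-trans (quad-* a 0ℚ c 0ℚ a 0ℚ (ℚ.- c) 0ℚ)
      (≈-trans (quad-cong
        (ℚS.solve 4 (λ a c p q → a :* a :+ con 0ℤ :* con 0ℤ :* p :+ c :* (:- c) :* q :+ con 0ℤ :* con 0ℤ :* (p :* q) := a :* a :- c :* c :* q) refl a c (fromℤ D₁) (fromℤ D₂))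
        (ℚS.solve 3 (λ a c q → a :* con 0ℤ :+ con 0ℤ :* a :+ c :* con 0ℤ :* q :+ con 0ℤ :* (:- c) :* q := con 0ℤ) refl a c (fromℤ D₂))
        (ℚS.solve 3 (λ a c p → a :* (:- c) :+ c :* a :+ con 0ℤ :* con 0ℤ :* p :+ con 0ℤ :* con 0ℤ :* p := con 0ℤ) refl a c (fromℤ D₁))
        (ℚS.solve 2 (λ a c → a :* con 0ℤ :+ con 0ℤ :* a :+ con 0ℤ :* (:- c) :+ c :* con 0ℤ := con 0ℤ) refl a c))
        (quad-const _)))

  quad-S : ∀ z → ιℤ z * S ≈ quad 0ℚ (fromℤ z) 0ℚ 0ℚ
  quad-S z = FS.solve 3 (λ z s t → z FS.:* s FS.:= FS.con 0ℤ FS.:+ z FS.:* s FS.:+ FS.con 0ℤ FS.:* t FS.:+ FS.con 0ℤ FS.:* (s FS.:* t)) ≈-refl (ιℤ z) S T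

  quad-neg : ∀ a b c d → - quad a b c d ≈ quad (ℚ.- a) (ℚ.- b) (ℚ.- c) (ℚ.- d)
  quad-neg a b c d = ≈-trans
    (FS.solve 6 (λ a b c d s t → FS.:- (a FS.:+ b FS.:* s FS.:+ c FS.:* t FS.:+ d FS.:* (s FS.:* t))
      FS.:= (FS.:- a) FS.:+ (FS.:- b) FS.:* s FS.:+ (FS.:- c) FS.:* t FS.:+ (FS.:- d) FS.:* (s FS.:* t)) ≈-refl (ι a) (ι b) (ι c) (ι d) S T)
    (+-cong (+-cong (+-cong (≈-sym (ι-neg a)) (*-congʳ (≈-sym (ι-neg b)))) (*-congʳ (≈-sym (ι-neg c)))) (*-congʳ (≈-sym (ι-neg d))))

  infixl 6 _⊞_
  _⊞_ : ∀ {u v a b c d a′ b′ c′ d′} → u ≈ quad a b c d → v ≈ quad a′ b′ c′ d′ →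
    u + v ≈ quad (a ℚ.+ a′) (b ℚ.+ b′) (c ℚ.+ c′) (d ℚ.+ d′)
  _⊞_ {a = a} {b} {c} {d} {a′} {b′} {c′} {d′} p q = ≈-trans (+-cong p q) (quad-+ a b c d a′ b′ c′ d′)

  ⊟_ : ∀ {u a b c d} → u ≈ quad a b c d → - u ≈ quad (ℚ.- a) (ℚ.- b) (ℚ.- c) (ℚ.- d)
  ⊟_ {a = a} {b} {c} {d} p = ≈-trans (-‿cong p) (quad-neg a b c d)

  τ₂τ₁ : ∀ x → τ₂ (τ₁ x) ≈ τ₃ x
  τ₂τ₁ x = let a , b , c , d , x≈ = quad-spans x in ≈-trans
    (τ₂-quad a b (ℚ.- c) (ℚ.- d) (τ₁-quad a b c d x≈))
    (≈-trans (quad-cong refl refl refl (RingProperties.-‿involutive (CommutativeRing.ring ℚ.+-*-commutativeRing) d)) (≈-sym (τ₃-quad a b c d x≈)))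

  el-combination : ∀ k n a b x y → el (k ℤ.* a ℤ.+ n ℤ.* x) (k ℤ.* b ℤ.+ n ℤ.* y) ≈ ιℤ k * el a b + ιℤ n * el x y
  el-combination k n a b x y = ≈-trans
    (+-cong (≈-trans (ιℤ-+ (k ℤ.* a) (n ℤ.* x)) (+-cong (ιℤ-* k a) (ιℤ-* n x)))
      (*-congʳ (≈-trans (ιℤ-+ (k ℤ.* b) (n ℤ.* y)) (+-cong (ιℤ-* k b) (ιℤ-* n y)))))
    (FS.solve 7 (λ k n a b x y w → (k FS.:* a FS.:+ n FS.:* x) FS.:+ (k FS.:* b FS.:+ n FS.:* y) FS.:* w
      FS.:= k FS.:* (a FS.:+ b FS.:* w) FS.:+ n FS.:* (x FS.:+ y FS.:* w)) ≈-refl (ιℤ k) (ιℤ n) (ιℤ a) (ιℤ b) (ιℤ x) (ιℤ y) ω)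

  bar-combination : ∀ k n a b x y → bar (k ℤ.* a ℤ.+ n ℤ.* x) (k ℤ.* b ℤ.+ n ℤ.* y) ≈ ιℤ k * bar a b + ιℤ n * bar x y
  bar-combination k n a b x y = ≈-trans (el-cong
    (ℤS.solve 7 (λ D k n a b x y → (k ℤS.:* a ℤS.:+ n ℤS.:* x) ℤS.:+ D ℤS.:* (k ℤS.:* b ℤS.:+ n ℤS.:* y)
      ℤS.:= k ℤS.:* (a ℤS.:+ D ℤS.:* b) ℤS.:+ n ℤS.:* (x ℤS.:+ D ℤS.:* y)) refl D₁ k n a b x y)
    (ℤS.solve 4 (λ k n b y → ℤS.:- (k ℤS.:* b ℤS.:+ n ℤS.:* y) ℤS.:= k ℤS.:* (ℤS.:- b) ℤS.:+ n ℤS.:* (ℤS.:- y)) refl k n b y))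
    (el-combination k n (a ℤ.+ D₁ ℤ.* b) (ℤ.- b) (x ℤ.+ D₁ ℤ.* y) (ℤ.- y))

  wronskian : ∀ a b x y → el x y * bar a b - bar x y * el a b ≈ ιℤ (det a b x y) * S
  wronskian a b x y = begin
    el x y * bar a b - bar x y * el a b
      ≈⟨ +-cong (el-* x y (a ℤ.+ D₁ ℤ.* b) (ℤ.- b)) (-‿cong (el-* (x ℤ.+ D₁ ℤ.* y) (ℤ.- y) a b)) ⟩
    el p q - el p′ q′
      ≈⟨ +-cong (el-cong {p} {q} refl q≡) (-‿cong (el-cong p′≡ q′≡)) ⟩
    el p δ - el (p ℤ.+ D₁ ℤ.* δ) (ℤ.- δ)
      ≈⟨ +-congˡ (-‿cong (+-cong (≈-trans (ιℤ-+ p (D₁ ℤ.* δ)) (+-congˡ (ιℤ-* D₁ δ))) (*-congʳ (ιℤ-neg δ)))) ⟩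
    (ιℤ p + ιℤ δ * ω) - (ιℤ p + ιℤ D₁ * ιℤ δ + - ιℤ δ * ω)
      ≈⟨ FS.solve 4 (λ p δ w d → (p FS.:+ δ FS.:* w) FS.:- (p FS.:+ d FS.:* δ FS.:+ (FS.:- δ) FS.:* w) FS.:= δ FS.:* (FS.con (+ 2) FS.:* w FS.:- d)) ≈-refl (ιℤ p) (ιℤ δ) ω (ιℤ D₁) ⟩
    ιℤ δ * (ιℤ (+ 2) * ω - ιℤ D₁)
      ≈⟨ *-congˡ (≈-trans (+-congʳ 2ω) (FS.solve 2 (λ d s → (d FS.:+ s) FS.:- d FS.:= s) ≈-refl (ιℤ D₁) S)) ⟩
    ιℤ δ * S ∎
    where
    δ p q p′ q′ : ℤ
    δ  = det a b x y
    p  = x ℤ.* (a ℤ.+ D₁ ℤ.* b) ℤ.- m ℤ.* (y ℤ.* (ℤ.- b))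
    q  = x ℤ.* (ℤ.- b) ℤ.+ (a ℤ.+ D₁ ℤ.* b) ℤ.* y ℤ.+ D₁ ℤ.* (y ℤ.* (ℤ.- b))
    p′ = (x ℤ.+ D₁ ℤ.* y) ℤ.* a ℤ.- m ℤ.* ((ℤ.- y) ℤ.* b)
    q′ = (x ℤ.+ D₁ ℤ.* y) ℤ.* b ℤ.+ a ℤ.* (ℤ.- y) ℤ.+ D₁ ℤ.* ((ℤ.- y) ℤ.* b)
    q≡ : q ≡ δ
    q≡ = ℤS.solve 5 (λ D a b x y → x ℤS.:* (ℤS.:- b) ℤS.:+ (a ℤS.:+ D ℤS.:* b) ℤS.:* y ℤS.:+ D ℤS.:* (y ℤS.:* (ℤS.:- b)) ℤS.:= a ℤS.:* y ℤS.:- x ℤS.:* b) refl D₁ a b x y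
    q′≡ : q′ ≡ ℤ.- δ
    q′≡ = ℤS.solve 5 (λ D a b x y → (x ℤS.:+ D ℤS.:* y) ℤS.:* b ℤS.:+ a ℤS.:* (ℤS.:- y) ℤS.:+ D ℤS.:* ((ℤS.:- y) ℤS.:* b) ℤS.:= ℤS.:- (a ℤS.:* y ℤS.:- x ℤS.:* b)) refl D₁ a b x y
    p′≡ : p′ ≡ p ℤ.+ D₁ ℤ.* δ
    p′≡ = ℤS.solve 6 (λ D m a b x y → (x ℤS.:+ D ℤS.:* y) ℤS.:* a ℤS.:- m ℤS.:* ((ℤS.:- y) ℤS.:* b)
      ℤS.:= x ℤS.:* (a ℤS.:+ D ℤS.:* b) ℤS.:- m ℤS.:* (y ℤS.:* (ℤS.:- b)) ℤS.:+ D ℤS.:* (a ℤS.:* y ℤS.:- x ℤS.:* b)) refl D₁ m a b x y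

  module Traces (O : Ordering K) where
    open OrderingProperties O

    oriented-mate : ∀ a b x y → det a b x y ℤ.* det a b x y ≡ 1ℤ → norm x y ℤ.< 0ℤ →
      ∃₂ λ x y → det a b x y ℤ.* det a b x y ≡ 1ℤ × P (el x y) × P (- bar x y)
    oriented-mate a b x y det² N<0 = go (P-dich (el x y) el≉0)
      where
      P-norm : ∀ x y → norm x y ℤ.< 0ℤ → P (- bar x y * el x y)
      P-norm x y N<0 = P-resp (begin
        ιℤ (ℤ.- norm x y)  ≈⟨ ιℤ-neg (norm x y) ⟩
        - ιℤ (norm x y)  ≈⟨ -‿cong (el*bar x y) ⟨
        - (el x y * bar x y)  ≈⟨ FS.solve 2 (λ u v → FS.:- (u FS.:* v) FS.:= (FS.:- v) FS.:* u) ≈-refl (el x y) (bar x y) ⟩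
        - bar x y * el x y  ∎) (P-ℤ (ℤ.neg-mono-< {norm x y} {0ℤ} N<0))
      el≉0 : ¬ (el x y ≈ 0#)
      el≉0 el≈0 = P⇒≉0 (P-norm x y N<0) (≈-trans (*-congˡ el≈0) (zeroʳ _))
      el-neg : el (ℤ.- x) (ℤ.- y) ≈ - el x y
      el-neg = ≈-trans (+-cong (ιℤ-neg x) (*-congʳ (ιℤ-neg y)))
        (FS.solve 3 (λ x y w → FS.:- x FS.:+ (FS.:- y) FS.:* w FS.:= FS.:- (x FS.:+ y FS.:* w)) ≈-refl (ιℤ x) (ιℤ y) ω)
      go : P (el x y) ⊎ P (- el x y) → ∃₂ λ x y → det a b x y ℤ.* det a b x y ≡ 1ℤ × P (el x y) × P (- bar x y)
      go (inj₁ p) = x , y , det² , p , P-quotient (P-norm x y N<0) p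
      go (inj₂ p) = ℤ.- x , ℤ.- y
        , trans (ℤS.solve 4 (λ a b x y → (a ℤS.:* (ℤS.:- y) ℤS.:- (ℤS.:- x) ℤS.:* b) ℤS.:* (a ℤS.:* (ℤS.:- y) ℤS.:- (ℤS.:- x) ℤS.:* b)
            ℤS.:= (a ℤS.:* y ℤS.:- x ℤS.:* b) ℤS.:* (a ℤS.:* y ℤS.:- x ℤS.:* b)) refl a b x y) det²
        , p′ , P-quotient (P-norm (ℤ.- x) (ℤ.- y) (subst (ℤ._< 0ℤ) (sym norm-neg) N<0)) p′
        where
        p′ : P (el (ℤ.- x) (ℤ.- y))
        p′ = P-resp (≈-sym el-neg) p
        norm-neg : norm (ℤ.- x) (ℤ.- y) ≡ norm x y
        norm-neg = ℤS.solve 4 (λ D m x y → (ℤS.:- x) ℤS.:* (ℤS.:- x) ℤS.:+ D ℤS.:* ((ℤS.:- x) ℤS.:* (ℤS.:- y)) ℤS.:+ m ℤS.:* ((ℤS.:- y) ℤS.:* (ℤS.:- y))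
          ℤS.:= x ℤS.:* x ℤS.:+ D ℤS.:* (x ℤS.:* y) ℤS.:+ m ℤS.:* (y ℤS.:* y)) refl D₁ m x y

    module Mate (a b x y : ℤ) (Pα : P (el a b)) (Pᾱ : P (bar a b))
      (det² : det a b x y ℤ.* det a b x y ≡ 1ℤ) (Pη : P (el x y)) (P-η̄ : P (- bar x y)) where

      -- υ = η̄β is used because its four conjugates have known signs.
      module Summand (β : Carrier) (Pβ : P β) (Pβ₁ : P (τ₁ β)) (Pβ₂ : P (τ₂ β)) (Pβ₃ : P (τ₃ β))
        (k n : ℤ) (trace : β + τ₁ β ≈ el (k ℤ.* a ℤ.+ n ℤ.* x) (k ℤ.* b ℤ.+ n ℤ.* y)) where

        υ Σ⁺ Σ⁻ : Carrier
        υ  = bar x y * β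
        Σ⁻ = - υ - τ₁ υ + τ₂ υ + τ₃ υ
        Σ⁺ = υ + τ₁ υ + τ₂ υ + τ₃ υ

        υ₁≈ : τ₁ υ ≈ bar x y * τ₁ β
        υ₁≈ = ≈-trans (τ₁.*-homo (bar x y) β) (*-congʳ (τ₁-bar x y))
        υ₂≈ : τ₂ υ ≈ el x y * τ₂ β
        υ₂≈ = ≈-trans (τ₂.*-homo (bar x y) β) (*-congʳ (τ₂-bar x y))
        υ₃≈ : τ₃ υ ≈ el x y * τ₃ β
        υ₃≈ = ≈-trans (τ₃.*-homo (bar x y) β) (*-congʳ (τ₃-bar x y))

        P-υ : P (- υ)
        P-υ = P-resp (FS.solve 2 (λ u v → (FS.:- u) FS.:* v FS.:= FS.:- (u FS.:* v)) ≈-refl (bar x y) β) (P-* P-η̄ Pβ)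
        P-υ₁ : P (- τ₁ υ)
        P-υ₁ = P-resp (≈-trans (FS.solve 2 (λ u v → (FS.:- u) FS.:* v FS.:= FS.:- (u FS.:* v)) ≈-refl (bar x y) (τ₁ β)) (-‿cong (≈-sym υ₁≈))) (P-* P-η̄ Pβ₁)
        Pυ₂ : P (τ₂ υ)
        Pυ₂ = P-resp (≈-sym υ₂≈) (P-* Pη Pβ₂)
        Pυ₃ : P (τ₃ υ)
        Pυ₃ = P-resp (≈-sym υ₃≈) (P-* Pη Pβ₃)

        trace′ : τ₂ β + τ₃ β ≈ bar (k ℤ.* a ℤ.+ n ℤ.* x) (k ℤ.* b ℤ.+ n ℤ.* y)
        trace′ = begin
          τ₂ β + τ₃ β  ≈⟨ +-congˡ (τ₂τ₁ β) ⟨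
          τ₂ β + τ₂ (τ₁ β)  ≈⟨ τ₂.+-homo β (τ₁ β) ⟨
          τ₂ (β + τ₁ β)  ≈⟨ τ₂.⟦⟧-cong trace ⟩
          τ₂ (el (k ℤ.* a ℤ.+ n ℤ.* x) (k ℤ.* b ℤ.+ n ℤ.* y)) ≈⟨ τ₂-el (k ℤ.* a ℤ.+ n ℤ.* x) (k ℤ.* b ℤ.+ n ℤ.* y) ⟩
          bar (k ℤ.* a ℤ.+ n ℤ.* x) (k ℤ.* b ℤ.+ n ℤ.* y) ∎

        υ+υ₁ : υ + τ₁ υ ≈ bar x y * (ιℤ k * el a b + ιℤ n * el x y)
        υ+υ₁ = begin
          υ + τ₁ υ  ≈⟨ +-congˡ υ₁≈ ⟩
          bar x y * β + bar x y * τ₁ β  ≈⟨ distribˡ (bar x y) β (τ₁ β) ⟨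
          bar x y * (β + τ₁ β)  ≈⟨ *-congˡ (≈-trans trace (el-combination k n a b x y)) ⟩
          bar x y * (ιℤ k * el a b + ιℤ n * el x y) ∎

        υ₂+υ₃ : τ₂ υ + τ₃ υ ≈ el x y * (ιℤ k * bar a b + ιℤ n * bar x y)
        υ₂+υ₃ = begin
          τ₂ υ + τ₃ υ  ≈⟨ +-cong υ₂≈ υ₃≈ ⟩
          el x y * τ₂ β + el x y * τ₃ β  ≈⟨ distribˡ (el x y) (τ₂ β) (τ₃ β) ⟨
          el x y * (τ₂ β + τ₃ β)  ≈⟨ *-congˡ (≈-trans trace′ (bar-combination k n a b x y)) ⟩
          el x y * (ιℤ k * bar a b + ιℤ n * bar x y) ∎

        Σ⁻≈ : Σ⁻ ≈ ιℤ k * (el x y * bar a b - bar x y * el a b)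
        Σ⁻≈ = begin
          - υ - τ₁ υ + τ₂ υ + τ₃ υ  ≈⟨ FS.solve 4 (λ p q r s → FS.:- p FS.:- q FS.:+ r FS.:+ s FS.:= (r FS.:+ s) FS.:- (p FS.:+ q)) ≈-refl υ (τ₁ υ) (τ₂ υ) (τ₃ υ) ⟩
          (τ₂ υ + τ₃ υ) - (υ + τ₁ υ)  ≈⟨ +-cong υ₂+υ₃ (-‿cong υ+υ₁) ⟩
          el x y * (ιℤ k * bar a b + ιℤ n * bar x y) - bar x y * (ιℤ k * el a b + ιℤ n * el x y)
            ≈⟨ FS.solve 6 (λ e e′ f f′ k n → e FS.:* (k FS.:* f′ FS.:+ n FS.:* e′) FS.:- e′ FS.:* (k FS.:* f FS.:+ n FS.:* e)
                 FS.:= k FS.:* (e FS.:* f′ FS.:- e′ FS.:* f)) ≈-refl (el x y) (bar x y) (el a b) (bar a b) (ιℤ k) (ιℤ n) ⟩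
          ιℤ k * (el x y * bar a b - bar x y * el a b) ∎

        Σ⁺≈ : Σ⁺ ≈ ιℤ (k ℤ.* polar x y a b ℤ.+ + 2 ℤ.* (n ℤ.* norm x y))
        Σ⁺≈ = begin
          υ + τ₁ υ + τ₂ υ + τ₃ υ  ≈⟨ +-assoc (υ + τ₁ υ) (τ₂ υ) (τ₃ υ) ⟩
          (υ + τ₁ υ) + (τ₂ υ + τ₃ υ)  ≈⟨ +-cong υ+υ₁ υ₂+υ₃ ⟩
          bar x y * (ιℤ k * el a b + ιℤ n * el x y) + el x y * (ιℤ k * bar a b + ιℤ n * bar x y)
            ≈⟨ FS.solve 6 (λ e e′ f f′ k n → e′ FS.:* (k FS.:* f FS.:+ n FS.:* e) FS.:+ e FS.:* (k FS.:* f′ FS.:+ n FS.:* e′)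
                 FS.:= k FS.:* (e FS.:* f′ FS.:+ e′ FS.:* f) FS.:+ FS.con (+ 2) FS.:* (n FS.:* (e FS.:* e′))) ≈-refl (el x y) (bar x y) (el a b) (bar a b) (ιℤ k) (ιℤ n) ⟩
          ιℤ k * (el x y * bar a b + bar x y * el a b) + ιℤ (+ 2) * (ιℤ n * (el x y * bar x y))
            ≈⟨ +-cong (*-congˡ (polarization x y a b)) (*-congˡ (*-congˡ (el*bar x y))) ⟩
          ιℤ k * ιℤ (polar x y a b) + ιℤ (+ 2) * (ιℤ n * ιℤ (norm x y))
            ≈⟨ ≈-trans (ιℤ-+ (k ℤ.* polar x y a b) (+ 2 ℤ.* (n ℤ.* norm x y))) (+-cong (ιℤ-* k (polar x y a b))
                 (≈-trans (ιℤ-* (+ 2) (n ℤ.* norm x y)) (*-congˡ (ιℤ-* n (norm x y))))) ⟨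
          ιℤ (k ℤ.* polar x y a b ℤ.+ + 2 ℤ.* (n ℤ.* norm x y)) ∎

        coefficient-positive : 0ℤ ℤ.< k
        coefficient-positive = P-ℤ⁻¹ (P-quotient (P-resp Σ⁻≈ (P-+ (P-+ (P-+ P-υ P-υ₁) Pυ₂) Pυ₃)) Pc)
          where
          Pc : P (el x y * bar a b - bar x y * el a b)
          Pc = P-resp (FS.solve 4 (λ e e′ f f′ → e FS.:* f′ FS.:+ (FS.:- e′) FS.:* f FS.:= e FS.:* f′ FS.:- e′ FS.:* f) ≈-refl (el x y) (bar x y) (el a b) (bar a b))
            (P-+ (P-* Pη Pᾱ) (P-* P-η̄ Pα))

      module Half (β : Carrier) (ai-β : AlmostIntegral β) (Pβ : P β) (Pβ₁ : P (τ₁ β)) (Pβ₂ : P (τ₂ β)) (Pβ₃ : P (τ₃ β))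
        (n : ℤ) (trace : β + τ₁ β ≈ el (1ℤ ℤ.* a ℤ.+ n ℤ.* x) (1ℤ ℤ.* b ℤ.+ n ℤ.* y)) (0<D₂ : 0ℤ ℤ.< D₂) where
        open Summand β Pβ Pβ₁ Pβ₂ Pβ₃ 1ℤ n trace

        δ A : ℤ
        δ = det a b x y
        A = 1ℤ ℤ.* polar x y a b ℤ.+ + 2 ℤ.* (n ℤ.* norm x y)

        d₁ d₂ : ℚ
        d₁ = fromℤ D₁
        d₂ = fromℤ D₂

        κ : ℤ
        κ = norm a b ℤ.* norm x y ℤ.+ polar x y a b ℤ.* (n ℤ.* norm x y) ℤ.+ (n ℤ.* norm x y) ℤ.* (n ℤ.* norm x y)

        A²≡ : A ℤ.* A ≡ D₁ ℤ.+ + 4 ℤ.* κ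
        A²≡ = ≡.begin
          A ℤ.* A ≡.≡⟨ ℤS.solve 2 (λ h w → (ℤS.con 1ℤ ℤS.:* h ℤS.:+ ℤS.con (+ 2) ℤS.:* w) ℤS.:* (ℤS.con 1ℤ ℤS.:* h ℤS.:+ ℤS.con (+ 2) ℤS.:* w)
              ℤS.:= h ℤS.:* h ℤS.:+ ℤS.con (+ 4) ℤS.:* (h ℤS.:* w ℤS.:+ w ℤS.:* w)) refl (polar x y a b) (n ℤ.* norm x y) ⟩
          polar x y a b ℤ.* polar x y a b ℤ.+ rest ≡.≡⟨ cong (ℤ._+ rest) (trans (gram x y a b)
              (cong (λ z → D₁ ℤ.* z ℤ.+ + 4 ℤ.* (norm a b ℤ.* norm x y)) det²)) ⟩
          (D₁ ℤ.* 1ℤ ℤ.+ + 4 ℤ.* (norm a b ℤ.* norm x y)) ℤ.+ rest ≡.≡⟨ ℤS.solve 4 (λ d p h w → (d ℤS.:* ℤS.con 1ℤ ℤS.:+ ℤS.con (+ 4) ℤS.:* p) ℤS.:+ ℤS.con (+ 4) ℤS.:* (h ℤS.:* w ℤS.:+ w ℤS.:* w)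
              ℤS.:= d ℤS.:+ ℤS.con (+ 4) ℤS.:* (p ℤS.:+ h ℤS.:* w ℤS.:+ w ℤS.:* w)) refl D₁ (norm a b ℤ.* norm x y) (polar x y a b) (n ℤ.* norm x y) ⟩
          _ ≡.∎
          where
          module ≡ = ≡-Reasoning
          rest = + 4 ℤ.* (polar x y a b ℤ.* (n ℤ.* norm x y) ℤ.+ (n ℤ.* norm x y) ℤ.* (n ℤ.* norm x y))

        ai-υ : AlmostIntegral υ
        ai-υ = ai-* (ai-el (x ℤ.+ D₁ ℤ.* y) (ℤ.- y)) ai-β

        module Coordinates (y₀ y₁ y₂ y₃ : ℚ) (υ≈ : υ ≈ quad y₀ y₁ y₂ y₃) where
          open ℚS using (_:+_; _:*_; _:-_; :-_; _:=_; con)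

          υ₁≈quad : τ₁ υ ≈ quad y₀ y₁ (ℚ.- y₂) (ℚ.- y₃)
          υ₁≈quad = τ₁-quad y₀ y₁ y₂ y₃ υ≈
          υ₂≈quad : τ₂ υ ≈ quad y₀ (ℚ.- y₁) y₂ (ℚ.- y₃)
          υ₂≈quad = τ₂-quad y₀ y₁ y₂ y₃ υ≈
          υ₃≈quad : τ₃ υ ≈ quad y₀ (ℚ.- y₁) (ℚ.- y₂) y₃
          υ₃≈quad = τ₃-quad y₀ y₁ y₂ y₃ υ≈

          -4y₁≡δ : ℚ.- (fromℤ (+ 4) ℚ.* y₁) ≡ fromℤ δ
          -4y₁≡δ = trans (ℚS.solve 1 (λ y → :- (con (+ 4) :* y) := :- y :+ :- y :+ :- y :+ :- y) refl y₁)
            (proj₁ (proj₂ (quad-injective _ _ _ _ _ _ _ _ (≈-trans (≈-sym (⊟ υ≈ ⊞ ⊟ υ₁≈quad ⊞ υ₂≈quad ⊞ υ₃≈quad))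
              (≈-trans Σ⁻≈ (≈-trans (≈-trans (*-congʳ ι1) (*-identityˡ _)) (≈-trans (wronskian a b x y) (quad-S δ))))))))

          4y₀≡A : fromℤ (+ 4) ℚ.* y₀ ≡ fromℤ A
          4y₀≡A = trans (ℚS.solve 1 (λ y → con (+ 4) :* y := y :+ y :+ y :+ y) refl y₀)
            (proj₁ (quad-injective _ _ _ _ _ _ _ _ (≈-trans (≈-sym (υ≈ ⊞ υ₁≈quad ⊞ υ₂≈quad ⊞ υ₃≈quad))
              (≈-trans Σ⁺≈ (≈-sym (quad-const (fromℤ A)))))))

          u≡1 : fromℤ (+ 16) ℚ.* (y₁ ℚ.* y₁) ≡ 1ℚ
          u≡1 = trans (ℚS.solve 1 (λ y → con (+ 16) :* (y :* y) := (:- (con (+ 4) :* y)) :* (:- (con (+ 4) :* y))) refl y₁)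
            (trans (cong (λ z → z ℚ.* z) -4y₁≡δ) (trans (sym (fromℤ-* δ δ)) (cong fromℤ det²)))

          ai-ρ : ∃₂ λ A′ B → ∃[ R ] (y₀ ℚ.+ y₀) ℚ.+ (y₀ ℚ.+ y₀) ≡ fromℤ A′ × (y₂ ℚ.+ y₂) ℚ.+ (y₂ ℚ.+ y₂) ≡ fromℤ B ×
            A′ ℤ.* A′ ℤ.- D₂ ℤ.* (B ℤ.* B) ≡ + 4 ℤ.* R
          ai-ρ = ai-second (y₀ ℚ.+ y₀) (y₂ ℚ.+ y₂)
            (≈-trans (υ≈ ⊞ υ₂≈quad) (quad-cong refl (ℚ.+-inverseʳ y₁) refl (ℚ.+-inverseʳ y₃)))
            (ai-+ ai-υ (ai-τ₂ ai-υ))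

          N₀ N₂ : ℚ
          N₀ = y₀ ℚ.* y₀ ℚ.+ y₁ ℚ.* (ℚ.- y₁) ℚ.* d₁ ℚ.+ y₂ ℚ.* y₂ ℚ.* d₂ ℚ.+ y₃ ℚ.* (ℚ.- y₃) ℚ.* (d₁ ℚ.* d₂)
          N₂ = y₀ ℚ.* y₂ ℚ.+ y₂ ℚ.* y₀ ℚ.+ y₁ ℚ.* (ℚ.- y₃) ℚ.* d₁ ℚ.+ y₃ ℚ.* (ℚ.- y₁) ℚ.* d₁

          ai-ν : ∃₂ λ X Z → ∃[ R ] N₀ ℚ.+ N₀ ≡ fromℤ X × N₂ ℚ.+ N₂ ≡ fromℤ Z × X ℤ.* X ℤ.- D₂ ℤ.* (Z ℤ.* Z) ≡ + 4 ℤ.* R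
          ai-ν = ai-second N₀ N₂
            (≈-trans (*-cong υ≈ υ₂≈quad) (≈-trans (quad-* y₀ y₁ y₂ y₃ y₀ (ℚ.- y₁) y₂ (ℚ.- y₃)) (quad-cong refl
              (ℚS.solve 5 (λ p q r s d → p :* (:- q) :+ q :* p :+ r :* (:- s) :* d :+ s :* r :* d := con 0ℤ) refl y₀ y₁ y₂ y₃ d₂)
              refl
              (ℚS.solve 4 (λ p q r s → p :* (:- s) :+ s :* p :+ q :* r :+ r :* (:- q) := con 0ℤ) refl y₀ y₁ y₂ y₃))))
            (ai-* ai-υ (ai-τ₂ ai-υ))

          bound : ∀ B → (y₂ ℚ.+ y₂) ℚ.+ (y₂ ℚ.+ y₂) ≡ fromℤ B → (B ℤ.* B) ℤ.* D₂ ℤ.< D₁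
          bound B 4y₂≡B = subst₂ ℤ._<_ (ℤ.+-identityʳ _) (ℤS.solve 2 (λ u v → u ℤS.:+ (v ℤS.:- u) ℤS.:= v) refl ((B ℤ.* B) ℤ.* D₂) D₁)
            (ℤ.+-monoʳ-< ((B ℤ.* B) ℤ.* D₂) (P-ℤ⁻¹ {D₁ ℤ.- (B ℤ.* B) ℤ.* D₂} (P-resp product (P-* (P-ℤ {+ 4} (ℤ.+<+ (ℕ.s≤s ℕ.z≤n))) (P-* (P-+ P-υ Pυ₃) (P-+ P-υ₁ Pυ₂))))))
            where
            w : ℚ
            w = (y₁ ℚ.+ y₁) ℚ.* (y₁ ℚ.+ y₁) ℚ.* d₁ ℚ.- (y₂ ℚ.+ y₂) ℚ.* (y₂ ℚ.+ y₂) ℚ.* d₂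
            product₀ : (- υ + τ₃ υ) * (- τ₁ υ + τ₂ υ) ≈ ι w
            product₀ = ≈-trans (*-cong (⊟ υ≈ ⊞ υ₃≈quad) (⊟ υ₁≈quad ⊞ υ₂≈quad))
              (≈-trans (quad-* _ _ _ _ _ _ _ _) (≈-trans (quad-cong
                (ℚS.solve 6 (λ p q r s d e → (:- p :+ p) :* (:- p :+ p) :+ (:- q :+ :- q) :* (:- q :+ :- q) :* d :+ (:- r :+ :- r) :* (:- (:- r) :+ r) :* e :+ (:- s :+ s) :* (:- (:- s) :+ :- s) :* (d :* e)
                  := (q :+ q) :* (q :+ q) :* d :- (r :+ r) :* (r :+ r) :* e) refl y₀ y₁ y₂ y₃ d₁ d₂)
                (ℚS.solve 5 (λ p q r s e → (:- p :+ p) :* (:- q :+ :- q) :+ (:- q :+ :- q) :* (:- p :+ p) :+ (:- r :+ :- r) :* (:- (:- s) :+ :- s) :* e :+ (:- s :+ s) :* (:- (:- r) :+ r) :* e := con 0ℤ) refl y₀ y₁ y₂ y₃ d₂)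
                (ℚS.solve 5 (λ p q r s d → (:- p :+ p) :* (:- (:- r) :+ r) :+ (:- r :+ :- r) :* (:- p :+ p) :+ (:- q :+ :- q) :* (:- (:- s) :+ :- s) :* d :+ (:- s :+ s) :* (:- q :+ :- q) :* d := con 0ℤ) refl y₀ y₁ y₂ y₃ d₁)
                (ℚS.solve 4 (λ p q r s → (:- p :+ p) :* (:- (:- s) :+ :- s) :+ (:- s :+ s) :* (:- p :+ p) :+ (:- q :+ :- q) :* (:- (:- r) :+ r) :+ (:- r :+ :- r) :* (:- q :+ :- q) := con 0ℤ) refl y₀ y₁ y₂ y₃))
                (quad-const w)))
            4w≡ : fromℤ (+ 4) ℚ.* w ≡ fromℤ (D₁ ℤ.- (B ℤ.* B) ℤ.* D₂)
            4w≡ = trans (ℚS.solve 4 (λ q r d e → con (+ 4) :* ((q :+ q) :* (q :+ q) :* d :- (r :+ r) :* (r :+ r) :* e)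
                    := (con (+ 16) :* (q :* q)) :* d :- (r :+ r :+ (r :+ r)) :* (r :+ r :+ (r :+ r)) :* e) refl y₁ y₂ d₁ d₂)
              (trans (cong₂ (λ v z → v ℚ.* d₁ ℚ.- z ℚ.* z ℚ.* d₂) u≡1 4y₂≡B)
              (trans (cong (ℚ._- fromℤ B ℚ.* fromℤ B ℚ.* d₂) (ℚ.*-identityˡ d₁))
              (sym (trans (fromℤ-minus D₁ ((B ℤ.* B) ℤ.* D₂)) (cong (λ z → d₁ ℚ.- z) (trans (fromℤ-* (B ℤ.* B) D₂) (cong (ℚ._* d₂) (fromℤ-* B B))))))))
            product : ιℤ (+ 4) * ((- υ + τ₃ υ) * (- τ₁ υ + τ₂ υ)) ≈ ιℤ (D₁ ℤ.- (B ℤ.* B) ℤ.* D₂)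
            product = ≈-trans (*-congˡ product₀) (≈-trans (≈-sym (ι-* (fromℤ (+ 4)) w)) (ι-cong 4w≡))

          norm-equation : ∀ B X Z → (y₂ ℚ.+ y₂) ℚ.+ (y₂ ℚ.+ y₂) ≡ fromℤ B → N₀ ℚ.+ N₀ ≡ fromℤ X → N₂ ℚ.+ N₂ ≡ fromℤ Z →
            + 8 ℤ.* (D₁ ℤ.* X) ≡ D₁ ℤ.* (A ℤ.* A) ℤ.+ D₁ ℤ.* (D₂ ℤ.* (B ℤ.* B)) ℤ.- D₁ ℤ.* D₁
              ℤ.- D₂ ℤ.* ((A ℤ.* B ℤ.- + 4 ℤ.* Z) ℤ.* (A ℤ.* B ℤ.- + 4 ℤ.* Z))
          norm-equation B X Z 4y₂≡B 2N₀≡X 2N₂≡Z = fromℤ-injective (≡.begin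
            fromℤ (+ 8 ℤ.* (D₁ ℤ.* X))
              ≡.≡⟨ trans (fromℤ-* (+ 8) (D₁ ℤ.* X)) (cong (fromℤ (+ 8) ℚ.*_) (trans (fromℤ-* D₁ X) (cong (d₁ ℚ.*_) (sym 2N₀≡X)))) ⟩
            fromℤ (+ 8) ℚ.* (d₁ ℚ.* (N₀ ℚ.+ N₀))
              ≡.≡⟨ ℚS.solve 6 (λ p q r s d e →
                   con (+ 8) :* (d :* ((p :* p :+ q :* (:- q) :* d :+ r :* r :* e :+ s :* (:- s) :* (d :* e)) :+ (p :* p :+ q :* (:- q) :* d :+ r :* r :* e :+ s :* (:- s) :* (d :* e))))
                   := d :* ((con (+ 4) :* p) :* (con (+ 4) :* p)) :+ d :* (e :* ((r :+ r :+ (r :+ r)) :* (r :+ r :+ (r :+ r))))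
                      :- (con (+ 16) :* (q :* q)) :* (d :* d) :- con 1ℤ :* (con (+ 16) :* (d :* d :* e :* (s :* s)))) refl y₀ y₁ y₂ y₃ d₁ d₂ ⟩
            F (fromℤ (+ 16) ℚ.* (y₁ ℚ.* y₁)) 1ℚ
              ≡.≡⟨ cong₂ F u≡1 (sym u≡1) ⟩
            F 1ℚ (fromℤ (+ 16) ℚ.* (y₁ ℚ.* y₁))
              ≡.≡⟨ ℚS.solve 6 (λ p q r s d e → let a = con (+ 4) :* p
                                                   b = r :+ r :+ (r :+ r)
                                                   n = p :* r :+ r :* p :+ q :* (:- s) :* d :+ s :* (:- q) :* d
                                                   z = n :+ n in
                   d :* (a :* a) :+ d :* (e :* (b :* b)) :- con 1ℤ :* (d :* d) :- (con (+ 16) :* (q :* q)) :* (con (+ 16) :* (d :* d :* e :* (s :* s)))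
                   := d :* (a :* a) :+ d :* (e :* (b :* b)) :- d :* d :- e :* ((a :* b :- con (+ 4) :* z) :* (a :* b :- con (+ 4) :* z))) refl y₀ y₁ y₂ y₃ d₁ d₂ ⟩
            G (fromℤ (+ 4) ℚ.* y₀) ((y₂ ℚ.+ y₂) ℚ.+ (y₂ ℚ.+ y₂)) (N₂ ℚ.+ N₂)
              ≡.≡⟨ trans (cong₂ (λ u v → G u v (N₂ ℚ.+ N₂)) 4y₀≡A 4y₂≡B) (cong (G (fromℤ A) (fromℤ B)) 2N₂≡Z) ⟩
            G (fromℤ A) (fromℤ B) (fromℤ Z)
              ≡.≡⟨ trans (fromℤ-minus (p₁ ℤ.+ p₂ ℤ.- p₃) p₄) (cong₂ ℚ._-_
                   (trans (fromℤ-minus (p₁ ℤ.+ p₂) p₃) (cong₂ ℚ._-_ (trans (fromℤ-+ p₁ p₂) (cong₂ ℚ._+_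
                     (trans (fromℤ-* D₁ (A ℤ.* A)) (cong (d₁ ℚ.*_) (fromℤ-* A A)))
                     (trans (fromℤ-* D₁ (D₂ ℤ.* (B ℤ.* B))) (cong (d₁ ℚ.*_) (trans (fromℤ-* D₂ (B ℤ.* B)) (cong (d₂ ℚ.*_) (fromℤ-* B B)))))))
                     (fromℤ-* D₁ D₁)))
                   (trans (fromℤ-* D₂ (g ℤ.* g)) (cong (d₂ ℚ.*_) (trans (fromℤ-* g g) (cong (λ z → z ℚ.* z)
                     (trans (fromℤ-minus (A ℤ.* B) (+ 4 ℤ.* Z)) (cong₂ ℚ._-_ (fromℤ-* A B) (fromℤ-* (+ 4) Z)))))))) ⟨
            fromℤ (p₁ ℤ.+ p₂ ℤ.- p₃ ℤ.- p₄) ≡.∎)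
            where
            module ≡ = ≡-Reasoning
            F : ℚ → ℚ → ℚ
            F u v = d₁ ℚ.* ((fromℤ (+ 4) ℚ.* y₀) ℚ.* (fromℤ (+ 4) ℚ.* y₀)) ℚ.+ d₁ ℚ.* (d₂ ℚ.* ((y₂ ℚ.+ y₂ ℚ.+ (y₂ ℚ.+ y₂)) ℚ.* (y₂ ℚ.+ y₂ ℚ.+ (y₂ ℚ.+ y₂))))
              ℚ.- u ℚ.* (d₁ ℚ.* d₁) ℚ.- v ℚ.* (fromℤ (+ 16) ℚ.* (d₁ ℚ.* d₁ ℚ.* d₂ ℚ.* (y₃ ℚ.* y₃)))
            G : ℚ → ℚ → ℚ → ℚ
            G a b z = d₁ ℚ.* (a ℚ.* a) ℚ.+ d₁ ℚ.* (d₂ ℚ.* (b ℚ.* b)) ℚ.- d₁ ℚ.* d₁ ℚ.- d₂ ℚ.* ((a ℚ.* b ℚ.- fromℤ (+ 4) ℚ.* z) ℚ.* (a ℚ.* b ℚ.- fromℤ (+ 4) ℚ.* z))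
            g p₁ p₂ p₃ p₄ : ℤ
            g  = A ℤ.* B ℤ.- + 4 ℤ.* Z
            p₁ = D₁ ℤ.* (A ℤ.* A)
            p₂ = D₁ ℤ.* (D₂ ℤ.* (B ℤ.* B))
            p₃ = D₁ ℤ.* D₁
            p₄ = D₂ ℤ.* (g ℤ.* g)

          impossible : (C₁ : Class D₁) (C₂ : Class D₂) → ¬ (C₁ ≼ C₂)
          impossible C₁ C₂ C₁≼C₂ =
            let A′ , B , R , 4y₀≡A′ , 4y₂≡B , eqR = ai-ρ
                X , Z , R′ , 2N₀≡X , 2N₂≡Z , eqX = ai-ν
            in conclude A′ B R X Z R′ 4y₀≡A′ 4y₂≡B eqR 2N₀≡X 2N₂≡Z eqX
            where
            conclude : ∀ A′ B R X Z R′ → (y₀ ℚ.+ y₀) ℚ.+ (y₀ ℚ.+ y₀) ≡ fromℤ A′ → (y₂ ℚ.+ y₂) ℚ.+ (y₂ ℚ.+ y₂) ≡ fromℤ B →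
              A′ ℤ.* A′ ℤ.- D₂ ℤ.* (B ℤ.* B) ≡ + 4 ℤ.* R → N₀ ℚ.+ N₀ ≡ fromℤ X → N₂ ℚ.+ N₂ ≡ fromℤ Z →
              X ℤ.* X ℤ.- D₂ ℤ.* (Z ℤ.* Z) ≡ + 4 ℤ.* R′ → ⊥
            conclude A′ B R X Z R′ 4y₀≡A′ 4y₂≡B eqR 2N₀≡X 2N₂≡Z eqX = no-solution {D₁} {D₂} {A} {B} {R} {κ} {X} {Z} {R′} 0<D₂ A²≡
              (subst (λ w → w ℤ.* w ℤ.- D₂ ℤ.* (B ℤ.* B) ≡ + 4 ℤ.* R) A′≡A eqR) eqX
              (norm-equation B X Z 4y₂≡B 2N₀≡X 2N₂≡Z) (bound B 4y₂≡B) C₁ C₂ C₁≼C₂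
              where
              A′≡A : A′ ≡ A
              A′≡A = fromℤ-injective (trans (sym 4y₀≡A′) (trans
                (ℚS.solve 1 (λ y → (y :+ y) :+ (y :+ y) := con (+ 4) :* y) refl y₀) 4y₀≡A))

sqrtℝ : ∀ D → 0ℤ ℤ.< D → ∃[ r ] (r *ℝ r) ≈ℝ constℝ (fromℤ D)
sqrtℝ (+ zero)  (ℤ.+<+ ())
sqrtℝ (+ suc n) _ = SquareRoot.√ n , SquareRoot.√²≈ n

module GeneratorProperties {c ℓ} {F : NumberField c ℓ} (G : QuadraticGenerator F) where
  open FieldProperties F
  open QuadraticGenerator G
  open FS using (_:+_; _:*_; _:-_; :-_; _:=_; con)
  open import Relation.Binary.Reasoning.Setoid setoid

  s≉ιℤ : ∀ h → ¬ (s - ιℤ h ≈ 0#)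
  s≉ιℤ h eq = 1≢0 (proj₂ (irrational (fromℤ (ℤ.- h)) 1ℚ (begin
    ιℤ (ℤ.- h) + ι 1ℚ * s  ≈⟨ +-congʳ (ιℤ-neg h) ⟩
    - ιℤ h + ι 1ℚ * s  ≈⟨ FS.solve 2 (λ h s → :- h :+ con 1ℤ :* s := s :- h) ≈-refl (ιℤ h) s ⟩
    s - ιℤ h  ≈⟨ eq ⟩
    0#  ∎)))
    where
    1≢0 : 1ℚ ≢ 0ℚ
    1≢0 ()

  s≉0 : ¬ (s ≈ 0#)
  s≉0 s≈0 = s≉ιℤ 0ℤ (≈-trans (+-cong s≈0 (-‿cong ι0)) (-‿inverseʳ 0#))

  nonsquare : ∀ h → h ℤ.* h ≢ D
  nonsquare h h²≡D = s≉ιℤ (ℤ.- h) (≈-trans (+-congˡ (-‿cong (ιℤ-neg h))) (xy≈0⇒x≈0 (s≉ιℤ h) (begin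
    (s - (- ιℤ h)) * (s - ιℤ h)  ≈⟨ FS.solve 2 (λ s h → (s :- (:- h)) :* (s :- h) := s :* s :- h :* h) ≈-refl s (ιℤ h) ⟩
    s * s - ιℤ h * ιℤ h  ≈⟨ +-cong s²≈D (-‿cong (≈-trans (≈-sym (ιℤ-* h h)) (ιℤ-cong h²≡D))) ⟩
    ιℤ D - ιℤ D  ≈⟨ -‿inverseʳ (ιℤ D) ⟩
    0#  ∎)))

  ordered⇒D-positive : Ordering F → 0ℤ ℤ.< D
  ordered⇒D-positive O = P-ℤ⁻¹ (P-resp s²≈D (P-sq s s≉0))
    where open OrderingProperties O

  -- A field without real embeddings has no indecomposables: α = 0 + α.
  imaginary : ¬ (0ℤ ℤ.< D) → ∀ α → ¬ Indecomposable F α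
  imaginary D≯0 α (α∈𝒪⁺ , irreducible) = irreducible (0# , α , (0-integral , 0-positive) , α∈𝒪⁺ , ≈-sym (+-identityˡ α))
    where
    0-integral : Integral F 0#
    0-integral = 0ℤ ∷ [] , ≈-trans (+-cong ι0 (zeroˡ 1#)) (+-identityˡ 0#)
    0-positive : TotallyPositive F 0#
    0-positive σ σ-mono = contradiction (ordered⇒D-positive (ordering F σ σ-mono)) D≯0

module Inclusion {c ℓ c′ ℓ′} {K : NumberField c ℓ} (L : QuadraticSubfield K c′ ℓ′) where
  open QuadraticSubfield L
  module KP = FieldProperties K
  module LP = FieldProperties field′
  module i = IsRingMonomorphism incl-mono
  open KP using (_≈_; ≈-trans; ≈-sym; ≈-refl)

  incl-ι : ∀ q → incl (LP.ι q) ≈ KP.ι q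
  incl-ι = KP.ι-unique (incl ∘ LP.ι) (Composition.isRingHomomorphism ≈-trans LP.ι-homo i.isRingHomomorphism)

  incl-evalMonic : ∀ as x → incl (evalMonic field′ as x) ≈ evalMonic K as (incl x)
  incl-evalMonic []       x = i.1#-homo
  incl-evalMonic (a ∷ as) x = ≈-trans (i.+-homo (LP.ιℤ a) (x LP.* evalMonic field′ as x))
    (KP.+-cong (incl-ι (fromℤ a)) (≈-trans (i.*-homo x (evalMonic field′ as x)) (KP.*-congˡ (incl-evalMonic as x))))

  incl-integral : ∀ {x} → Integral field′ x → Integral K (incl x)
  incl-integral {x} (as , eq) = as , ≈-trans (≈-sym (incl-evalMonic as x)) (≈-trans (i.⟦⟧-cong eq) i.0#-homo)

  restrict : ∀ σ → IsRingMonomorphism KP.rawRing ℝ-rawRing σ → IsRingMonomorphism LP.rawRing ℝ-rawRing (σ ∘ incl)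
  restrict σ σ-mono = Composition.isRingMonomorphism (λ {x} {y} {z} → ℝR.trans {x} {y} {z}) incl-mono σ-mono

  incl-𝒪⁺ : ∀ {x} → 𝒪⁺ field′ x → 𝒪⁺ K (incl x)
  incl-𝒪⁺ (int , pos) = incl-integral int , λ σ σ-mono → pos (σ ∘ incl) (restrict σ σ-mono)

  incl-linear : ∀ a b x → incl (LP.ι a LP.+ LP.ι b LP.* x) ≈ KP.ι a KP.+ KP.ι b KP.* incl x
  incl-linear a b x = ≈-trans (i.+-homo (LP.ι a) (LP.ι b LP.* x))
    (KP.+-cong (incl-ι a) (≈-trans (i.*-homo (LP.ι b) x) (KP.*-congʳ (incl-ι b))))

  incl-irrational : ∀ {x} → Irrational field′ x → Irrational K (incl x)
  incl-irrational {x} irr a b eq = irr a b (i.injective (≈-trans (incl-linear a b x) (≈-trans eq (≈-sym i.0#-homo))))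

between : ∀ {k} → 0ℤ ℤ.< k → 0ℤ ℤ.< + 2 ℤ.- k → k ≡ 1ℤ
between {k} 0<k 0<2-k = squeeze 0<k (subst₂ ℤ._<_ (ℤ.+-identityˡ k)
  (ℤS.solve 1 (λ k → ℤS.con (+ 2) ℤS.:- k ℤS.:+ k ℤS.:= ℤS.con (+ 2)) refl k) (ℤ.+-monoˡ-< k 0<2-k))
  where
  squeeze : ∀ {k} → 0ℤ ℤ.< k → k ℤ.< + 2 → k ≡ 1ℤ
  squeeze {+ zero}        (ℤ.+<+ ()) _
  squeeze {+ suc zero}    _ _ = refl
  squeeze {+ suc (suc n)} _ (ℤ.+<+ (ℕ.s≤s (ℕ.s≤s ())))

module Pair {c ℓ c′ ℓ′} {K : NumberField c ℓ} (degree≡4 : NumberField.degree K ≡ 4)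
  (L₁ L₂ : QuadraticSubfield K c′ ℓ′)
  (G₁ : QuadraticGenerator (QuadraticSubfield.field′ L₁)) (G₂ : QuadraticGenerator (QuadraticSubfield.field′ L₂))
  (L₁≢L₂ : ¬ (L₁ ≐ₛ L₂)) where

  open FieldProperties K
  open FS using (_:+_; _:*_; _:-_; :-_; _:=_; con)
  open import Relation.Binary.Reasoning.Setoid setoid
  private
    module I₁ = Inclusion L₁
    module I₂ = Inclusion L₂
    module L₁ = QuadraticSubfield L₁
    module L₂ = QuadraticSubfield L₂
    module F₁ = FieldProperties L₁.field′
    module F₂ = FieldProperties L₂.field′
    module G₁ = QuadraticGenerator G₁
    module G₂ = QuadraticGenerator G₂
    D₁ = G₁.D
    D₂ = G₂.D

  S T : Carrier
  S = L₁.incl G₁.s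
  T = L₂.incl G₂.s

  S²≈D₁ : S * S ≈ ιℤ D₁
  S²≈D₁ = ≈-trans (≈-sym (I₁.i.*-homo G₁.s G₁.s)) (≈-trans (I₁.i.⟦⟧-cong G₁.s²≈D) (I₁.incl-ι (fromℤ D₁)))

  T²≈D₂ : T * T ≈ ιℤ D₂
  T²≈D₂ = ≈-trans (≈-sym (I₂.i.*-homo G₂.s G₂.s)) (≈-trans (I₂.i.⟦⟧-cong G₂.s²≈D) (I₂.incl-ι (fromℤ D₂)))

  S-irrational : Irrational K S
  S-irrational = I₁.incl-irrational G₁.irrational

  T-irrational : Irrational K T
  T-irrational = I₂.incl-irrational G₂.irrational

  open Biquadratic K D₁ D₂ S T S²≈D₁ T²≈D₂

  T∉L₁ : ∀ t → ¬ (L₁.incl t ≈ T)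
  T∉L₁ t t≈T = let p , q , t≈ = G₁.generates t in same p q t≈
    where
    same : ∀ p q → F₁._≈_ t (F₁._+_ (F₁.ι p) (F₁._*_ (F₁.ι q) G₁.s)) → ⊥
    same p q t≈ = L₁≢L₂ λ x → to x , from x
      where
      T≈ : T ≈ ι p + ι q * S
      T≈ = ≈-trans (≈-sym t≈T) (≈-trans (I₁.i.⟦⟧-cong t≈) (I₁.incl-linear p q G₁.s))
      1≢0 : 1ℚ ≢ 0ℚ
      1≢0 ()
      q≢0 : q ≢ 0ℚ
      q≢0 q≡0 = 1≢0 (proj₂ (T-irrational (ℚ.- p) 1ℚ (begin
        ι (ℚ.- p) + ι 1ℚ * T  ≈⟨ +-cong (ι-neg p) (≈-trans (*-congʳ ι1) (≈-trans (*-identityˡ T) T≈)) ⟩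
        - ι p + (ι p + ι q * S)  ≈⟨ +-congˡ (+-congˡ (*-congʳ (ι-cong q≡0))) ⟩
        - ι p + (ι p + ι 0ℚ * S)  ≈⟨ FS.solve 2 (λ p s → :- p :+ (p :+ con 0ℤ :* s) := con 0ℤ) ≈-refl (ι p) S ⟩
        ι 0ℚ  ≈⟨ ι0 ⟩
        0#  ∎)))
      r = proj₁ (1/ι q q≢0)
      S≈ : S ≈ ι (ℚ.- (r ℚ.* p)) + ι r * T
      S≈ = begin
        S  ≈⟨ *-identityˡ S ⟨
        1# * S  ≈⟨ *-congʳ (≈-trans (≈-sym ι1) (≈-trans (ι-cong (sym (proj₂ (1/ι q q≢0)))) (ι-* r q))) ⟩
        (ι r * ι q) * S  ≈⟨ FS.solve 4 (λ r q s p → (r :* q) :* s := :- (r :* p) :+ r :* (p :+ q :* s)) ≈-refl (ι r) (ι q) S (ι p) ⟩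
        - (ι r * ι p) + ι r * (ι p + ι q * S)  ≈⟨ +-cong (≈-trans (ι-neg _) (-‿cong (ι-* r p))) (*-congˡ T≈) ⟨
        ι (ℚ.- (r ℚ.* p)) + ι r * T  ∎
      to : ∀ x → x ∈ₛ L₁ → x ∈ₛ L₂
      to x (y , y↦x) = let a , b , y≈ = G₁.generates y
                           z = F₂._+_ (F₂.ι (ℚ.- (r ℚ.* p))) (F₂._*_ (F₂.ι r) G₂.s)
                       in F₂._+_ (F₂.ι a) (F₂._*_ (F₂.ι b) z) , (begin
        L₂.incl _  ≈⟨ I₂.incl-linear a b z ⟩
        ι a + ι b * L₂.incl z  ≈⟨ +-congˡ (*-congˡ (≈-trans (I₂.incl-linear _ r G₂.s) (≈-sym S≈))) ⟩
        ι a + ι b * S  ≈⟨ I₁.incl-linear a b G₁.s ⟨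
        L₁.incl _  ≈⟨ I₁.i.⟦⟧-cong y≈ ⟨
        L₁.incl y  ≈⟨ y↦x ⟩
        x  ∎)
      from : ∀ x → x ∈ₛ L₂ → x ∈ₛ L₁
      from x (y , y↦x) = let a , b , y≈ = G₂.generates y in F₁._+_ (F₁.ι a) (F₁._*_ (F₁.ι b) t) , (begin
        L₁.incl _  ≈⟨ I₁.incl-linear a b t ⟩
        ι a + ι b * L₁.incl t  ≈⟨ +-congˡ (*-congˡ t≈T) ⟩
        ι a + ι b * T  ≈⟨ I₂.incl-linear a b G₂.s ⟨
        L₂.incl _  ≈⟨ I₂.i.⟦⟧-cong y≈ ⟨
        L₂.incl y  ≈⟨ y↦x ⟩
        x  ∎)

  c+dS≈0 : ∀ a b c d → quad a b c d ≈ 0# → ι c + ι d * S ≈ 0#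
  c+dS≈0 a b c d eq with (ι c + ι d * S) ≈? 0#
  ... | yes V≈0 = V≈0
  ... | no V≉0  = ⊥-elim (T∉L₁ t (*-cancelʳ V≉0 (begin
        L₁.incl t * V  ≈⟨ *-congʳ (≈-trans (I₁.i.*-homo _ w) (*-congʳ (≈-trans (I₁.i.-‿homo U′) (-‿cong (I₁.incl-linear a b G₁.s))))) ⟩
        (- U * L₁.incl w) * V  ≈⟨ *-congˡ (≈-sym (I₁.incl-linear c d G₁.s)) ⟩
        (- U * L₁.incl w) * L₁.incl V′  ≈⟨ ≈-trans (*-assoc _ _ _) (*-congˡ (≈-trans (*-comm _ _) (≈-sym (I₁.i.*-homo V′ w)))) ⟩
        - U * L₁.incl (F₁._*_ V′ w)  ≈⟨ *-congˡ (≈-trans (I₁.i.⟦⟧-cong V′w≈1) I₁.i.1#-homo) ⟩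
        - U * 1#  ≈⟨ *-identityʳ (- U) ⟩
        - U  ≈⟨ FS.solve 2 (λ u x → :- u := x :- (u :+ x)) ≈-refl U (T * V) ⟩
        T * V - (U + T * V)  ≈⟨ +-congˡ (-‿cong (≈-trans U+TV eq)) ⟩
        T * V - 0#  ≈⟨ FS.solve 2 (λ x z → x :- z := x :+ :- z) ≈-refl (T * V) 0# ⟩
        T * V + - 0#  ≈⟨ +-congˡ (≈-trans (-‿cong (≈-sym ι0)) (≈-trans (≈-sym (ι-neg 0ℚ)) ι0)) ⟩
        T * V + 0#  ≈⟨ +-identityʳ _ ⟩
        T * V  ∎)))
    where
    U V : Carrier
    U = ι a + ι b * S
    V = ι c + ι d * S
    U′ V′ : F₁.Carrier
    U′ = F₁._+_ (F₁.ι a) (F₁._*_ (F₁.ι b) G₁.s)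
    V′ = F₁._+_ (F₁.ι c) (F₁._*_ (F₁.ι d) G₁.s)
    V′≉0 : ¬ (F₁._≈_ V′ F₁.0#)
    V′≉0 V′≈0 = V≉0 (≈-trans (≈-sym (I₁.incl-linear c d G₁.s)) (≈-trans (I₁.i.⟦⟧-cong V′≈0) I₁.i.0#-homo))
    w = proj₁ (F₁.inverse V′ V′≉0)
    V′w≈1 = proj₂ (F₁.inverse V′ V′≉0)
    t = F₁._*_ (F₁.-_ U′) w
    U+TV : U + T * V ≈ quad a b c d
    U+TV = FS.solve 6 (λ a b c d s t → (a :+ b :* s) :+ t :* (c :+ d :* s) := a :+ b :* s :+ c :* t :+ d :* (s :* t)) ≈-refl (ι a) (ι b) (ι c) (ι d) S T

  quad-independent : ∀ a b c d → quad a b c d ≈ 0# → a ≡ 0ℚ × b ≡ 0ℚ × c ≡ 0ℚ × d ≡ 0ℚ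
  quad-independent a b c d eq =
    let V≈0 = c+dS≈0 a b c d eq
        c≡0 , d≡0 = S-irrational c d V≈0
        a≡0 , b≡0 = S-irrational a b (begin
          ι a + ι b * S  ≈⟨ +-identityʳ _ ⟨
          ι a + ι b * S + 0#  ≈⟨ +-congˡ (≈-trans (*-congˡ V≈0) (zeroʳ T)) ⟨
          ι a + ι b * S + T * (ι c + ι d * S)  ≈⟨ FS.solve 6 (λ a b c d s t → (a :+ b :* s) :+ t :* (c :+ d :* s) := a :+ b :* s :+ c :* t :+ d :* (s :* t)) ≈-refl (ι a) (ι b) (ι c) (ι d) S T ⟩
          quad a b c d  ≈⟨ eq ⟩
          0#  ∎)
    in a≡0 , b≡0 , c≡0 , d≡0

  quad-spans : ∀ x → ∃₂ λ a b → ∃₂ λ c d → x ≈ quad a b c d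
  quad-spans x =
    let a , x≈ = independent⇒spans degree≡4 v ind x
    in a 0′ , a 1′ , a 2′ , a 3′ , ≈-trans x≈ (∙≈quad a)
    where
    open LinearAlgebra K
    0′ 1′ 2′ 3′ : Fin 4
    0′ = zero
    1′ = suc zero
    2′ = suc (suc zero)
    3′ = suc (suc (suc zero))
    v : Fin 4 → Carrier
    v zero                   = 1#
    v (suc zero)             = S
    v (suc (suc zero))       = T
    v (suc (suc (suc zero))) = S * T
    ∙≈quad : ∀ a → a ∙ v ≈ quad (a 0′) (a 1′) (a 2′) (a 3′)
    ∙≈quad a = ≈-trans (+-cong (*-identityʳ _) (+-congˡ (+-congˡ (+-identityʳ _))))
      (FS.solve 4 (λ a b c d → a :+ (b :+ (c :+ d)) := a :+ b :+ c :+ d) ≈-refl (ι (a 0′)) (ι (a 1′) * S) (ι (a 2′) * T) (ι (a 3′) * (S * T)))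
    ind : Independent v
    ind a eq = pick (quad-independent _ _ _ _ (≈-trans (≈-sym (∙≈quad a)) eq))
      where
      pick : a 0′ ≡ 0ℚ × a 1′ ≡ 0ℚ × a 2′ ≡ 0ℚ × a 3′ ≡ 0ℚ → ∀ i → a i ≡ 0ℚ
      pick (p , _ , _ , _) zero                   = p
      pick (_ , p , _ , _) (suc zero)             = p
      pick (_ , _ , p , _) (suc (suc zero))       = p
      pick (_ , _ , _ , p) (suc (suc (suc zero))) = p

  -- Opaque, so that the automorphisms built from it do not unfold to the
  -- elimination procedure behind quad-spans.
  abstract
    isBasis : IsBasis
    isBasis = record { quad-independent = quad-independent ; quad-spans = quad-spans }

  module Real (0<D₁ : 0ℤ ℤ.< D₁) (0<D₂ : 0ℤ ℤ.< D₂) where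
    open Automorphisms isBasis using (module Extension)

    private
      module Eℝ = Extension ℝ-commutativeRing constℝ constℝ-homo
        (proj₁ (sqrtℝ D₁ 0<D₁)) (proj₁ (sqrtℝ D₂ 0<D₂)) (proj₂ (sqrtℝ D₁ 0<D₁)) (proj₂ (sqrtℝ D₂ 0<D₂))

    abstract
      embedding : ∃[ σ ] IsRingMonomorphism rawRing ℝ-rawRing σ
      embedding = Eℝ.ext , field-homomorphism-injective K ℝ-commutativeRing 0≉1ℝ Eℝ.ext-homo

    σ₀ : Carrier → ℝ
    σ₀ = proj₁ embedding

    σ₀-mono : IsRingMonomorphism rawRing ℝ-rawRing σ₀
    σ₀-mono = proj₂ embedding

    abstract
      O : Ordering K
      O = ordering K σ₀ σ₀-mono

      positive : ∀ {x} → TotallyPositive K x → Ordering.P O x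
      positive pos = pos σ₀ σ₀-mono

      conjugate-positive : ∀ {τ} → IsRingHomomorphism rawRing rawRing τ → ∀ {x} → TotallyPositive K x → Ordering.P O (τ x)
      conjugate-positive {τ} τ-homo pos = pos (σ₀ ∘ τ) (Composition.isRingMonomorphism (λ {x} {y} {z} → ℝR.trans {x} {y} {z})
        (field-homomorphism-injective K commutativeRing 1≉0 τ-homo) σ₀-mono)

    open OrderingProperties O

    private
      m = proj₁ (discriminant-square (Fundamental.discriminant G₁.fundamental))
      D₁²≡ = proj₂ (discriminant-square (Fundamental.discriminant G₁.fundamental))
    open Subfields K D₁ D₂ S T S²≈D₁ T²≈D₂ isBasis G₁.fundamental G₂.fundamental m D₁²≡
      using (module E₁; module E₂; module E₃; τ₁; τ₂; τ₁-quad; el; bar; el-cong; el-combination; el*bar; τ₂-el; det; norm; AlmostIntegral;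
        integral⇒ai; ai-first; ai-+; ai-τ₁; el-quad; module Traces)
    private module L₁-order = QuadraticOrder L₁.field′ G₁.s D₁ m G₁.s²≈D D₁²≡

    incl-el : ∀ x y → L₁.incl (L₁-order.el x y) ≈ el x y
    incl-el x y = ≈-trans (I₁.incl-linear (fromℤ x) (fromℤ y) L₁-order.ω) (+-congˡ (*-congˡ (≈-trans (I₁.i.*-homo _ _)
      (*-cong (I₁.incl-ι ½) (≈-trans (I₁.i.+-homo _ G₁.s) (+-congʳ (I₁.incl-ι (fromℤ D₁))))))))

    integral-coordinates : ∀ {α} → Integral L₁.field′ α → ∃₂ λ x y → L₁.incl α ≈ el x y
    integral-coordinates {α} int =
      let a , b , α≈ = G₁.generates α
      in ai-first a b (≈-trans (I₁.i.⟦⟧-cong α≈) (≈-trans (I₁.incl-linear a b G₁.s)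
           (FS.solve 4 (λ a b s t → a :+ b :* s := a :+ b :* s :+ con 0ℤ :* t :+ con 0ℤ :* (s :* t)) ≈-refl (ι a) (ι b) S T)))
         (integral⇒ai (I₁.incl-integral int))

    trace-coordinates : ∀ {β} → Integral K β → ∃₂ λ u v → β + τ₁ β ≈ el u v
    trace-coordinates {β} int =
      let a , b , c , d , β≈ = quad-spans β
      in ai-first (a ℚ.+ a) (b ℚ.+ b) (≈-trans (+-cong β≈ (τ₁-quad a b c d β≈)) (≈-trans (quad-+ a b c d a b (ℚ.- c) (ℚ.- d))
           (quad-cong refl refl (ℚ.+-inverseʳ c) (ℚ.+-inverseʳ d))))
         (ai-+ (integral⇒ai int) (ai-τ₁ (integral⇒ai int)))

    cramer : ∀ a b x y u v → det a b x y ℤ.* det a b x y ≡ 1ℤ →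
      ∃₂ λ k n → u ≡ k ℤ.* a ℤ.+ n ℤ.* x × v ≡ k ℤ.* b ℤ.+ n ℤ.* y
    cramer a b x y u v det² = δ ℤ.* (u ℤ.* y ℤ.- v ℤ.* x) , δ ℤ.* (a ℤ.* v ℤ.- b ℤ.* u)
      , trans (sym (trans (cong (ℤ._* u) det²) (ℤ.*-identityˡ u))) (ℤS.solve 6 (λ a b x y u v → let δ = a ℤS.:* y ℤS.:- x ℤS.:* b in
          (δ ℤS.:* δ) ℤS.:* u ℤS.:= (δ ℤS.:* (u ℤS.:* y ℤS.:- v ℤS.:* x)) ℤS.:* a ℤS.:+ (δ ℤS.:* (a ℤS.:* v ℤS.:- b ℤS.:* u)) ℤS.:* x) refl a b x y u v)
      , trans (sym (trans (cong (ℤ._* v) det²) (ℤ.*-identityˡ v))) (ℤS.solve 6 (λ a b x y u v → let δ = a ℤS.:* y ℤS.:- x ℤS.:* b in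
          (δ ℤS.:* δ) ℤS.:* v ℤS.:= (δ ℤS.:* (u ℤS.:* y ℤS.:- v ℤS.:* x)) ℤS.:* b ℤS.:+ (δ ℤS.:* (a ℤS.:* v ℤS.:- b ℤS.:* u)) ℤS.:* y) refl a b x y u v)
      where δ = det a b x y

    indecomposables-remain : (C₁ : Class D₁) (C₂ : Class D₂) → C₁ ≼ C₂ → IndecomposablesRemain L₁
    indecomposables-remain C₁ C₂ C₁≼C₂ α α-ind = α∈𝒪⁺ , λ (β , γ , β∈ , γ∈ , α≈β+γ) →
      from-coordinates (integral-coordinates (proj₁ (proj₁ α-ind))) β γ β∈ γ∈ α≈β+γ
      where
      α∈𝒪⁺ : 𝒪⁺ K (L₁.incl α)
      α∈𝒪⁺ = I₁.incl-𝒪⁺ (proj₁ α-ind)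
      module _ (a b : ℤ) (α≈ : L₁.incl α ≈ el a b) where
        Pα : P (el a b)
        Pα = P-resp α≈ (positive (proj₂ α∈𝒪⁺))
        Pᾱ : P (bar a b)
        Pᾱ = P-resp {τ₂ (L₁.incl α)} {bar a b} τ₂α≈ (conjugate-positive {τ₂} E₂.ext-homo {L₁.incl α} (proj₂ α∈𝒪⁺))
          where
          τ₂α≈ : τ₂ (L₁.incl α) ≈ bar a b
          τ₂α≈ = ≈-trans {τ₂ (L₁.incl α)} {τ₂ (el a b)} {bar a b} (E₂.ext-cong {L₁.incl α} {el a b} α≈) (τ₂-el a b)
        0<Nα : 0ℤ ℤ.< norm a b
        0<Nα = P-ℤ⁻¹ (P-resp (el*bar a b) (P-* Pα Pᾱ))
        module _ (x y : ℤ) (det² : det a b x y ℤ.* det a b x y ≡ 1ℤ) (Pη : P (el x y)) (P-η̄ : P (- bar x y)) where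
          coefficient-positive : ∀ {β} → TotallyPositive K β → ∀ k n →
            β + τ₁ β ≈ el (k ℤ.* a ℤ.+ n ℤ.* x) (k ℤ.* b ℤ.+ n ℤ.* y) → 0ℤ ℤ.< k
          coefficient-positive {β} pos k n = Traces.Mate.Summand.coefficient-positive O a b x y Pα Pᾱ det² Pη P-η̄ β (positive pos)
            (conjugate-positive E₁.ext-homo pos) (conjugate-positive E₂.ext-homo pos) (conjugate-positive E₃.ext-homo pos) k n

          half-impossible : ∀ {β} → 𝒪⁺ K β → ∀ n → ¬ (β + τ₁ β ≈ el (1ℤ ℤ.* a ℤ.+ n ℤ.* x) (1ℤ ℤ.* b ℤ.+ n ℤ.* y))
          half-impossible {β} (int , pos) n trace = from-quad (quad-spans (bar x y * β))
            where
            from-quad : ¬ (∃₂ λ y₀ y₁ → ∃₂ λ y₂ y₃ → bar x y * β ≈ quad y₀ y₁ y₂ y₃)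
            from-quad (y₀ , y₁ , y₂ , y₃ , υ≈) = Traces.Mate.Half.Coordinates.impossible O a b x y Pα Pᾱ det² Pη P-η̄ β (integral⇒ai int) (positive pos)
              (conjugate-positive E₁.ext-homo pos) (conjugate-positive E₂.ext-homo pos) (conjugate-positive E₃.ext-homo pos)
              n trace 0<D₂ y₀ y₁ y₂ y₃ υ≈ C₁ C₂ C₁≼C₂

          complement : ∀ {β γ} k n → L₁.incl α ≈ β + γ →
            β + τ₁ β ≈ el (k ℤ.* a ℤ.+ n ℤ.* x) (k ℤ.* b ℤ.+ n ℤ.* y) →
            γ + τ₁ γ ≈ el ((+ 2 ℤ.- k) ℤ.* a ℤ.+ (ℤ.- n) ℤ.* x) ((+ 2 ℤ.- k) ℤ.* b ℤ.+ (ℤ.- n) ℤ.* y)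
          complement {β} {γ} k n α≈β+γ trace = begin
            γ + τ₁ γ
              ≈⟨ FS.solve 4 (λ b g b′ g′ → g :+ g′ := ((b :+ g) :+ (b′ :+ g′)) :- (b :+ b′)) ≈-refl β γ (τ₁ β) (τ₁ γ) ⟩
            ((β + γ) + (τ₁ β + τ₁ γ)) - (β + τ₁ β)
              ≈⟨ +-cong (+-cong (≈-trans (≈-sym α≈β+γ) α≈) (≈-trans (≈-sym (E₁.ext-+ β γ)) τ₁α)) (-‿cong (≈-trans trace (el-combination k n a b x y))) ⟩
            (el a b + el a b) - (ιℤ k * el a b + ιℤ n * el x y)
              ≈⟨ FS.solve 4 (λ e f k n → (e :+ e) :- (k :* e :+ n :* f) := (con (+ 2) :- k) :* e :+ (:- n) :* f) ≈-refl (el a b) (el x y) (ιℤ k) (ιℤ n) ⟩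
            (ιℤ (+ 2) - ιℤ k) * el a b + - ιℤ n * el x y
              ≈⟨ +-cong (*-congʳ (≈-trans (ιℤ-+ (+ 2) (ℤ.- k)) (+-congˡ (ιℤ-neg k)))) (*-congʳ (ιℤ-neg n)) ⟨
            ιℤ (+ 2 ℤ.- k) * el a b + ιℤ (ℤ.- n) * el x y
              ≈⟨ el-combination (+ 2 ℤ.- k) (ℤ.- n) a b x y ⟨
            _ ∎
            where
            τ₁α : τ₁ (β + γ) ≈ el a b
            τ₁α = ≈-trans (E₁.ext-cong (≈-trans (≈-sym α≈β+γ) α≈)) (≈-trans (τ₁-quad _ _ _ _ (el-quad a b)) (≈-sym (el-quad a b)))

          with-η : ∀ β γ → 𝒪⁺ K β → 𝒪⁺ K γ → ¬ (L₁.incl α ≈ β + γ)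
          with-η β γ β∈ γ∈ α≈β+γ = from-trace (trace-coordinates (proj₁ β∈))
            where
            with-k : ∀ k n → ¬ (β + τ₁ β ≈ el (k ℤ.* a ℤ.+ n ℤ.* x) (k ℤ.* b ℤ.+ n ℤ.* y))
            with-k k n trace = half-impossible β∈ n
              (subst (λ k → β + τ₁ β ≈ el (k ℤ.* a ℤ.+ n ℤ.* x) (k ℤ.* b ℤ.+ n ℤ.* y))
                (between (coefficient-positive (proj₂ β∈) k n trace)
                  (coefficient-positive (proj₂ γ∈) (+ 2 ℤ.- k) (ℤ.- n) (complement k n α≈β+γ trace))) trace)
            from-cramer : ∀ u v → β + τ₁ β ≈ el u v → (∃₂ λ k n → u ≡ k ℤ.* a ℤ.+ n ℤ.* x × v ≡ k ℤ.* b ℤ.+ n ℤ.* y) → ⊥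
            from-cramer u v trace (k , n , u≡ , v≡) = with-k k n (≈-trans trace (el-cong u≡ v≡))
            from-trace : (∃₂ λ u v → β + τ₁ β ≈ el u v) → ⊥
            from-trace (u , v , trace) = from-cramer u v trace (cramer a b x y u v det²)

        mixed : ∃₂ λ x y → det a b x y ℤ.* det a b x y ≡ 1ℤ × norm x y ℤ.< 0ℤ
        mixed = L₁-order.Indecomposables.mixed-mate a b (I₁.i.injective (≈-trans α≈ (≈-sym (incl-el a b)))) α-ind 0<Nα
          0<D₁ (GeneratorProperties.nonsquare G₁)

        with-α : ∀ β γ → 𝒪⁺ K β → 𝒪⁺ K γ → ¬ (L₁.incl α ≈ β + γ)
        with-α = from-mixed mixed
          where
          from-oriented : (∃₂ λ x y → det a b x y ℤ.* det a b x y ≡ 1ℤ × P (el x y) × P (- bar x y)) →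
            ∀ β γ → 𝒪⁺ K β → 𝒪⁺ K γ → ¬ (L₁.incl α ≈ β + γ)
          from-oriented (x , y , det² , Pη , P-η̄) = with-η x y det² Pη P-η̄
          from-mixed : (∃₂ λ x y → det a b x y ℤ.* det a b x y ≡ 1ℤ × norm x y ℤ.< 0ℤ) →
            ∀ β γ → 𝒪⁺ K β → 𝒪⁺ K γ → ¬ (L₁.incl α ≈ β + γ)
          from-mixed (x , y , det² , N<0) = from-oriented (Traces.oriented-mate O a b x y det² N<0)

      from-coordinates : (∃₂ λ a b → L₁.incl α ≈ el a b) → ∀ β γ → 𝒪⁺ K β → 𝒪⁺ K γ → ¬ (L₁.incl α ≈ β + γ)
      from-coordinates (a , b , α≈) = with-α a b α≈

≼-total : ∀ {D₁ D₂} (C₁ : Class D₁) (C₂ : Class D₂) → C₁ ≼ C₂ ⊎ C₂ ≼ C₁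
≼-total {D₁} {D₂} C₁ C₂ with ℕ.<-cmp (rank C₁) (rank C₂)
... | tri< lt _ _ = inj₁ (inj₁ lt)
... | tri> _ _ gt = inj₂ (inj₁ gt)
... | tri≈ _ eq _ with ℤ.≤-total D₁ D₂
...   | inj₁ le = inj₁ (inj₂ (eq , le))
...   | inj₂ ge = inj₂ (inj₂ (sym eq , ge))

theorem1p5 : ∀ {c ℓ c′ ℓ′ : Level} (K : NumberField c ℓ) → IsRealBiquadratic K →
    (L : Fin 3 → QuadraticSubfield K c′ ℓ′) →
    (∀ i j → i ≢ j → ¬ (L i ≐ₛ L j)) →
    ∃₂ λ i j → i ≢ j × IndecomposablesRemain (L i) × IndecomposablesRemain (L j)
theorem1p5 K biquadratic L distinct = by-signs (0ℤ ℤ.<? D 0F) (0ℤ ℤ.<? D 1F) (0ℤ ℤ.<? D 2F)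
  where
  open IsRealBiquadratic biquadratic using (degree≡4)

  G : ∀ i → QuadraticGenerator (QuadraticSubfield.field′ (L i))
  G i = QuadraticField.quadraticGenerator (QuadraticSubfield.field′ (L i)) (QuadraticSubfield.degree≡2 (L i))

  D : Fin 3 → ℤ
  D i = QuadraticGenerator.D (G i)

  C : ∀ i → Class (D i)
  C i = classify (QuadraticGenerator.fundamental (G i))

  imaginary : ∀ i → ¬ (0ℤ ℤ.< D i) → IndecomposablesRemain (L i)
  imaginary i D≯0 α α-ind = contradiction α-ind (GeneratorProperties.imaginary (G i) D≯0 α)

  real : ∀ i j → i ≢ j → 0ℤ ℤ.< D i → 0ℤ ℤ.< D j → C i ≼ C j → IndecomposablesRemain (L i)
  real i j i≢j 0<Dᵢ 0<Dⱼ = Pair.Real.indecomposables-remain degree≡4 (L i) (L j) (G i) (G j) (distinct i j i≢j) 0<Dᵢ 0<Dⱼ (C i) (C j)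

  third : ∀ i j k → i ≢ j → 0ℤ ℤ.< D i → 0ℤ ℤ.< D j → 0ℤ ℤ.< D k
  third i j k i≢j 0<Dᵢ 0<Dⱼ = GeneratorProperties.ordered⇒D-positive (G k)
    (ordering (QuadraticSubfield.field′ (L k)) _ (Inclusion.restrict (L k) R.σ₀ R.σ₀-mono))
    where module R = Pair.Real degree≡4 (L i) (L j) (G i) (G j) (distinct i j i≢j) 0<Dᵢ 0<Dⱼ

  Goal = ∃₂ λ i j → i ≢ j × IndecomposablesRemain (L i) × IndecomposablesRemain (L j)

  all-real : (∀ i → 0ℤ ℤ.< D i) → Goal
  all-real 0<D = compare (≼-total (C 0F) (C 1F))
    where
    remain : ∀ i j → i ≢ j → C i ≼ C j → IndecomposablesRemain (L i)
    remain i j i≢j = real i j i≢j (0<D i) (0<D j)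
    compare : C 0F ≼ C 1F ⊎ C 1F ≼ C 0F → Goal
    compare (inj₁ 0≼1) with ≼-total (C 1F) (C 2F)
    ... | inj₁ 1≼2 = 0F , 1F , (λ ()) , remain 0F 1F (λ ()) 0≼1 , remain 1F 2F (λ ()) 1≼2
    ... | inj₂ 2≼1 = 0F , 2F , (λ ()) , remain 0F 1F (λ ()) 0≼1 , remain 2F 1F (λ ()) 2≼1
    compare (inj₂ 1≼0) with ≼-total (C 0F) (C 2F)
    ... | inj₁ 0≼2 = 1F , 0F , (λ ()) , remain 1F 0F (λ ()) 1≼0 , remain 0F 2F (λ ()) 0≼2
    ... | inj₂ 2≼0 = 1F , 2F , (λ ()) , remain 1F 0F (λ ()) 1≼0 , remain 2F 0F (λ ()) 2≼0

  by-signs : Dec (0ℤ ℤ.< D 0F) → Dec (0ℤ ℤ.< D 1F) → Dec (0ℤ ℤ.< D 2F) → Goal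
  by-signs (no p)  (no q)  _       = 0F , 1F , (λ ()) , imaginary 0F p , imaginary 1F q
  by-signs (no p)  (yes _) (no r)  = 0F , 2F , (λ ()) , imaginary 0F p , imaginary 2F r
  by-signs (yes _) (no q)  (no r)  = 1F , 2F , (λ ()) , imaginary 1F q , imaginary 2F r
  by-signs (yes p) (yes q) _       = all-real λ i → third 0F 1F i (λ ()) p q
  by-signs (yes p) (no _)  (yes r) = all-real λ i → third 0F 2F i (λ ()) p r
  by-signs (no _)  (yes q) (yes r) = all-real λ i → third 1F 2F i (λ ()) q r
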